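{- Let $T=\{1234,2341,4123\}$ and let $F_T(x)=\sum_{n\ge0}|S_n(T)|x^n$. Then $$F_T(x)=\frac{1-11x+51x^2-130x^3+199x^4-183x^5+91x^6-15x^7-6x^8+4x^9}{(1-x)^7(1-2x)^2}+\frac{1+x}{1-x}\big(C(x)-1\big),$$ where $C(x)=\frac{1-\sqrt{1-4x}}{2x}$.
   Context: $S_n$ is the set of permutations of $[n]$ ($S_0$ contains the empty permutation). A permutation avoids a pattern $\tau$ if it has no subsequence order-isomorphic to $\tau$; $S_n(T)$ is the set of permutations in $S_n$ avoiding every pattern in $T$. $C(x)$ is the Catalan generating function. -}

module Defs where

open import Data.Bool using (Bool; true; false; _∧_; _∨_; not; if_then_else_)
open import Data.Nat as ℕ using (ℕ; zero; suc; _<ᵇ_; _≡ᵇ_)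
open import Data.Nat.Combinatorics using (_C_)
open import Data.Nat.DivMod using (_/_)
open import Data.Integer as ℤ using (ℤ; +_; -_)
open import Data.List using (List; []; _∷_; length; map; concatMap; upTo; foldr; zipWith; _++_)
open import Data.Product using (_,_)
open import Relation.Binary.PropositionalEquality using (_≡_)
open import Function using (_∘_)

anyB : {A : Set} → (A → Bool) → List A → Bool
anyB p = foldr (λ x b → p x ∨ b) false

allB : {A : Set} → (A → Bool) → List A → Bool
allB p = foldr (λ x b → p x ∧ b) true

countB : {A : Set} → (A → Bool) → List A → ℕ
countB p = foldr (λ x c → if p x then suc c else c) 0

words : ℕ → ℕ → List (List ℕ)
words n zero    = [] ∷ []
words n (suc k) = concatMap (λ a → map (a ∷_) (words n k)) (upTo n)

distinct : List ℕ → Bool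
distinct []       = true
distinct (a ∷ as) = not (anyB (a ≡ᵇ_) as) ∧ distinct as

subseqs : List ℕ → List (List ℕ)
subseqs []       = [] ∷ []
subseqs (a ∷ as) = map (a ∷_) (subseqs as) ++ subseqs as

orderIso : List ℕ → List ℕ → Bool
orderIso s t =
  (length s ≡ᵇ length t) ∧
  allB (λ i → allB (λ j → eqB (at s i <ᵇ at s j) (at t i <ᵇ at t j))
                 (upTo (length s)))
      (upTo (length s))
  where
  at : List ℕ → ℕ → ℕ
  at []       _       = 0
  at (x ∷ _)  zero    = x
  at (_ ∷ xs) (suc i) = at xs i
  eqB : Bool → Bool → Bool
  eqB true  b = b
  eqB false b = not b

contains : List ℕ → List ℕ → Bool
contains w τ = anyB (λ s → orderIso s τ) (subseqs w)

avoidsAll : List (List ℕ) → List ℕ → Bool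
avoidsAll T w = allB (not ∘ contains w) T

-- |S_n(T)|: the number of permutations of [n] (written as words over
-- {0,…,n-1} with distinct letters) avoiding every pattern in T.
countAvoiders : List (List ℕ) → ℕ → ℕ
countAvoiders T n = countB (λ w → distinct w ∧ avoidsAll T w) (words n n)

Series : Set
Series = ℕ → ℤ

ΣZ : List ℤ → ℤ
ΣZ = foldr ℤ._+_ (+ 0)

_⊕_ : Series → Series → Series
(f ⊕ g) n = f n ℤ.+ g n

_⊖_ : Series → Series → Series
(f ⊖ g) n = f n ℤ.- g n

_⊛_ : Series → Series → Series
(f ⊛ g) n = ΣZ (map (λ k → f k ℤ.* g (n ℕ.∸ k)) (upTo (suc n)))

poly : List ℤ → Series
poly []       _       = + 0
poly (a ∷ _)  zero    = a
poly (_ ∷ as) (suc n) = poly as n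

-- Multiplicative inverse of a series f with f 0 = 1:
-- b₀ = 1,  b_{n} = - Σ_{k=1}^{n} f_k b_{n-k}.
-- invUpTo f n = [b_n, b_{n-1}, …, b_0].
invUpTo : Series → ℕ → List ℤ
invUpTo f zero    = + 1 ∷ []
invUpTo f (suc n) =
  let bs = invUpTo f n in
  (- ΣZ (zipWith ℤ._*_ (map (λ k → f (suc k)) (upTo (suc n))) bs)) ∷ bs

inv : Series → Series
inv f n with invUpTo f n
... | []    = + 0
... | b ∷ _ = b

-- Quotient f / g of power series (g with constant term 1).
_⊘_ : Series → Series → Series
f ⊘ g = f ⊛ inv g

_^^_ : Series → ℕ → Series
f ^^ zero  = poly (+ 1 ∷ [])
f ^^ suc k = f ⊛ (f ^^ k)

-- The Catalan generating function C(x) = (1 - √(1-4x))/(2x) = Σ Cat_n xⁿ.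

catalan : ℕ → ℕ
catalan n = ((2 ℕ.* n) C n) / suc n

C : Series
C n = + catalan n

F : List (List ℕ) → Series
F T n = + countAvoiders T n

-- T = {1234, 2341, 4123} (patterns written 0-based).
T3p29 : List (List ℕ)
T3p29 = (0 ∷ 1 ∷ 2 ∷ 3 ∷ []) ∷ (1 ∷ 2 ∷ 3 ∷ 0 ∷ []) ∷ (3 ∷ 0 ∷ 1 ∷ 2 ∷ []) ∷ []

numer : Series
numer = poly (+ 1 ∷ - + 11 ∷ + 51 ∷ - + 130 ∷ + 199 ∷ - + 183 ∷ + 91 ∷ - + 15 ∷ - + 6 ∷ + 4 ∷ [])

oneMinusX oneMinus2X onePlusX one : Series
oneMinusX  = poly (+ 1 ∷ - + 1 ∷ [])
oneMinus2X = poly (+ 1 ∷ - + 2 ∷ [])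
onePlusX   = poly (+ 1 ∷ + 1 ∷ [])
one        = poly (+ 1 ∷ [])

rhs3p29 : Series
rhs3p29 = (numer ⊘ ((oneMinusX ^^ 7) ⊛ (oneMinus2X ^^ 2)))
        ⊕ ((onePlusX ⊘ oneMinusX) ⊛ (C ⊖ one))

{-# OPTIONS --safe #-}
module Submission where

-- Read a permutation from left to right.  The values already read cut the remaining ones into blocks, and
-- avoiding T means that the remaining word, besides avoiding T itself, obeys conditions of a few kinds: inside
-- an interval of blocks it has no ascent, or no increasing triple; no letter above one cut precedes a letter
-- below another; no ascent above a cut is followed by a letter below it.  Reading one more letter replaces each
-- condition by similar ones, and up to some simple implications between them only twenty-one sets of conditions
-- ever occur.  The number of words obeying such a set depends on the block sizes only; it is a sum of ballot
-- numbers, powers of two and lattice path numbers.  Summing over the first letter, the ballot numbers add up to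
-- the Catalan numbers C(1) + ... + C(n) and C(0) + ... + C(n-1), and what is left is a polynomial in n plus a
-- multiple of 2 ^ n linear in n.

open import Defs
open import Data.Bool using (Bool; true; false; T; _∧_; _∨_; not; if_then_else_)
open import Data.Bool.ListAction using (any)
open import Data.Bool.Properties using (T-∧; T-∨; T-≡; ∧-zeroʳ)
open import Data.Empty using (⊥; ⊥-elim)
open import Data.Integer as ℤ using (ℤ; -_) renaming (+_ to ↑_)
import Data.Integer.Properties as ℤₚ
import Data.Integer.Tactic.RingSolver as ℤ-Solver
open import Data.List using (List; []; _∷_; _++_; map; concat; concatMap; foldr; length; take; drop; replicate; upTo; applyUpTo; zipWith; filterᵇ)
open import Data.List.Membership.Propositional using (_∈_)
open import Data.List.Membership.Propositional.Properties using (∈-++⁻; ∈-++⁺ʳ)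
open import Data.List.Properties using (++-assoc; ++-identityʳ; concat-++; length-++; length-map; length-upTo; map-++; map-applyUpTo; take++drop≡id)
open import Data.List.Relation.Binary.Permutation.Propositional using (_↭_; ↭-refl; ↭-sym; ↭-trans; prep; ↭⇒↭ₛ)
open import Data.List.Relation.Binary.Permutation.Propositional.Properties using (∈-resp-↭; shift)
import Data.List.Relation.Binary.Permutation.Setoid.Properties as Permₛ
open import Data.List.Relation.Binary.Sublist.Propositional using (_⊆_; []; _∷_; _∷ʳ_; minimum; ⊆-refl; ⊆-trans; from∈; to∈)
open import Data.List.Relation.Binary.Sublist.Propositional.Properties using (All-resp-⊆)
open import Data.List.Relation.Unary.All as All using (All; []; _∷_; reduce)
import Data.List.Relation.Unary.All.Properties as Allₚ
open import Data.List.Relation.Unary.AllPairs as AllPairs using (AllPairs; []; _∷_)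
import Data.List.Relation.Unary.AllPairs.Properties as AllPairsₚ
open import Data.List.Relation.Unary.Any using (here; there)
open import Data.List.Relation.Unary.Unique.Propositional using (Unique)
import Data.List.Relation.Unary.Unique.Propositional.Properties as Uniqueₚ
open import Data.Maybe using (Maybe; just; nothing; is-just; is-nothing; ap; _<∣>_; _>>=_)
open import Data.Nat using (ℕ; zero; suc; pred; _+_; _*_; _^_; _∸_; _≤_; _<_; z≤n; s≤s; _≤?_; _<?_; _≡ᵇ_; _<ᵇ_; _≤′_; ≤′-refl; ≤′-step)
open import Data.Nat.Combinatorics using (nCk+nC[k+1]≡[n+1]C[k+1]; nCk≡nC[n∸k]) renaming (_C_ to _choose_)
open import Data.Nat.DivMod using (m*n/n≡m; /-congˡ)
open import Data.Nat.ListAction using (sum)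
open import Data.Nat.Properties
import Data.Nat.Tactic.RingSolver as ℕ-Solver
open import Data.Product using (∃; _×_; _,_; proj₁; proj₂)
open import Data.Sum using (_⊎_; inj₁; inj₂)
open import Data.Unit using (⊤; tt)
open import Data.Vec as Vec using (Vec; []; _∷_)
open import Function using (_∘_; id; _⇔_; mk⇔; Equivalence)
open import Relation.Binary.PropositionalEquality
open import Relation.Nullary using (Dec; yes; no; ¬_; does)
open import Relation.Nullary.Decidable using (_×-dec_; _→-dec_; ¬?; dec⇒maybe; does-⇔; dec-false)

-- Words and forbidden patterns

-- The number of blocks grows with every letter read, so the point is to show that cuts can be
-- forgotten again. The implications between conditions are derived by rules that see only which
-- blocks are nonempty: `Entailment` compares two cuts by the number of nonempty blocks below them.
-- Hence every entry of the table `next` is a finite question, whatever the block sizes, and it is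
-- settled in both directions by a proof search that runs during type checking. The decisive rule is
-- `cyc-mid`: inside a decreasing interval the `cyc` conditions at the two ends and at one inner cut
-- imply those at all higher inner cuts. The chain `free`, `desc₀`, `desc₁`, `desc₂` gains a block
-- whenever its lowest block is split; because of this rule it closes up at `desc₂`. The counting
-- argument is independent of the formulas: any function that is 1 on the empty word and obeys the
-- recursion read off the table counts the words. For the formulas in `value` it is this recursion
-- that is verified.

In : ℕ → ℕ → ℕ → Set
In lo hi v = lo ≤ v × v < hi

in? : ∀ lo hi v → Dec (In lo hi v)
in? lo hi v = lo ≤? v ×-dec v <? hi

split : {A C : Set} → Dec A → (A → C) → (¬ A → C) → C
split (yes a) f g = f a
split (no a)  f g = g a

Along : (ℕ → List ℕ → Set) → List ℕ → Set
Along R []      = ⊤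
Along R (c ∷ w) = R c w × Along R w

along? : ∀ {R} → (∀ c w → Dec (R c w)) → ∀ w → Dec (Along R w)
along? R? []      = yes tt
along? R? (c ∷ w) = R? c w ×-dec along? R? w

along-lookup : ∀ {R x xs w} → Along R w → x ∷ xs ⊆ w → ∃ λ w′ → R x w′ × xs ⊆ w′
along-lookup (_ , a) (_ ∷ʳ s)   = along-lookup a s
along-lookup (r , _) (refl ∷ s) = _ , r , s

along-tabulate : ∀ {R} w → (∀ {x w′} → (∀ {xs} → xs ⊆ w′ → x ∷ xs ⊆ w) → R x w′) → Along R w
along-tabulate []      f = tt
along-tabulate (c ∷ w) f = f (refl ∷_) , along-tabulate w (λ g → f (λ s → c ∷ʳ g s))

-- Each condition demands the previous one of the suffix after every letter of the interval, with
-- the lower end raised past that letter: no letter, no ascent, no increasing triple.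
Emp Dcr Inc : ℕ → ℕ → List ℕ → Set
Emp lo hi = Along (λ c _ → ¬ In lo hi c)
Dcr lo hi = Along (λ c w → In lo hi c → Emp (suc c) hi w)
Inc lo hi = Along (λ c w → In lo hi c → Dcr (suc c) hi w)

Bar : ℕ → ℕ → List ℕ → Set
Bar s t = Along (λ c w → t ≤ c → Emp 0 s w)

Cyc : ℕ → List ℕ → Set
Cyc s = Along (λ c w → s ≤ c → Bar s (suc c) w)

-- With `c` as first letter of an occurrence, the three conditions exclude 1234, 4123 and 2341, in
-- this order. A single bound `suc c` separates small from large, because `c` does not occur again.
Av : ℕ → List ℕ → Set
Av n = Along (λ c w → Inc (suc c) n w × Inc 0 (suc c) w × Cyc (suc c) w)

emp? : ∀ lo hi w → Dec (Emp lo hi w)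
emp? lo hi = along? λ c _ → ¬? (in? lo hi c)

dcr? : ∀ lo hi w → Dec (Dcr lo hi w)
dcr? lo hi = along? λ c w → in? lo hi c →-dec emp? (suc c) hi w

inc? : ∀ lo hi w → Dec (Inc lo hi w)
inc? lo hi = along? λ c w → in? lo hi c →-dec dcr? (suc c) hi w

bar? : ∀ s t w → Dec (Bar s t w)
bar? s t = along? λ c w → t ≤? c →-dec emp? 0 s w

cyc? : ∀ s w → Dec (Cyc s w)
cyc? s = along? λ c w → s ≤? c →-dec bar? s (suc c) w

av? : ∀ n w → Dec (Av n w)
av? n = along? λ c w → inc? (suc c) n w ×-dec inc? 0 (suc c) w ×-dec cyc? (suc c) w

module _ {w : List ℕ} where

  emp→ : ∀ {lo hi x} → Emp lo hi w → x ∷ [] ⊆ w → lo ≤ x → x < hi → ⊥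
  emp→ e s l h = let _ , r , _ = along-lookup e s in r (l , h)

  →emp : ∀ {lo hi} → (∀ {x} → x ∷ [] ⊆ w → lo ≤ x → x < hi → ⊥) → Emp lo hi w
  →emp f = along-tabulate w λ g (l , h) → f (g (minimum _)) l h

module _ {w : List ℕ} where

  dcr→ : ∀ {lo hi x y} → Dcr lo hi w → x ∷ y ∷ [] ⊆ w → lo ≤ x → x < y → y < hi → ⊥
  dcr→ d s l lt h = let _ , r , s′ = along-lookup d s in emp→ (r (l , <-trans lt h)) s′ lt h

  →dcr : ∀ {lo hi} → (∀ {x y} → x ∷ y ∷ [] ⊆ w → lo ≤ x → x < y → y < hi → ⊥) → Dcr lo hi w
  →dcr f = along-tabulate w λ g (l , _) → →emp λ s lt h → f (g s) l lt h

  bar→ : ∀ {s t x y} → Bar s t w → x ∷ y ∷ [] ⊆ w → t ≤ x → y < s → ⊥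
  bar→ b s l h = let _ , r , s′ = along-lookup b s in emp→ (r l) s′ z≤n h

  →bar : ∀ {s t} → (∀ {x y} → x ∷ y ∷ [] ⊆ w → t ≤ x → y < s → ⊥) → Bar s t w
  →bar f = along-tabulate w λ g l → →emp λ s _ h → f (g s) l h

module _ {w : List ℕ} where

  inc→ : ∀ {lo hi x y z} → Inc lo hi w → x ∷ y ∷ z ∷ [] ⊆ w →
         lo ≤ x → x < y → y < z → z < hi → ⊥
  inc→ i s l xy yz h =
    let _ , r , s′ = along-lookup i s in
    dcr→ (r (l , <-trans xy (<-trans yz h))) s′ xy yz h

  →inc : ∀ {lo hi} → (∀ {x y z} → x ∷ y ∷ z ∷ [] ⊆ w → lo ≤ x → x < y → y < z → z < hi → ⊥) →
         Inc lo hi w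
  →inc f = along-tabulate w λ g (l , _) → →dcr λ s xy yz h → f (g s) l xy yz h

  cyc→ : ∀ {s x y z} → Cyc s w → x ∷ y ∷ z ∷ [] ⊆ w → s ≤ x → x < y → z < s → ⊥
  cyc→ c s l xy h = let _ , r , s′ = along-lookup c s in bar→ (r l) s′ xy h

  →cyc : ∀ {s} → (∀ {x y z} → x ∷ y ∷ z ∷ [] ⊆ w → s ≤ x → x < y → z < s → ⊥) → Cyc s w
  →cyc f = along-tabulate w λ g l → →bar λ s xy h → f (g s) l xy h

precede : ∀ {w : List ℕ} {x y} → x ∷ [] ⊆ w → y ∷ [] ⊆ w → x ≢ y → x ∷ y ∷ [] ⊆ w ⊎ y ∷ x ∷ [] ⊆ w
precede (refl ∷ _) (refl ∷ _) ne = ⊥-elim (ne refl)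
precede (refl ∷ _) (_ ∷ʳ t)   ne = inj₁ (refl ∷ t)
precede (_ ∷ʳ s)   (refl ∷ _) ne = inj₂ (refl ∷ s)
precede (c ∷ʳ s)   (_ ∷ʳ t)   ne with precede s t ne
... | inj₁ p = inj₁ (c ∷ʳ p)
... | inj₂ p = inj₂ (c ∷ʳ p)

absent : ∀ {c} {w : List ℕ} → All (c ≢_) w → c ∷ [] ⊆ w → ⊥
absent a s = All.lookup a (to∈ s) refl

first : ∀ {x} {xs w : List ℕ} → x ∷ xs ⊆ w → x ∷ [] ⊆ w
first s = ⊆-trans (refl ∷ minimum _) s

rest : ∀ {x} {xs w : List ℕ} → x ∷ xs ⊆ w → xs ⊆ w
rest s = ⊆-trans (_ ∷ʳ ⊆-refl) s

front outer : ∀ {x y z} {w : List ℕ} → x ∷ y ∷ z ∷ [] ⊆ w → _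
front {x} {y} {z} {w} s = ⊆-trans {i = x ∷ y ∷ []} {k = w} (refl ∷ refl ∷ (z ∷ʳ [])) s
outer {x} {y} {z} {w} s = ⊆-trans {i = x ∷ z ∷ []} {k = w} (refl ∷ (y ∷ʳ (refl ∷ []))) s

-- Since letters do not repeat, `y` has the same position in both subsequences, so they can be
-- joined there.
link : ∀ {w : List ℕ} {x y z} → Unique w → x ∷ y ∷ [] ⊆ w → y ∷ z ∷ [] ⊆ w → x ∷ y ∷ z ∷ [] ⊆ w
link (_ ∷ u) (c ∷ʳ s)   (_ ∷ʳ t)   = c ∷ʳ link u s t
link (_ ∷ u) (refl ∷ s) (_ ∷ʳ t)   = refl ∷ t
link (a ∷ _) (_ ∷ʳ s)   (refl ∷ _) = ⊥-elim (absent a (rest s))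
link (a ∷ _) (refl ∷ s) (refl ∷ _) = ⊥-elim (absent a s)

-- Constraints on the remaining letters and their consequences

-- The cuts between the blocks of remaining letters are numbered from below, block s lying between the
-- cuts s and suc s; Θ gives their values.
data Con : Set where
  bot             : Con
  emp dec inc bar : (s t : ℕ) → Con
  cyc             : (s : ℕ) → Con

⟦_⟧ : Con → (ℕ → ℕ) → List ℕ → Set
⟦ bot     ⟧ Θ w = ⊥
⟦ emp s t ⟧ Θ w = Emp (Θ s) (Θ t) w
⟦ dec s t ⟧ Θ w = Dcr (Θ s) (Θ t) w
⟦ inc s t ⟧ Θ w = Inc (Θ s) (Θ t) w
⟦ bar s t ⟧ Θ w = Bar (Θ s) (Θ t) w
⟦ cyc s   ⟧ Θ w = Cyc (Θ s) w

holds? : ∀ k Θ w → Dec (⟦ k ⟧ Θ w)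
holds? bot       Θ w = no λ ()
holds? (emp s t) Θ w = emp? (Θ s) (Θ t) w
holds? (dec s t) Θ w = dcr? (Θ s) (Θ t) w
holds? (inc s t) Θ w = inc? (Θ s) (Θ t) w
holds? (bar s t) Θ w = bar? (Θ s) (Θ t) w
holds? (cyc s)   Θ w = cyc? (Θ s) w

pure : {A : Set} → A → Maybe A
pure = just

_<*>_ : {A B : Set} → Maybe (A → B) → Maybe A → Maybe B
_<*>_ = ap

-- In use, `rk` counts the nonempty blocks below a cut and `m` is the topmost cut. Then `s ≼ t`
-- means that no letter lies at or above cut t and below cut s, and `s ≺ t` that some letter lies
-- between cuts s and t.
module Entailment (rk : ℕ → ℕ) (m : ℕ) where

  infix 4 _≼_ _≺_

  _≼_ _≺_ : ℕ → ℕ → Set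
  s ≼ t = rk s ≤ rk t
  s ≺ t = rk s < rk t

  infix 3 _⊢_

  data _⊢_ (K : List Con) : Con → Set where
    hyp      : ∀ {k} → k ∈ K → K ⊢ k
    bot-emp  : ∀ {s t} → K ⊢ emp s t → s ≺ t → K ⊢ bot
    bot-bar  : ∀ {s t a b} → K ⊢ bar s t → K ⊢ dec a b → s ≼ t → a ≺ s → t ≺ b → K ⊢ bot
    emp-triv : ∀ {s t} → t ≼ s → K ⊢ emp s t
    dec-triv : ∀ {s t} → t ≼ s → K ⊢ dec s t
    dec-mono : ∀ {s t a b} → K ⊢ dec a b → a ≼ s → t ≼ b → K ⊢ dec s t
    dec-lap  : ∀ {s t a b c d} → K ⊢ dec a b → K ⊢ dec c d → a ≼ s → c ≺ b → t ≼ d → K ⊢ dec s t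
    dec-bar  : ∀ {s t a b c d} → K ⊢ inc a b → K ⊢ bar c d →
               a ≼ s → t ≼ c → c ≼ d → d ≺ b → K ⊢ dec s t
    inc-triv : ∀ {s t} → t ≼ s → K ⊢ inc s t
    inc-mono : ∀ {s t a b} → K ⊢ inc a b → a ≼ s → t ≼ b → K ⊢ inc s t
    inc-dec  : ∀ {s t a b} → K ⊢ dec a b → a ≼ s → t ≼ b → K ⊢ inc s t
    inc-lap  : ∀ {s t a b c d} → K ⊢ inc a b → K ⊢ dec c d → a ≼ s → c ≺ b → t ≼ d → K ⊢ inc s t
    inc-two  : ∀ {s t a b c d} → K ⊢ dec a b → K ⊢ dec c d → a ≼ s → c ≼ b → t ≼ d → K ⊢ inc s t
    bar-low  : ∀ {s t} → s ≼ 0 → K ⊢ bar s t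
    bar-top  : ∀ {s t} → m ≼ t → K ⊢ bar s t
    bar-mono : ∀ {s t a b} → K ⊢ bar a b → s ≼ a → b ≼ t → K ⊢ bar s t
    bar-up   : ∀ {s t a b c d} → K ⊢ bar a b → K ⊢ dec c d → c ≺ a → b ≼ t → s ≼ d → K ⊢ bar s t
    bar-down : ∀ {s t a b c d} → K ⊢ bar a b → K ⊢ dec c d → s ≼ a → c ≼ t → b ≺ d → K ⊢ bar s t
    cyc-low  : ∀ {s} → s ≼ 0 → K ⊢ cyc s
    cyc-top  : ∀ {s} → m ≼ s → K ⊢ cyc s
    cyc-mono : ∀ {s t} → K ⊢ cyc t → s ≼ t → t ≼ s → K ⊢ cyc s
    cyc-dec  : ∀ {s a b} → K ⊢ dec a b → a ≼ s → m ≼ b → K ⊢ cyc s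
    cyc-bar  : ∀ {s a b c d} → K ⊢ inc a b → K ⊢ bar c d → a ≼ s → s ≼ c → d ≺ b → K ⊢ cyc s
    cyc-two  : ∀ {s a b c d e f} → K ⊢ bar c d → K ⊢ dec a b → K ⊢ dec e f →
               s ≼ c → a ≼ s → d ≼ b → e ≼ d → m ≼ f → K ⊢ cyc s
    cyc-mid  : ∀ {s a b a′ b′ r} → K ⊢ dec a b → K ⊢ cyc r → K ⊢ cyc a′ → K ⊢ cyc b′ →
               a ≺ r → r ≺ s → s ≺ b → a ≼ a′ → a′ ≼ a → b ≼ b′ → b′ ≼ b → K ⊢ cyc s

  _≼?_ : ∀ s t → Maybe (s ≼ t)
  s ≼? t = dec⇒maybe (rk s ≤? rk t)

  _≺?_ : ∀ s t → Maybe (s ≺ t)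
  s ≺? t = dec⇒maybe (rk s <? rk t)

  module _ {K : List Con} (known : List (∃ (K ⊢_))) where

    module _ {X : Set} where

      some : (∃ (K ⊢_) → Maybe X) → Maybe X
      some f = foldr (λ d r → f d <∣> r) nothing known

      with-emp : (∀ s t → K ⊢ emp s t → Maybe X) → Maybe X
      with-emp f = some λ { (emp s t , d) → f s t d ; _ → nothing }

      with-dec : (∀ s t → K ⊢ dec s t → Maybe X) → Maybe X
      with-dec f = some λ { (dec s t , d) → f s t d ; _ → nothing }

      with-inc : (∀ s t → K ⊢ inc s t → Maybe X) → Maybe X
      with-inc f = some λ { (inc s t , d) → f s t d ; _ → nothing }

      with-bar : (∀ s t → K ⊢ bar s t → Maybe X) → Maybe X
      with-bar f = some λ { (bar s t , d) → f s t d ; _ → nothing }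

      with-cyc : (∀ s → K ⊢ cyc s → Maybe X) → Maybe X
      with-cyc f = some λ { (cyc s , d) → f s d ; _ → nothing }

    -- One rule is applied to facts already known, and the free cuts of the rule are taken from
    -- these facts; the search therefore has no depth.
    search : ∀ k → Maybe (K ⊢ k)
    search bot =
          with-emp (λ s t d → ⦇ (bot-emp d) (s ≺? t) ⦈)
      <∣> with-bar (λ s t d → with-dec λ a b e → ⦇ (bot-bar d e) (s ≼? t) (a ≺? s) (t ≺? b) ⦈)
    search (emp s t) = ⦇ emp-triv (t ≼? s) ⦈
    search (dec s t) =
          ⦇ dec-triv (t ≼? s) ⦈
      <∣> with-dec (λ a b d → ⦇ (dec-mono d) (a ≼? s) (t ≼? b) ⦈)
      <∣> with-dec (λ a b d → with-dec λ c f e → ⦇ (dec-lap d e) (a ≼? s) (c ≺? b) (t ≼? f) ⦈)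
      <∣> with-inc (λ a b d → with-bar λ c f e →
            ⦇ (dec-bar d e) (a ≼? s) (t ≼? c) (c ≼? f) (f ≺? b) ⦈)
    search (inc s t) =
          ⦇ inc-triv (t ≼? s) ⦈
      <∣> with-inc (λ a b d → ⦇ (inc-mono d) (a ≼? s) (t ≼? b) ⦈)
      <∣> with-dec (λ a b d → ⦇ (inc-dec d) (a ≼? s) (t ≼? b) ⦈)
      <∣> with-dec (λ c f e → with-inc (λ a b d → ⦇ (inc-lap d e) (a ≼? s) (c ≺? b) (t ≼? f) ⦈)
                          <∣> with-dec (λ a b d → ⦇ (inc-two d e) (a ≼? s) (c ≼? b) (t ≼? f) ⦈))
    search (bar s t) =
          ⦇ bar-low (s ≼? 0) ⦈
      <∣> ⦇ bar-top (m ≼? t) ⦈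
      <∣> with-bar (λ a b d → ⦇ (bar-mono d) (s ≼? a) (b ≼? t) ⦈)
      <∣> with-bar (λ a b d → with-dec λ c f e →
            ⦇ (bar-up d e) (c ≺? a) (b ≼? t) (s ≼? f) ⦈
        <∣> ⦇ (bar-down d e) (s ≼? a) (c ≼? t) (b ≺? f) ⦈)
    search (cyc s) =
          ⦇ cyc-low (s ≼? 0) ⦈
      <∣> ⦇ cyc-top (m ≼? s) ⦈
      <∣> with-cyc (λ t d → ⦇ (cyc-mono d) (s ≼? t) (t ≼? s) ⦈)
      <∣> with-dec (λ a b d → ⦇ (cyc-dec d) (a ≼? s) (m ≼? b) ⦈)
      <∣> with-bar (λ c f e → with-inc λ a b d → ⦇ (cyc-bar d e) (a ≼? s) (s ≼? c) (f ≺? b) ⦈)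
      <∣> with-bar (λ c g e → with-dec λ a b d → with-dec λ x y f →
            ⦇ (cyc-two e d f) (s ≼? c) (a ≼? s) (g ≼? b) (x ≼? g) (m ≼? y) ⦈)
      <∣> with-dec (λ a b d → with-cyc λ r c → with-cyc λ a′ ca → with-cyc λ b′ cb →
            ⦇ (cyc-mid d c ca cb) (a ≺? r) (r ≺? s) (s ≺? b) (a ≼? a′) (a′ ≼? a) (b ≼? b′) (b′ ≼? b) ⦈)

  proves : ∀ {K} → List (∃ (K ⊢_)) → ∀ T → Maybe (All (K ⊢_) T)
  proves known []      = just []
  proves known (k ∷ T) = ⦇ search known k ∷ proves known T ⦈

  hypotheses : ∀ K → List (∃ (K ⊢_))
  hypotheses K = reduce (λ {k} k∈ → k , hyp k∈) (All.tabulate {xs = K} id)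

  -- The hints are proved first, in order; they replace a deeper search.
  entails : ∀ K → List Con → ∀ T → Maybe (All (K ⊢_) T)
  entails K hints T = go ((cyc 0 , cyc-low ≤-refl) ∷ hypotheses K) hints
    where
    go : List (∃ (K ⊢_)) → List Con → Maybe (All (K ⊢_) T)
    go known []      = proves known T
    go known (h ∷ hs) = search known h >>= λ d → go ((h , d) ∷ known) hs

  module Sound {w} (u : Unique w) (Θ : ℕ → ℕ)
    (≼-sound : ∀ {s t} → s ≼ t → ∀ {v} → v ∷ [] ⊆ w → Θ t ≤ v → Θ s ≤ v)
    (≺-sound : ∀ {s t} → s ≺ t → ∃ λ z → z ∷ [] ⊆ w × Θ s ≤ z × z < Θ t)
    (bounded : ∀ {v} → v ∷ [] ⊆ w → Θ 0 ≤ v × v < Θ m) where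

    below : ∀ {s t} → s ≼ t → ∀ {v} → v ∷ [] ⊆ w → v < Θ s → v < Θ t
    below p v∈ v<s = ≰⇒> λ t≤v → <⇒≱ v<s (≼-sound p v∈ t≤v)

    later : ∀ {lo hi x y} → Dcr lo hi w → x ∷ [] ⊆ w → y ∷ [] ⊆ w →
            lo ≤ x → x < y → y < hi → y ∷ x ∷ [] ⊆ w
    later d x∈ y∈ l lt h with precede x∈ y∈ (<⇒≢ lt)
    ... | inj₁ s = ⊥-elim (dcr→ d s l lt h)
    ... | inj₂ s = s

    after : ∀ {s t x y} → Bar s t w → x ∷ [] ⊆ w → y ∷ [] ⊆ w →
            x < y → x < s → t ≤ y → x ∷ y ∷ [] ⊆ w
    after b x∈ y∈ lt l h with precede x∈ y∈ (<⇒≢ lt)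
    ... | inj₁ s = s
    ... | inj₂ s = ⊥-elim (bar→ b s h l)

    sound : ∀ {K k} → All (λ k → ⟦ k ⟧ Θ w) K → K ⊢ k → ⟦ k ⟧ Θ w
    sound h (hyp k∈) = All.lookup h k∈
    sound h (bot-emp d p) =
      let z , z∈ , l , g = ≺-sound p in emp→ (sound h d) z∈ l g
    -- The bar puts the low letter before the high one, which is an ascent inside the decreasing
    -- interval.
    sound h (bot-bar d e st as tb) =
      let z  , z∈  , lz  , hz  = ≺-sound as
          z′ , z′∈ , lz′ , hz′ = ≺-sound tb
          z<z′ = <-≤-trans hz (≼-sound st z′∈ lz′)
      in dcr→ (sound h e) (after (sound h d) z∈ z′∈ z<z′ hz lz′) lz z<z′ hz′
    sound h (emp-triv p) = →emp λ x∈ l g → <⇒≱ (below p x∈ g) l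
    sound h (dec-triv p) = →dcr λ s l lt g →
      <⇒≱ (below p (first s) (<-trans lt g)) l
    sound h (dec-mono d p q) = →dcr λ s l lt g →
      dcr→ (sound h d) s (≼-sound p (first s) l) lt (below q (rest s) g)
    -- If x, y straddle the overlap, a letter z of the overlap comes after y, so x, z is an ascent
    -- within the lower interval.
    sound h (dec-lap {b = b} {c = c} d e as cb td) = →dcr λ {x} {y} s l lt g →
      let x∈ = first s
          y∈ = rest s
          z , z∈ , lz , hz = ≺-sound cb
          g′ = below td y∈ g
      in split (y <? Θ b) (λ y<b → dcr→ (sound h d) s (≼-sound as x∈ l) lt y<b) λ y≮b →
         split (Θ c ≤? x) (λ c≤x → dcr→ (sound h e) s c≤x lt g′) λ c≰x → (
             let z<y = <-≤-trans hz (≮⇒≥ y≮b)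
                 x<z = <-≤-trans (≰⇒> c≰x) lz
             in dcr→ (sound h d) (outer (link u s (later (sound h e) z∈ y∈ lz z<y g′)))
                  (≼-sound as x∈ l) x<z hz)
    -- A letter above cut d comes after every letter below cut c, so it would extend an ascent to an
    -- increasing triple.
    sound h (dec-bar d e as tc cd db) = →dcr λ s l lt g →
      let z , z∈ , lz , hz = ≺-sound db
          y∈  = rest s
          g′  = below tc y∈ g
          y<z = <-≤-trans g′ (≼-sound cd z∈ lz)
      in inc→ (sound h d) (link u s (after (sound h e) y∈ z∈ y<z g′ lz))
           (≼-sound as (first s) l) lt y<z hz
    sound h (inc-triv p) = →inc λ s l xy yz g →
      <⇒≱ (below p (first s) (<-trans xy (<-trans yz g))) l
    sound h (inc-mono d p q) = →inc λ s l xy yz g →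
      inc→ (sound h d) s (≼-sound p (first s) l) xy yz (below q (rest (rest s)) g)
    sound h (inc-dec d p q) = →inc λ s l xy yz g →
      dcr→ (sound h d) (front s) (≼-sound p (first s) l) xy
        (<-trans yz (below q (rest (rest s)) g))
    -- As for `dec-lap`, now with the largest letter of the triple replaced by a letter of the
    -- overlap.
    sound h (inc-lap {b = b} {c = c} d e as cb td) = →inc λ {x} {y} {z} s l xy yz g →
      let x∈ = first s
          z∈ = rest (rest s)
          v , v∈ , lv , hv = ≺-sound cb
          g′ = below td z∈ g
      in split (z <? Θ b) (λ z<b → inc→ (sound h d) s (≼-sound as x∈ l) xy yz z<b) λ z≮b →
         split (Θ c ≤? y) (λ c≤y → dcr→ (sound h e) (rest s) c≤y yz g′) λ c≰y → (
             let v<z = <-≤-trans hv (≮⇒≥ z≮b)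
                 y<v = <-≤-trans (≰⇒> c≰y) lv
                 yv  = outer (link u (rest s) (later (sound h e) v∈ z∈ lv v<z g′))
             in inc→ (sound h d) (link u (front s) yv) (≼-sound as x∈ l) xy y<v hv)
    -- The position of the middle letter decides which of the two decreasing intervals contains an
    -- ascent.
    sound h (inc-two {b = b} d e as cb td) = →inc λ {x} {y} {z} s l xy yz g →
      let y∈ = first (rest s) in
      split (y <? Θ b)
        (λ y<b → dcr→ (sound h d) (front s) (≼-sound as (first s) l) xy y<b)
        (λ y≮b → dcr→ (sound h e) (rest s) (≼-sound cb y∈ (≮⇒≥ y≮b)) yz (below td (rest (rest s)) g))
    sound h (bar-low p) = →bar λ s l g → <⇒≱ (below p (rest s) g) (proj₁ (bounded (rest s)))
    sound h (bar-top p) = →bar λ s l g → <⇒≱ (proj₂ (bounded (first s))) (≼-sound p (first s) l)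
    sound h (bar-mono d p q) = →bar λ s l g →
      bar→ (sound h d) s (≼-sound q (first s) l) (below p (rest s) g)
    -- A letter y at or above cut a is followed by the smaller letter z below cut a, to which the
    -- given bar applies.
    sound h (bar-up {a = a} d e ca bt sd) = →bar λ {x} {y} s l g →
      let z , z∈ , lz , hz = ≺-sound ca
          l′ = ≼-sound bt (first s) l
      in split (y <? Θ a)
           (λ y<a → bar→ (sound h d) s l′ y<a)
           (λ y≮a → bar→ (sound h d)
             (outer (link u s
               (later (sound h e) z∈ (rest s) lz (<-≤-trans hz (≮⇒≥ y≮a)) (below sd (rest s) g))))
             l′ hz)
    -- Dually, a letter x below cut b is preceded by the larger letter z above cut b.
    sound h (bar-down {b = b} d e sa ct bd) = →bar λ {x} {y} s l g →
      let z , z∈ , lz , hz = ≺-sound bd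
          g′ = below sa (rest s) g
      in split (Θ b ≤? x)
           (λ b≤x → bar→ (sound h d) s b≤x g′)
           (λ b≰x → bar→ (sound h d)
             (outer (link u
               (later (sound h e) (first s) z∈ (≼-sound ct (first s) l) (<-≤-trans (≰⇒> b≰x) lz) hz) s))
             lz g′)
    sound h (cyc-low p) = →cyc λ s l lt g →
      <⇒≱ (below p (rest (rest s)) g) (proj₁ (bounded (rest (rest s))))
    sound h (cyc-top p) = →cyc λ s l lt g →
      <⇒≱ (proj₂ (bounded (first s))) (≼-sound p (first s) l)
    sound h (cyc-mono d p q) = →cyc λ s l lt g →
      cyc→ (sound h d) s (≼-sound q (first s) l) lt (below p (rest (rest s)) g)
    sound h (cyc-dec d p q) = →cyc λ s l lt g →
      let y∈ = first (rest s) in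
      dcr→ (sound h d) (front s) (≼-sound p (first s) l) lt (below q y∈ (proj₂ (bounded y∈)))
    -- If y lies below cut d, a letter between cuts d and b comes after the low letter, hence after
    -- y, and completes x, y to an increasing triple.
    sound h (cyc-bar {d = d} i e as sc db) = →cyc λ {x} {y} s l lt g →
      let z , z∈ , lz , hz = ≺-sound db
          z′∈ = rest (rest s)
          g′  = below sc z′∈ g
      in split (Θ d ≤? y)
           (λ d≤y → bar→ (sound h e) (rest s) d≤y g′)
           (λ d≰y →
             let y<z = <-≤-trans (≰⇒> d≰y) lz
                 z′z = after (sound h e) z′∈ z∈ (<-trans (<-≤-trans g l) (<-trans lt y<z)) g′ lz
             in inc→ (sound h i) (link u (front s) (outer (link u (rest s) z′z)))
                  (≼-sound as (first s) l) lt y<z hz)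
    sound h (cyc-two {d = d} e p q sc as db ed mf) = →cyc λ {x} {y} s l lt g →
      let x∈ = first s
          y∈ = first (rest s)
      in split (y <? Θ d)
           (λ y<d → dcr→ (sound h p) (front s) (≼-sound as x∈ l) lt (below db y∈ y<d))
           (λ y≮d → bar→ (sound h e) (rest s) (≮⇒≥ y≮d) (below sc (rest (rest s)) g))
    -- The conditions at the two ends deal with x above cut b and with z below cut a. Otherwise, if
    -- z lies below cut r, the condition at r applies directly; if not, a letter v between cuts a
    -- and r comes after z in the decreasing interval, and x, y, v violates the condition at r.
    sound h (cyc-mid {s} {a} {b} {a′} {b′} {r} d c ca cb ar rs sb aa a′a bb b′b) =
      →cyc λ {x} {y} {z} t l lt g →
      let x∈ = first t
          y∈ = first (rest t)
          z∈ = rest (rest t)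
      in split (Θ b ≤? x)
           (λ b≤x → cyc→ (sound h cb) t (≼-sound b′b x∈ b≤x) lt
                      (below bb z∈ (below (<⇒≤ sb) z∈ g)))
           (λ b≰x → split (Θ a ≤? z)
             (λ a≤z →
               let v , v∈ , lv , hv = ≺-sound ar
                   r≤x = ≼-sound (<⇒≤ rs) x∈ l
                   v<x = <-≤-trans hv r≤x
               in split (Θ r ≤? z)
                    (λ r≤z → cyc→ (sound h c)
                      (link u (front t) (outer (link u (rest t)
                        (later (sound h d) v∈ z∈ lv (<-≤-trans hv r≤z) (below (<⇒≤ sb) z∈ g)))))
                      r≤x lt hv)
                    (λ r≰z → cyc→ (sound h c) t r≤x lt (≰⇒> r≰z)))
             (λ a≰z → cyc→ (sound h ca) t
               (≼-sound a′a x∈ (≼-sound (<⇒≤ (<-trans ar rs)) x∈ l)) lt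
               (below aa z∈ (≰⇒> a≰z))))

-- The families of constraint sets

Mono : (ℕ → ℕ) → Set
Mono Θ = ∀ {s t} → s ≤ t → Θ s ≤ Θ t

-- The new cut divides block b and receives the number `suc b`; the old cuts are renumbered by
-- `lift b`.
insert : ℕ → ℕ → (ℕ → ℕ) → ℕ → ℕ
insert zero    v Θ zero          = Θ zero
insert zero    v Θ (suc zero)    = v
insert zero    v Θ (suc (suc g)) = Θ (suc g)
insert (suc b) v Θ zero          = Θ zero
insert (suc b) v Θ (suc g)       = insert b v (Θ ∘ suc) g

lift : ℕ → ℕ → ℕ
lift zero    zero    = zero
lift zero    (suc g) = suc (suc g)
lift (suc b) zero    = zero
lift (suc b) (suc g) = suc (lift b g)

insert-lift : ∀ b {v} Θ g → insert b v Θ (lift b g) ≡ Θ g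
insert-lift zero    Θ zero    = refl
insert-lift zero    Θ (suc g) = refl
insert-lift (suc b) Θ zero    = refl
insert-lift (suc b) Θ (suc g) = insert-lift b (Θ ∘ suc) g

insert-new : ∀ b {v} Θ → insert b v Θ (suc b) ≡ v
insert-new zero    Θ = refl
insert-new (suc b) Θ = insert-new b (Θ ∘ suc)

insert-zero : ∀ b {v} Θ → insert b v Θ 0 ≡ Θ 0
insert-zero zero    Θ = refl
insert-zero (suc b) Θ = refl

insert-top : ∀ {b m} {v} Θ → b < m → insert b v Θ (suc m) ≡ Θ m
insert-top {zero}  {suc m} Θ lt       = refl
insert-top {suc b} {suc m} Θ (s≤s lt) = insert-top {b} {m} (Θ ∘ suc) lt

mono-step : ∀ {Θ : ℕ → ℕ} → (∀ g → Θ g ≤ Θ (suc g)) → Mono Θ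
mono-step {Θ} h {s} {t} s≤t = go (≤⇒≤′ s≤t)
  where
  go : ∀ {t} → s ≤′ t → Θ s ≤ Θ t
  go ≤′-refl     = ≤-refl
  go (≤′-step p) = ≤-trans (go p) (h _)

insert-mono : ∀ b {v Θ} → Mono Θ → Θ b ≤ v → v ≤ Θ (suc b) → Mono (insert b v Θ)
insert-mono b {v} {Θ} mono l h = mono-step (go b mono l h)
  where
  go : ∀ b {Θ} → Mono Θ → Θ b ≤ v → v ≤ Θ (suc b) → ∀ g → insert b v Θ g ≤ insert b v Θ (suc g)
  go zero    mono l h zero          = l
  go zero    mono l h (suc zero)    = h
  go zero    mono l h (suc (suc g)) = mono (n≤1+n _)
  go (suc b) {Θ} mono l h zero = subst (Θ 0 ≤_) (sym (insert-zero b (Θ ∘ suc))) (mono (n≤1+n 0))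
  go (suc b) mono l h (suc g) = go b (mono ∘ s≤s) l h g

rename : (ℕ → ℕ) → Con → Con
rename f bot       = bot
rename f (emp s t) = emp (f s) (f t)
rename f (dec s t) = dec (f s) (f t)
rename f (inc s t) = inc (f s) (f t)
rename f (bar s t) = bar (f s) (f t)
rename f (cyc s)   = cyc (f s)

rename-sound : ∀ f k {Θ w} → ⟦ rename f k ⟧ Θ w ≡ ⟦ k ⟧ (Θ ∘ f) w
rename-sound f bot       = refl
rename-sound f (emp s t) = refl
rename-sound f (dec s t) = refl
rename-sound f (inc s t) = refl
rename-sound f (bar s t) = refl
rename-sound f (cyc s)   = refl

when : {A : Set} → Dec A → Con → List Con
when (yes _) k = k ∷ []
when (no _)  k = []

-- What a constraint demands, in addition to itself, of the word after a letter of block b; that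
-- letter becomes the cut suc b.
derived : ℕ → Con → List Con
derived b bot       = []
derived b (emp s t) = when (in? s t b) bot
derived b (dec s t) = when (in? s t b) (emp (suc b) (lift b t))
derived b (inc s t) = when (in? s t b) (dec (suc b) (lift b t))
derived b (bar s t) = when (t ≤? b) (emp 0 (lift b s))
derived b (cyc s)   = when (s ≤? b) (bar (lift b s) (suc b))

residual : ℕ → Con → List Con
residual b k = rename (lift b) k ∷ derived b k

after-letter : ℕ → ℕ → List Con → List Con
after-letter m b K =
  inc (suc b) (suc m) ∷ inc 0 (suc b) ∷ cyc (suc b) ∷ concatMap (residual b) K

Sat : (ℕ → ℕ) → List ℕ → List Con → Set
Sat Θ w = All (λ k → ⟦ k ⟧ Θ w)

module _ {b c : ℕ} {Θ : ℕ → ℕ} (mono : Mono Θ) (Θ₀ : Θ 0 ≡ 0) (l : Θ b ≤ c) (h : c < Θ (suc b)) where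

  private
    Θ′ = insert b (suc c) Θ

  cut≤ : ∀ {s} → s ≤ b → Θ s ≤ c
  cut≤ p = ≤-trans (mono p) l

  ≤cut : ∀ {s} → Θ s ≤ c → s ≤ b
  ≤cut p = ≮⇒≥ λ q → <⇒≱ h (≤-trans (mono q) p)

  cut< : ∀ {t} → b < t → c < Θ t
  cut< p = ≤-trans h (mono p)

  <cut : ∀ {t} → c < Θ t → b < t
  <cut p = ≰⇒> λ q → <⇒≱ p (cut≤ q)

  in-cut : ∀ s t → In s t b ⇔ In (Θ s) (Θ t) c
  in-cut s t = mk⇔ (λ (p , q) → cut≤ p , cut< q) (λ (p , q) → ≤cut p , <cut q)

  private
    -- A letter meets the premise of a condition exactly when its block does, so the extra demand is
    -- either present or vacuous, and this is decided on the numbers of the cuts.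
    glue : ∀ {A A′ B C : Set} {k r w} (d : Dec A) → A ⇔ A′ →
           B ≡ ⟦ k ⟧ Θ′ w → C ≡ ⟦ r ⟧ Θ′ w → ((A′ → B) × C) ⇔ Sat Θ′ w (r ∷ when d k)
    glue (yes a) A⇔A′ refl refl =
      mk⇔ (λ (f , x) → x ∷ f (Equivalence.to A⇔A′ a) ∷ []) (λ { (x ∷ y ∷ []) → (λ _ → y) , x })
    glue (no ¬a) A⇔A′ refl refl =
      mk⇔ (λ (f , x) → x ∷ []) (λ { (x ∷ []) → (λ a → ⊥-elim (¬a (Equivalence.from A⇔A′ a))) , x })

    moved : ∀ g → Θ g ≡ Θ′ (lift b g)
    moved g = sym (insert-lift b Θ g)

    added : suc c ≡ Θ′ (suc b)
    added = sym (insert-new b Θ)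

    origin : 0 ≡ Θ′ 0
    origin = sym (trans (insert-zero b Θ) Θ₀)

  residual-sound : ∀ k w → ⟦ k ⟧ Θ (c ∷ w) ⇔ Sat Θ′ w (residual b k)
  residual-sound bot       w = mk⇔ (λ ()) λ { (() ∷ _) }
  residual-sound (emp s t) w =
    glue (in? s t b) (in-cut s t) refl (cong₂ (λ x y → Emp x y w) (moved s) (moved t))
  residual-sound (dec s t) w =
    glue (in? s t b) (in-cut s t) (cong₂ (λ x y → Emp x y w) added (moved t))
      (cong₂ (λ x y → Dcr x y w) (moved s) (moved t))
  residual-sound (inc s t) w =
    glue (in? s t b) (in-cut s t) (cong₂ (λ x y → Dcr x y w) added (moved t))
      (cong₂ (λ x y → Inc x y w) (moved s) (moved t))
  residual-sound (bar s t) w =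
    glue (t ≤? b) (mk⇔ cut≤ ≤cut) (cong₂ (λ x y → Emp x y w) origin (moved s))
      (cong₂ (λ x y → Bar x y w) (moved s) (moved t))
  residual-sound (cyc s)   w =
    glue (s ≤? b) (mk⇔ cut≤ ≤cut) (cong₂ (λ x y → Bar x y w) (moved s) added)
      (cong (λ x → Cyc x w) (moved s))

  residuals-sound : ∀ K w → Sat Θ (c ∷ w) K ⇔ Sat Θ′ w (concatMap (residual b) K)
  residuals-sound []      w = mk⇔ (λ _ → []) (λ _ → [])
  residuals-sound (k ∷ K) w = mk⇔
    (λ { (p ∷ ps) → Allₚ.++⁺ (Equivalence.to (residual-sound k w) p)
                             (Equivalence.to (residuals-sound K w) ps) })
    (λ ps → Equivalence.from (residual-sound k w) (Allₚ.++⁻ˡ (residual b k) ps) ∷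
            Equivalence.from (residuals-sound K w) (Allₚ.++⁻ʳ (residual b k) ps))

  -- What `Av` demands on account of the letter `c` becomes the three leading conditions. `Av` of
  -- the suffix stays outside the list: its demands enter only as its own letters are read.
  after-letter-sound : ∀ {m} → b < m → ∀ K w →
    (Av (Θ m) (c ∷ w) × Sat Θ (c ∷ w) K) ⇔ (Av (Θ m) w × Sat Θ′ w (after-letter m b K))
  after-letter-sound {m} b<m K w = mk⇔
    (λ (((p , q , r) , a) , s) → a ,
       subst₂ (λ x y → Inc x y w) added (sym (insert-top Θ b<m)) p ∷
       subst₂ (λ x y → Inc x y w) origin added q ∷
       subst (λ x → Cyc x w) added r ∷
       Equivalence.to (residuals-sound K w) s)
    (λ { (a , p ∷ q ∷ r ∷ s) →
       ((subst₂ (λ x y → Inc x y w) (sym added) (insert-top Θ b<m) p ,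
         subst₂ (λ x y → Inc x y w) (sym origin) (sym added) q ,
         subst (λ x → Cyc x w) (sym added) r) , a) ,
       Equivalence.from (residuals-sound K w) s })

data Family : Set where
  free avoid line ballot merge stack tail
    final power linear asc₀ asc₁ asc₂ shuffle
    cap₀ cap₁ base₁ base₂ desc₀ desc₁ desc₂ : Family

width : Family → ℕ
width free    = 1
width avoid   = 1
width line    = 1
width ballot  = 2
width merge   = 2
width stack   = 2
width tail    = 2
width final   = 3
width power   = 3
width linear  = 3
width asc₀    = 2
width asc₁    = 3
width asc₂    = 4
width shuffle = 3
width cap₀    = 3
width cap₁    = 4
width base₁   = 2
width base₂   = 3
width desc₀   = 2
width desc₁   = 3
width desc₂   = 4

-- `line` and `stack` leave exactly one word. `avoid` is avoidance of 123, `ballot` the same with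
-- the upper block decreasing, and `merge` consists of the shuffles of two decreasing words.
constraints : Family → List Con
constraints free    = []
constraints avoid   = inc 0 1 ∷ []
constraints line    = dec 0 1 ∷ []
constraints ballot  = inc 0 2 ∷ dec 1 2 ∷ []
constraints merge   = dec 0 1 ∷ dec 1 2 ∷ []
constraints stack   = dec 0 1 ∷ dec 1 2 ∷ bar 1 1 ∷ []
constraints tail    = inc 0 1 ∷ dec 1 2 ∷ bar 1 1 ∷ []
constraints final   = inc 0 2 ∷ dec 1 2 ∷ dec 2 3 ∷ bar 2 2 ∷ []
constraints power   = inc 0 3 ∷ bar 1 2 ∷ dec 2 3 ∷ []
constraints linear  = inc 0 3 ∷ dec 1 2 ∷ bar 1 2 ∷ dec 2 3 ∷ []
constraints asc₀    = inc 0 2 ∷ cyc 1 ∷ []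
constraints asc₁    = inc 0 3 ∷ dec 1 2 ∷ cyc 1 ∷ cyc 2 ∷ []
constraints asc₂    = inc 0 4 ∷ dec 1 3 ∷ cyc 1 ∷ cyc 2 ∷ cyc 3 ∷ []
constraints shuffle = inc 0 2 ∷ dec 1 2 ∷ dec 2 3 ∷ bar 1 2 ∷ []
constraints cap₀    = inc 0 2 ∷ inc 1 3 ∷ dec 2 3 ∷ bar 1 2 ∷ []
constraints cap₁    = inc 0 3 ∷ inc 1 4 ∷ bar 2 3 ∷ dec 3 4 ∷ []
constraints base₁   = inc 0 2 ∷ dec 0 1 ∷ cyc 1 ∷ []
constraints base₂   = inc 0 3 ∷ dec 0 2 ∷ cyc 1 ∷ cyc 2 ∷ []
constraints desc₀   = inc 0 1 ∷ inc 1 2 ∷ cyc 1 ∷ []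
constraints desc₁   = inc 0 2 ∷ inc 1 3 ∷ dec 1 2 ∷ cyc 1 ∷ cyc 2 ∷ []
constraints desc₂   = inc 0 3 ∷ inc 1 4 ∷ dec 1 3 ∷ cyc 1 ∷ cyc 2 ∷ cyc 3 ∷ []

-- The list of numbers says how many of the new blocks are merged into each block of the family.
data Step : Set where
  step : Family → List ℕ → List Con → Step

_▹_ : Family → List ℕ → Maybe Step
F ▹ g = just (step F g [])

-- The Booleans tell whether the block of the letter read has letters left below and above it.
next : Family → ℕ → Bool → Bool → Maybe Step
next free    0 false false = line ▹ (2 ∷ [])
next free    0 false true  = avoid ▹ (2 ∷ [])
next free    0 true  false = avoid ▹ (2 ∷ [])
next free    0 true  true  = desc₀ ▹ (1 ∷ 1 ∷ [])
next avoid   0 false _     = line ▹ (2 ∷ [])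
next avoid   0 true  false = avoid ▹ (2 ∷ [])
next avoid   0 true  true  = ballot ▹ (1 ∷ 1 ∷ [])
next line    0 _     false = line ▹ (2 ∷ [])
next ballot  0 false _     = line ▹ (3 ∷ [])
next ballot  0 true  _     = ballot ▹ (1 ∷ 2 ∷ [])
next ballot  1 false false = avoid ▹ (3 ∷ [])
next ballot  1 true  false = ballot ▹ (1 ∷ 2 ∷ [])
next merge   0 false false = line ▹ (3 ∷ [])
next merge   0 true  false = merge ▹ (1 ∷ 2 ∷ [])
next merge   1 false false = line ▹ (3 ∷ [])
next merge   1 true  false = merge ▹ (1 ∷ 2 ∷ [])
next stack   0 false false = line ▹ (3 ∷ [])
next stack   0 true  false = stack ▹ (1 ∷ 2 ∷ [])
next tail    0 false false = line ▹ (3 ∷ [])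
next tail    0 false true  = stack ▹ (2 ∷ 1 ∷ [])
next tail    0 true  false = tail ▹ (1 ∷ 2 ∷ [])
next tail    0 true  true  = final ▹ (1 ∷ 1 ∷ 1 ∷ [])
next final   0 false _     = stack ▹ (3 ∷ 1 ∷ [])
next final   0 true  _     = final ▹ (1 ∷ 2 ∷ 1 ∷ [])
next final   1 false false = tail ▹ (1 ∷ 3 ∷ [])
next final   1 true  false = final ▹ (1 ∷ 1 ∷ 2 ∷ [])
next power   0 false false = line ▹ (4 ∷ [])
next power   0 true  false = stack ▹ (1 ∷ 3 ∷ [])
next power   1 false _     = stack ▹ (1 ∷ 3 ∷ [])
next power   1 true  _     = power ▹ (1 ∷ 1 ∷ 2 ∷ [])
next linear  0 false false = line ▹ (4 ∷ [])
next linear  0 true  false = stack ▹ (1 ∷ 3 ∷ [])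
next linear  1 false false = stack ▹ (1 ∷ 3 ∷ [])
next linear  1 true  false = linear ▹ (1 ∷ 1 ∷ 2 ∷ [])
next asc₀    0 false _     = line ▹ (3 ∷ [])
next asc₀    0 true  _     = ballot ▹ (1 ∷ 2 ∷ [])
next asc₀    1 false false = avoid ▹ (3 ∷ [])
next asc₀    1 false true  = stack ▹ (1 ∷ 2 ∷ [])
next asc₀    1 true  false = asc₀ ▹ (1 ∷ 2 ∷ [])
next asc₀    1 true  true  = power ▹ (1 ∷ 1 ∷ 1 ∷ [])
next asc₁    0 false _     = line ▹ (4 ∷ [])
next asc₁    0 true  _     = ballot ▹ (1 ∷ 3 ∷ [])
next asc₁    1 false false = stack ▹ (1 ∷ 3 ∷ [])
next asc₁    1 true  false = linear ▹ (1 ∷ 1 ∷ 2 ∷ [])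
next asc₁    2 false false = ballot ▹ (1 ∷ 3 ∷ [])
next asc₁    2 false true  = stack ▹ (2 ∷ 2 ∷ [])
next asc₁    2 true  false = asc₁ ▹ (1 ∷ 1 ∷ 2 ∷ [])
next asc₁    2 true  true  = power ▹ (2 ∷ 1 ∷ 1 ∷ [])
next asc₂    0 false _     = line ▹ (5 ∷ [])
next asc₂    0 true  _     = ballot ▹ (1 ∷ 4 ∷ [])
next asc₂    2 false false = stack ▹ (2 ∷ 3 ∷ [])
next asc₂    2 true  false = just (step stack (3 ∷ 2 ∷ []) (dec 0 2 ∷ []))
next asc₂    3 false false = ballot ▹ (1 ∷ 4 ∷ [])
next asc₂    3 false true  = stack ▹ (3 ∷ 2 ∷ [])
next asc₂    3 true  false = asc₂ ▹ (1 ∷ 1 ∷ 1 ∷ 2 ∷ [])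
next asc₂    3 true  true  = power ▹ (3 ∷ 1 ∷ 1 ∷ [])
next shuffle 0 false false = merge ▹ (3 ∷ 1 ∷ [])
next shuffle 0 false true  = stack ▹ (3 ∷ 1 ∷ [])
next shuffle 0 true  false = shuffle ▹ (1 ∷ 2 ∷ 1 ∷ [])
next shuffle 0 true  true  = final ▹ (1 ∷ 2 ∷ 1 ∷ [])
next shuffle 1 false false = tail ▹ (1 ∷ 3 ∷ [])
next shuffle 1 true  false = shuffle ▹ (1 ∷ 1 ∷ 2 ∷ [])
next cap₀    0 false false = merge ▹ (3 ∷ 1 ∷ [])
next cap₀    0 false true  = stack ▹ (3 ∷ 1 ∷ [])
next cap₀    0 true  false = shuffle ▹ (1 ∷ 2 ∷ 1 ∷ [])
next cap₀    0 true  true  = final ▹ (1 ∷ 2 ∷ 1 ∷ [])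
next cap₀    1 false false = tail ▹ (1 ∷ 3 ∷ [])
next cap₀    1 false true  = just (step stack (1 ∷ 3 ∷ []) (bar 1 1 ∷ []))
next cap₀    1 true  false = cap₀ ▹ (1 ∷ 1 ∷ 2 ∷ [])
next cap₀    1 true  true  = power ▹ (1 ∷ 1 ∷ 2 ∷ [])
next cap₁    0 false _     = stack ▹ (4 ∷ 1 ∷ [])
next cap₁    0 true  _     = final ▹ (1 ∷ 3 ∷ 1 ∷ [])
next cap₁    1 false false = just (step stack (1 ∷ 4 ∷ []) (bar 1 1 ∷ []))
next cap₁    1 true  false = just (step stack (2 ∷ 3 ∷ []) (bar 2 2 ∷ []))
next cap₁    2 false false = final ▹ (1 ∷ 1 ∷ 3 ∷ [])
next cap₁    2 false true  = just (step stack (2 ∷ 3 ∷ []) (bar 2 2 ∷ []))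
next cap₁    2 true  false = cap₁ ▹ (1 ∷ 1 ∷ 1 ∷ 2 ∷ [])
next cap₁    2 true  true  = power ▹ (2 ∷ 1 ∷ 2 ∷ [])
next base₁   0 false false = line ▹ (3 ∷ [])
next base₁   0 true  false = merge ▹ (1 ∷ 2 ∷ [])
next base₁   1 false false = line ▹ (3 ∷ [])
next base₁   1 false true  = stack ▹ (1 ∷ 2 ∷ [])
next base₁   1 true  false = base₁ ▹ (1 ∷ 2 ∷ [])
next base₁   1 true  true  = power ▹ (1 ∷ 1 ∷ 1 ∷ [])
next base₂   1 false false = stack ▹ (1 ∷ 3 ∷ [])
next base₂   1 true  false = stack ▹ (2 ∷ 2 ∷ [])
next base₂   2 false false = line ▹ (4 ∷ [])
next base₂   2 false true  = stack ▹ (2 ∷ 2 ∷ [])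
next base₂   2 true  false = base₂ ▹ (1 ∷ 1 ∷ 2 ∷ [])
next base₂   2 true  true  = power ▹ (2 ∷ 1 ∷ 1 ∷ [])
next desc₀   0 false false = avoid ▹ (3 ∷ [])
next desc₀   0 false true  = base₁ ▹ (2 ∷ 1 ∷ [])
next desc₀   0 true  false = desc₀ ▹ (1 ∷ 2 ∷ [])
next desc₀   0 true  true  = desc₁ ▹ (1 ∷ 1 ∷ 1 ∷ [])
next desc₀   1 false false = avoid ▹ (3 ∷ [])
next desc₀   1 false true  = tail ▹ (1 ∷ 2 ∷ [])
next desc₀   1 true  false = asc₀ ▹ (1 ∷ 2 ∷ [])
next desc₀   1 true  true  = cap₀ ▹ (1 ∷ 1 ∷ 1 ∷ [])
next desc₁   0 false false = base₁ ▹ (3 ∷ 1 ∷ [])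
next desc₁   0 false true  = base₂ ▹ (2 ∷ 1 ∷ 1 ∷ [])
next desc₁   0 true  false = desc₁ ▹ (1 ∷ 2 ∷ 1 ∷ [])
next desc₁   0 true  true  = desc₂ ▹ (1 ∷ 1 ∷ 1 ∷ 1 ∷ [])
next desc₁   1 false false = tail ▹ (1 ∷ 3 ∷ [])
next desc₁   1 true  false = shuffle ▹ (1 ∷ 1 ∷ 2 ∷ [])
next desc₁   2 false false = ballot ▹ (1 ∷ 3 ∷ [])
next desc₁   2 false true  = final ▹ (1 ∷ 1 ∷ 2 ∷ [])
next desc₁   2 true  false = asc₁ ▹ (1 ∷ 1 ∷ 2 ∷ [])
next desc₁   2 true  true  = cap₁ ▹ (1 ∷ 1 ∷ 1 ∷ 1 ∷ [])
next desc₂   0 false false = base₂ ▹ (3 ∷ 1 ∷ 1 ∷ [])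
next desc₂   0 false true  = base₂ ▹ (2 ∷ 2 ∷ 1 ∷ [])
next desc₂   0 true  false = desc₂ ▹ (1 ∷ 2 ∷ 1 ∷ 1 ∷ [])
next desc₂   0 true  true  = desc₂ ▹ (1 ∷ 1 ∷ 2 ∷ 1 ∷ [])
next desc₂   2 false false = final ▹ (1 ∷ 1 ∷ 3 ∷ [])
next desc₂   2 true  false = final ▹ (1 ∷ 2 ∷ 2 ∷ [])
next desc₂   3 false false = ballot ▹ (1 ∷ 4 ∷ [])
next desc₂   3 false true  = final ▹ (1 ∷ 2 ∷ 2 ∷ [])
next desc₂   3 true  false = asc₂ ▹ (1 ∷ 1 ∷ 1 ∷ 2 ∷ [])
next desc₂   3 true  true  = cap₁ ▹ (1 ∷ 2 ∷ 1 ∷ 1 ∷ [])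
-- The other letters of a family make its conditions contradictory, so no word continues with them;
-- `correct` derives `bot` in these cases.
next _       _ _     _     = nothing

group : {A : Set} → List ℕ → List (List A) → List (List A)
group []      Bs = []
group (k ∷ g) Bs = concat (take k Bs) ∷ group g (drop k Bs)

cut : List ℕ → ℕ → ℕ
cut g       zero    = 0
cut []      (suc i) = 0
cut (k ∷ g) (suc i) = k + cut g i

-- The flags mark the nonempty blocks, so two cuts of equal rank have no letter between them.
rank : List Bool → ℕ → ℕ
rank []           _       = 0
rank (f ∷ fs)     zero    = 0
rank (false ∷ fs) (suc g) = rank fs g
rank (true ∷ fs)  (suc g) = suc (rank fs g)

inhabited : List ℕ → List Bool → Bool
inhabited []      fs = true
inhabited (k ∷ g) fs = any id (take k fs) ∧ inhabited g (drop k fs)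

-- The check of a family presumes nonempty blocks, so each step has to lead to nonempty blocks
-- again. Only `line` may run empty, and there the word ends.
fits : Family → List ℕ → List Bool → Bool
fits line _ _  = true
fits F    g fs = inhabited g fs

-- The two entailments together ensure that passing to the next family neither loses nor gains
-- words.
correct : List Bool → List Con → Maybe Step → Bool
correct fs K nothing              = is-just (Entailment.entails (rank fs) (length fs) K [] (bot ∷ []))
correct fs K (just (step F g hs)) =
  (length g ≡ᵇ width F) ∧ (sum g ≡ᵇ length fs) ∧ fits F g fs ∧
  is-just (entails K hs L) ∧ is-just (entails L [] K)
  where
  open Entailment (rank fs) (length fs)
  L = map (rename (cut g)) (constraints F)

correct-at : Family → ℕ → Bool → Bool → Bool
correct-at F b x y =
  correct (replicate b true ++ x ∷ y ∷ replicate (width F ∸ suc b) true)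
          (after-letter (width F) b (constraints F)) (next F b x y)

all-cases : (Bool → Bool → Bool) → Bool
all-cases P = (P false false ∧ P false true) ∧ (P true false ∧ P true true)

below-all : ℕ → (ℕ → Bool) → Bool
below-all zero    P = true
below-all (suc m) P = P m ∧ below-all m P

correct-family : Family → Bool
correct-family F = (0 <ᵇ width F) ∧ below-all (width F) (λ b → all-cases (correct-at F b))

-- Each clause evaluates the proof search for every block of the family and all four emptiness
-- patterns of the divided block; `tt` has the required type only if all searches succeed.
table-correct : ∀ F → T (correct-family F)
table-correct free    = tt
table-correct avoid   = tt
table-correct line    = tt
table-correct ballot  = tt
table-correct merge   = tt
table-correct stack   = tt
table-correct tail    = tt
table-correct final   = tt
table-correct power   = tt
table-correct linear  = tt
table-correct asc₀    = tt
table-correct asc₁    = tt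
table-correct asc₂    = tt
table-correct shuffle = tt
table-correct cap₀    = tt
table-correct cap₁    = tt
table-correct base₁   = tt
table-correct base₂   = tt
table-correct desc₀   = tt
table-correct desc₁   = tt
table-correct desc₂   = tt

-- Counting arrangements

Σ-splits : List ℕ → (List ℕ → ℕ → List ℕ → ℕ) → ℕ
Σ-splits []      φ = 0
Σ-splits (c ∷ R) φ = φ [] c R + Σ-splits R (φ ∘ (c ∷_))

-- The sum over x + y = n - 1: what remains of `Σ-splits` when only the lengths of the two parts
-- matter.
Σ-sizes : ℕ → (ℕ → ℕ → ℕ) → ℕ
Σ-sizes zero    φ = 0
Σ-sizes (suc n) φ = φ 0 n + Σ-sizes n (φ ∘ suc)

Σ-splits-cong : ∀ R {φ ψ} → (∀ xs c ys → R ≡ xs ++ c ∷ ys → φ xs c ys ≡ ψ xs c ys) →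
                Σ-splits R φ ≡ Σ-splits R ψ
Σ-splits-cong []      h = refl
Σ-splits-cong (c ∷ R) h =
  cong₂ _+_ (h [] c R refl) (Σ-splits-cong R λ xs d ys eq → h (c ∷ xs) d ys (cong (c ∷_) eq))

Σ-splits-++ : ∀ A B {φ} → Σ-splits (A ++ B) φ ≡
              Σ-splits A (λ xs c ys → φ xs c (ys ++ B)) + Σ-splits B (λ xs → φ (A ++ xs))
Σ-splits-++ []      B     = refl
Σ-splits-++ (a ∷ A) B {φ} =
  trans (cong (φ [] a (A ++ B) +_) (Σ-splits-++ A B)) (sym (+-assoc (φ [] a (A ++ B)) _ _))

Σ-splits-length : ∀ R {ψ} → Σ-splits R (λ xs _ ys → ψ (length xs) (length ys)) ≡ Σ-sizes (length R) ψ
Σ-splits-length []          = refl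
Σ-splits-length (c ∷ R) {ψ} = cong (ψ 0 (length R) +_) (Σ-splits-length R)

indicator : Bool → ℕ
indicator b = if b then 1 else 0

-- n is the length of R.
count : ℕ → List ℕ → (List ℕ → Bool) → ℕ
count zero    R p = indicator (p [])
count (suc n) R p = Σ-splits R λ xs c ys → count n (xs ++ ys) (p ∘ (c ∷_))

reinsert : ∀ {w} {c : ℕ} xs ys → w ↭ xs ++ ys → c ∷ w ↭ xs ++ c ∷ ys
reinsert {c = c} xs ys p = ↭-trans (prep c p) (↭-sym (shift c xs ys))

length-split : ∀ {n} {R : List ℕ} {c} xs ys → suc n ≡ length R → R ≡ xs ++ c ∷ ys → n ≡ length (xs ++ ys)
length-split xs ys len refl =
  suc-injective (trans len (trans (length-++ xs) (trans (+-suc _ _) (cong suc (sym (length-++ xs))))))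

count-cong : ∀ n R {p q} → n ≡ length R → (∀ w → w ↭ R → p w ≡ q w) → count n R p ≡ count n R q
count-cong zero    []  len h = cong indicator (h [] ↭-refl)
count-cong (suc n) R len h = Σ-splits-cong R λ xs c ys eq →
  count-cong n (xs ++ ys) (length-split xs ys len eq)
    λ w w↭ → h (c ∷ w) (subst (c ∷ w ↭_) (sym eq) (reinsert xs ys w↭))

Σ-splits-zero : ∀ R → Σ-splits R (λ _ _ _ → 0) ≡ 0
Σ-splits-zero []      = refl
Σ-splits-zero (_ ∷ R) = Σ-splits-zero R

count-false : ∀ n R {p} → n ≡ length R → (∀ w → w ↭ R → p w ≡ false) → count n R p ≡ 0
count-false zero    []  len h = cong indicator (h [] ↭-refl)
count-false (suc n) R len h = trans
  (Σ-splits-cong R λ xs c ys eq → count-false n (xs ++ ys) (length-split xs ys len eq)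
    λ w w↭ → h (c ∷ w) (subst (c ∷ w ↭_) (sym eq) (reinsert xs ys w↭)))
  (Σ-splits-zero R)

-- Sorted blocks of letters between the cuts

Blocks : Set
Blocks = List (List ℕ)

data Tiled : (ℕ → ℕ) → Blocks → Set where
  []  : ∀ {Θ} → Tiled Θ []
  _∷_ : ∀ {Θ B Bs} → All (In (Θ 0) (Θ 1)) B × AllPairs _<_ B → Tiled (Θ ∘ suc) Bs → Tiled Θ (B ∷ Bs)

occupied : List ℕ → Bool
occupied []      = false
occupied (_ ∷ _) = true

tiled-range : ∀ {Θ Bs} → Mono Θ → Tiled Θ Bs → All (In (Θ 0) (Θ (length Bs))) (concat Bs)
tiled-range mono [] = []
tiled-range mono ((r , _) ∷ t) = Allₚ.++⁺
  (All.map (λ (l , h) → l , <-≤-trans h (mono (s≤s z≤n))) r)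
  (All.map (λ (l , h) → ≤-trans (mono z≤n) l , h) (tiled-range (mono ∘ s≤s) t))

tiled-sorted : ∀ {Θ Bs} → Mono Θ → Tiled Θ Bs → AllPairs _<_ (concat Bs)
tiled-sorted mono [] = []
tiled-sorted mono ((r , s) ∷ t) = AllPairsₚ.++⁺ s (tiled-sorted (mono ∘ s≤s) t)
  (All.map (λ (_ , h) → All.map (λ (l , _) → <-≤-trans h l) (tiled-range (mono ∘ s≤s) t)) r)

rank-mono : ∀ fs {s t} → s ≤ t → rank fs s ≤ rank fs t
rank-mono []           _       = z≤n
rank-mono (_ ∷ fs)     z≤n     = z≤n
rank-mono (false ∷ fs) (s≤s p) = rank-mono fs p
rank-mono (true ∷ fs)  (s≤s p) = s≤s (rank-mono fs p)

flags : Blocks → List Bool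
flags = map occupied

cell : ∀ {Θ Bs v} → Tiled Θ Bs → v ∈ concat Bs →
       ∃ λ i → In (Θ i) (Θ (suc i)) v × rank (flags Bs) (suc i) ≡ suc (rank (flags Bs) i)
cell {Bs = B ∷ Bs} ((r , _) ∷ t) v∈ with ∈-++⁻ B v∈
... | inj₁ v∈B = 0 , All.lookup r v∈B , first-rank B v∈B
  where
  first-rank : ∀ B {v} → v ∈ B → rank (flags (B ∷ Bs)) 1 ≡ 1
  first-rank (_ ∷ _) _ = cong suc (go (flags Bs))
    where
    go : ∀ fs → rank fs 0 ≡ 0
    go []      = refl
    go (_ ∷ _) = refl
... | inj₂ v∈Bs with cell t v∈Bs
...   | i , r′ , eq = suc i , r′ , shift-rank B eq
  where
  shift-rank : ∀ B {i} → rank (flags Bs) (suc i) ≡ suc (rank (flags Bs) i) →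
               rank (flags (B ∷ Bs)) (suc (suc i)) ≡ suc (rank (flags (B ∷ Bs)) (suc i))
  shift-rank []      eq = eq
  shift-rank (_ ∷ _) eq = cong suc eq

-- Otherwise the block of `v` would lie between cut t and cut s, and as a nonempty block it would
-- make the rank of s the larger one.
rank-≤ : ∀ {Θ Bs s t v} → Mono Θ → Tiled Θ Bs → rank (flags Bs) s ≤ rank (flags Bs) t →
         v ∈ concat Bs → Θ t ≤ v → Θ s ≤ v
rank-≤ {Θ} {Bs} {s} {t} mono tiled r v∈ l with cell tiled v∈
... | i , (li , hi) , eq with s ≤? i
...   | yes s≤i = ≤-trans (mono s≤i) li
...   | no  s≰i = ⊥-elim (<⇒≱ (≤-reflexive (sym eq))
  (≤-trans (rank-mono (flags Bs) (≰⇒> s≰i)) (≤-trans r (rank-mono (flags Bs) t≤i))))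
  where
  t≤i : t ≤ i
  t≤i = ≮⇒≥ λ q → <⇒≱ hi (≤-trans (mono q) l)

rank-< : ∀ {Θ Bs s t} → Mono Θ → Tiled Θ Bs → rank (flags Bs) s < rank (flags Bs) t →
         ∃ λ z → z ∈ concat Bs × In (Θ s) (Θ t) z
rank-< {Bs = []}             mono tiled ()
rank-< {Bs = B ∷ Bs} {t = zero} mono tiled ()
rank-< {Bs = [] ∷ Bs} {zero} {suc t} mono (_ ∷ tiled) r
  with rank-< {s = 0} (mono ∘ s≤s) tiled (≤-trans (s≤s (zero-rank (flags Bs))) r)
  where
  zero-rank : ∀ fs → rank fs 0 ≤ 0
  zero-rank []      = z≤n
  zero-rank (_ ∷ _) = z≤n
... | z , z∈ , l , h = z , z∈ , ≤-trans (mono z≤n) l , h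
rank-< {Bs = (z ∷ B) ∷ Bs} {zero} {suc t} mono (((l , h) ∷ _ , _) ∷ _) r =
  z , here refl , l , <-≤-trans h (mono (s≤s z≤n))
rank-< {Bs = [] ∷ Bs} {suc s} {suc t} mono (_ ∷ tiled) r = rank-< (mono ∘ s≤s) tiled r
rank-< {Bs = B@(_ ∷ _) ∷ Bs} {suc s} {suc t} mono (_ ∷ tiled) (s≤s r)
  with rank-< (mono ∘ s≤s) tiled r
... | z , z∈ , i = z , ∈-++⁺ʳ B z∈ , i

module _ {Θ Bs w} (mono : Mono Θ) (tiled : Tiled Θ Bs) (w↭ : w ↭ concat Bs) where

  arrangement-unique : Unique w
  arrangement-unique = Permₛ.Unique-resp-↭ (setoid ℕ) (↭⇒↭ₛ (↭-sym w↭))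
    (AllPairs.map <⇒≢ (tiled-sorted mono tiled))

  ≼-sound : ∀ {s t} → rank (flags Bs) s ≤ rank (flags Bs) t →
            ∀ {x} → x ∷ [] ⊆ w → Θ t ≤ x → Θ s ≤ x
  ≼-sound r x∈ = rank-≤ mono tiled r (∈-resp-↭ w↭ (to∈ x∈))

  ≺-sound : ∀ {s t} → rank (flags Bs) s < rank (flags Bs) t →
            ∃ λ z → z ∷ [] ⊆ w × Θ s ≤ z × z < Θ t
  ≺-sound r = let z , z∈ , i = rank-< mono tiled r in z , from∈ (∈-resp-↭ (↭-sym w↭) z∈) , i

  bounded : ∀ {x} → x ∷ [] ⊆ w → In (Θ 0) (Θ (length (flags Bs))) x
  bounded {x} x∈ = subst (λ m → In (Θ 0) (Θ m) x) (sym (length-map occupied Bs))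
    (All.lookup (tiled-range mono tiled) (∈-resp-↭ w↭ (to∈ x∈)))

  entails-sound : ∀ {K T′} hs →
                  T (is-just (Entailment.entails (rank (flags Bs)) (length (flags Bs)) K hs T′)) →
                  Sat Θ w K → Sat Θ w T′
  entails-sound {K} {T′} hs ok sat
    with Entailment.entails (rank (flags Bs)) (length (flags Bs)) K hs T′
  ... | just ds = All.map (Entailment.Sound.sound (rank (flags Bs)) (length (flags Bs))
                    arrangement-unique Θ ≼-sound ≺-sound bounded sat) ds

-- The value of the new cut is `suc c`: in a sorted block the letters before `c` stay below it,
-- those after `c` reach it, and `c` itself is gone.
tiled-split : ∀ {Θ} pre {xs c ys post} → Tiled Θ (pre ++ (xs ++ c ∷ ys) ∷ post) →
              In (Θ (length pre)) (Θ (suc (length pre))) c ×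
              Tiled (insert (length pre) (suc c) Θ) (pre ++ xs ∷ ys ∷ post)
tiled-split [] {xs} {c} {ys} ((r , s) ∷ t) =
  All.head (Allₚ.++⁻ʳ xs r) ,
  (All.zipWith (λ ((l , _) , h) → l , s≤s (<⇒≤ h)) (Allₚ.++⁻ˡ xs r , below xs s) , proj₁ (sides xs s)) ∷
  (All.zipWith (λ ((_ , h) , l) → l , h) (All.tail (Allₚ.++⁻ʳ xs r) , above xs s) , proj₂ (sides xs s)) ∷
  t
  where
  below : ∀ xs → AllPairs _<_ (xs ++ c ∷ ys) → All (_< c) xs
  below []       _       = []
  below (x ∷ xs) (a ∷ s) = All.head (Allₚ.++⁻ʳ xs a) ∷ below xs s
  above : ∀ xs → AllPairs _<_ (xs ++ c ∷ ys) → All (suc c ≤_) ys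
  above []       (a ∷ _) = a
  above (x ∷ xs) (_ ∷ s) = above xs s
  sides : ∀ xs → AllPairs _<_ (xs ++ c ∷ ys) → AllPairs _<_ xs × AllPairs _<_ ys
  sides []       (_ ∷ s) = [] , s
  sides (x ∷ xs) (a ∷ s) = Allₚ.++⁻ˡ xs a ∷ proj₁ (sides xs s) , proj₂ (sides xs s)
tiled-split (B ∷ pre) (r ∷ t) with tiled-split pre t
... | i , t′ = i , (subst (λ x → All (In _ x) B) (sym (insert-zero (length pre) _)) (proj₁ r) , proj₂ r) ∷ t′

tiled-take : ∀ {Θ} k {Bs} → Mono Θ → Tiled Θ Bs → k ≤ length Bs →
             All (In (Θ 0) (Θ k)) (concat (take k Bs)) × AllPairs _<_ (concat (take k Bs)) ×
             Tiled (Θ ∘ (k +_)) (drop k Bs)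
tiled-take zero    mono t             z≤n     = [] , [] , t
tiled-take (suc k) mono ((r , s) ∷ t) (s≤s p) with tiled-take k (mono ∘ s≤s) t p
... | r′ , s′ , t′ =
  Allₚ.++⁺ (All.map (λ (l , h) → l , <-≤-trans h (mono (s≤s z≤n))) r)
           (All.map (λ (l , h) → ≤-trans (mono z≤n) l , h) r′) ,
  AllPairsₚ.++⁺ s s′ (All.map (λ (_ , h) → All.map (λ (l , _) → <-≤-trans h l) r′) r) , t′

length-drop : {A : Set} → ∀ k {m} (Bs : List A) → k + m ≡ length Bs → m ≡ length (drop k Bs)
length-drop zero    Bs       eq = eq
length-drop (suc k) (_ ∷ Bs) eq = length-drop k Bs (suc-injective eq)

tiled-group : ∀ {Θ} g {Bs} → Mono Θ → Tiled Θ Bs → sum g ≡ length Bs → Tiled (Θ ∘ cut g) (group g Bs)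
tiled-group []      mono t eq = []
tiled-group {Θ} (k ∷ g) {Bs} mono t eq
  with tiled-take k mono t (≤-trans (m≤m+n k (sum g)) (≤-reflexive eq))
... | r , s , t′ =
  (subst (λ x → All (In (Θ 0) (Θ x)) (concat (take k Bs))) (sym (cut-one g)) r , s) ∷
  tiled-group g (mono ∘ +-monoʳ-≤ k) t′ (length-drop k Bs eq)
  where
  cut-one : ∀ g → k + cut g 0 ≡ k
  cut-one g = +-identityʳ k

concat-group : ∀ g (Bs : Blocks) → sum g ≡ length Bs → concat (group g Bs) ≡ concat Bs
concat-group []      []  eq = refl
concat-group (k ∷ g) Bs eq = trans
  (cong (concat (take k Bs) ++_) (concat-group g (drop k Bs) (length-drop k Bs eq)))
  (trans (concat-++ (take k Bs) (drop k Bs)) (cong concat (take++drop≡id k Bs)))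

cut-total : ∀ g → cut g (length g) ≡ sum g
cut-total []      = refl
cut-total (k ∷ g) = cong (k +_) (cut-total g)

cut-mono : ∀ g → Mono (cut g)
cut-mono []      {zero}  {zero}  p       = ≤-refl
cut-mono []      {zero}  {suc _} p       = ≤-refl
cut-mono []      {suc _} {suc _} p       = ≤-refl
cut-mono (k ∷ g) z≤n                     = z≤n
cut-mono (k ∷ g) (s≤s p)                 = +-monoʳ-≤ k (cut-mono g p)

-- A single entry is not followed by `+ 0`, so that the size of a block that is not merged remains
-- literally the same.
total : List ℕ → ℕ
total []           = 0
total (s ∷ [])     = s
total (s ∷ t ∷ ss) = s + total (t ∷ ss)

total-∷ : ∀ s ss → total (s ∷ ss) ≡ s + total ss
total-∷ s []       = sym (+-identityʳ s)
total-∷ s (_ ∷ ss) = refl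

sums : List ℕ → List ℕ → List ℕ
sums []      ss = []
sums (k ∷ g) ss = total (take k ss) ∷ sums g (drop k ss)

group-sizes : ∀ g (Bs : Blocks) → map length (group g Bs) ≡ sums g (map length Bs)
group-sizes []      Bs = refl
group-sizes (k ∷ g) Bs = cong₂ _∷_ (first-sum k Bs)
  (trans (group-sizes g (drop k Bs)) (cong (sums g) (drop-sizes k Bs)))
  where
  first-sum : ∀ k (Bs : Blocks) → length (concat (take k Bs)) ≡ total (take k (map length Bs))
  first-sum zero    Bs       = refl
  first-sum (suc k) []       = refl
  first-sum (suc k) (B ∷ Bs) = trans (length-++ B)
    (trans (cong (length B +_) (first-sum k Bs)) (sym (total-∷ (length B) (take k (map length Bs)))))
  drop-sizes : ∀ k (Bs : Blocks) → map length (drop k Bs) ≡ drop k (map length Bs)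
  drop-sizes zero    Bs       = refl
  drop-sizes (suc k) []       = refl
  drop-sizes (suc k) (B ∷ Bs) = drop-sizes k Bs

length-group : ∀ {A : Set} g (Bs : List (List A)) → length (group g Bs) ≡ length g
length-group []      Bs = refl
length-group (k ∷ g) Bs = cong suc (length-group g (drop k Bs))

Occupied : List ℕ → Set
Occupied B = T (occupied B)

data Fit : Family → Blocks → Set where
  full : ∀ {F Bs} → length Bs ≡ width F → All Occupied Bs → Fit F Bs
  done : Fit line ([] ∷ [])

inhabited-sound : ∀ g Bs → T (inhabited g (flags Bs)) → All Occupied (group g Bs)
inhabited-sound []      Bs ok = []
inhabited-sound (k ∷ g) Bs ok = let p , q = Equivalence.to T-∧ ok in
  some k Bs p ∷ inhabited-sound g (drop k Bs) (subst (T ∘ inhabited g) (drop-flags k Bs) q)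
  where
  some : ∀ k Bs → T (any id (take k (flags Bs))) → Occupied (concat (take k Bs))
  some (suc k) ([] ∷ Bs)      p = some k Bs p
  some (suc k) ((_ ∷ _) ∷ Bs) p = tt
  drop-flags : ∀ k Bs → drop k (flags Bs) ≡ flags (drop k Bs)
  drop-flags zero    Bs       = refl
  drop-flags (suc k) []       = refl
  drop-flags (suc k) (_ ∷ Bs) = drop-flags k Bs

fits-sound : ∀ F g {Bs} → length g ≡ width F → T (fits F g (flags Bs)) → Fit F (group g Bs)
fits-sound line    (k ∷ []) {Bs} len ok = single (concat (take k Bs))
  where
  single : ∀ B → Fit line (B ∷ [])
  single []      = done
  single (_ ∷ _) = full refl (tt ∷ [])
fits-sound free    g {Bs} len ok = full (trans (length-group g Bs) len) (inhabited-sound g Bs ok)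
fits-sound avoid   g {Bs} len ok = full (trans (length-group g Bs) len) (inhabited-sound g Bs ok)
fits-sound ballot  g {Bs} len ok = full (trans (length-group g Bs) len) (inhabited-sound g Bs ok)
fits-sound merge   g {Bs} len ok = full (trans (length-group g Bs) len) (inhabited-sound g Bs ok)
fits-sound stack   g {Bs} len ok = full (trans (length-group g Bs) len) (inhabited-sound g Bs ok)
fits-sound tail    g {Bs} len ok = full (trans (length-group g Bs) len) (inhabited-sound g Bs ok)
fits-sound final   g {Bs} len ok = full (trans (length-group g Bs) len) (inhabited-sound g Bs ok)
fits-sound power   g {Bs} len ok = full (trans (length-group g Bs) len) (inhabited-sound g Bs ok)
fits-sound linear  g {Bs} len ok = full (trans (length-group g Bs) len) (inhabited-sound g Bs ok)
fits-sound asc₀    g {Bs} len ok = full (trans (length-group g Bs) len) (inhabited-sound g Bs ok)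
fits-sound asc₁    g {Bs} len ok = full (trans (length-group g Bs) len) (inhabited-sound g Bs ok)
fits-sound asc₂    g {Bs} len ok = full (trans (length-group g Bs) len) (inhabited-sound g Bs ok)
fits-sound shuffle g {Bs} len ok = full (trans (length-group g Bs) len) (inhabited-sound g Bs ok)
fits-sound cap₀    g {Bs} len ok = full (trans (length-group g Bs) len) (inhabited-sound g Bs ok)
fits-sound cap₁    g {Bs} len ok = full (trans (length-group g Bs) len) (inhabited-sound g Bs ok)
fits-sound base₁   g {Bs} len ok = full (trans (length-group g Bs) len) (inhabited-sound g Bs ok)
fits-sound base₂   g {Bs} len ok = full (trans (length-group g Bs) len) (inhabited-sound g Bs ok)
fits-sound desc₀   g {Bs} len ok = full (trans (length-group g Bs) len) (inhabited-sound g Bs ok)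
fits-sound desc₁   g {Bs} len ok = full (trans (length-group g Bs) len) (inhabited-sound g Bs ok)
fits-sound desc₂   g {Bs} len ok = full (trans (length-group g Bs) len) (inhabited-sound g Bs ok)

good? : ∀ N Θ K w → Dec (Av N w × Sat Θ w K)
good? N Θ K w = av? N w ×-dec All.all? (λ k → holds? k Θ w) K

good : ℕ → (ℕ → ℕ) → List Con → List ℕ → Bool
good N Θ K w = does (good? N Θ K w)

positive : ℕ → Bool
positive zero    = false
positive (suc _) = true

occupied-length : ∀ B → positive (length B) ≡ occupied B
occupied-length []      = refl
occupied-length (_ ∷ _) = refl

below-all-sound : ∀ m {P b} → T (below-all m P) → b < m → T (P b)
below-all-sound (suc m) {P} {b} ok b<m with Equivalence.to T-∧ ok | m≤n⇒m<n∨m≡n (≤-pred b<m)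
... | p , q | inj₁ b<m′ = below-all-sound m q b<m′
... | p , q | inj₂ refl = p

width-positive : ∀ F → 0 < width F
width-positive F = <ᵇ⇒< 0 (width F) (proj₁ (Equivalence.to T-∧ (table-correct F)))

all-cases-sound : ∀ P → T (all-cases P) → ∀ x y → T (P x y)
all-cases-sound P ok x y with Equivalence.to T-∧ ok
... | f , t with Equivalence.to T-∧ f | Equivalence.to T-∧ t | x | y
... | ff , _  | _        | false | false = ff
... | _  , ft | _        | false | true  = ft
... | _       | tf , _   | true  | false = tf
... | _       | _  , tt′ | true  | true  = tt′

correct-at-sound : ∀ F {b} x y → b < width F → T (correct-at F b x y)
correct-at-sound F {b} x y b< = all-cases-sound (correct-at F b)
  (below-all-sound (width F) (proj₂ (Equivalence.to (T-∧ {0 <ᵇ width F}) (table-correct F))) b<) x y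

-- The recursion for the numbers of words

module Values (val : Family → List ℕ → ℕ) where

  outcome : Maybe Step → List ℕ → ℕ
  outcome nothing             ss = 0
  outcome (just (step G g _)) ss = val G (sums g ss)

  branch : Family → List ℕ → ℕ → ℕ → List ℕ → ℕ
  branch F pre x y post = outcome (next F (length pre) (positive x) (positive y)) (pre ++ x ∷ y ∷ post)

  -- Sums over the block containing the first letter; `pre` holds the sizes of the blocks below it.
  expand : Family → List ℕ → List ℕ → ℕ
  expand F pre []         = 0
  expand F pre (s ∷ post) = Σ-sizes s (λ x y → branch F pre x y post) + expand F (pre ++ s ∷ []) post

  module _ (val-done : val line (0 ∷ []) ≡ 1)
           (val-step : ∀ F ss → length ss ≡ width F → All (0 <_) ss → val F ss ≡ expand F [] ss) where

    sat-rename : ∀ f K {Θ w} → Sat Θ w (map (rename f) K) ⇔ Sat (Θ ∘ f) w K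
    sat-rename f K = mk⇔
      (λ s → All.map (λ {k} → subst id (rename-sound f k)) (Allₚ.map⁻ s))
      (λ s → Allₚ.map⁺ (All.map (λ {k} → subst id (sym (rename-sound f k))) s))

    fine-flags : ∀ (pre : Blocks) {m} xs ys post → length pre + suc (length post) ≡ m →
                 All Occupied pre → All Occupied post →
                 flags (pre ++ xs ∷ ys ∷ post) ≡
                 replicate (length pre) true ++
                 occupied xs ∷ occupied ys ∷ replicate (m ∸ suc (length pre)) true
    fine-flags [] xs ys post refl _ o = cong (λ fs → occupied xs ∷ occupied ys ∷ fs) (rep post o)
      where
      rep : ∀ post → All Occupied post → flags post ≡ replicate (length post) true
      rep []               _       = refl
      rep ((_ ∷ _) ∷ post) (_ ∷ o) = cong (true ∷_) (rep post o)
    fine-flags ((_ ∷ _) ∷ pre) xs ys post refl (_ ∷ o) o′ = cong (true ∷_) (fine-flags pre xs ys post refl o o′)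

    concat-fine : ∀ (pre : Blocks) xs ys post →
                  concat (pre ++ xs ∷ ys ∷ post) ≡ (concat pre ++ xs) ++ (ys ++ concat post)
    concat-fine pre xs ys post =
      trans (sym (concat-++ pre (xs ∷ ys ∷ post))) (sym (++-assoc (concat pre) xs _))

    -- Induction on the number of letters, mutual with `count-step`. The cuts and the letters
    -- themselves disappear from the result, where only the block sizes remain.
    count-family : ∀ n F {Θ Bs N} → Mono Θ → Θ 0 ≡ 0 → Θ (width F) ≡ N → Tiled Θ Bs → Fit F Bs →
                   n ≡ length (concat Bs) →
                   count n (concat Bs) (good N Θ (constraints F)) ≡ val F (map length Bs)

    -- The conditions after the letter are exchanged, by the two checked entailments, for those of
    -- the next family on merged blocks. A contradictory letter contributes zero.
    count-step : ∀ n F b {Θ Bs N c} → let Θ′ = insert b (suc c) Θ ; m = width F in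
                 Mono Θ → Mono Θ′ → Tiled Θ′ Bs → Θ 0 ≡ 0 → Θ m ≡ N → In (Θ b) (Θ (suc b)) c → b < m →
                 length Bs ≡ suc m → n ≡ length (concat Bs) →
                 ∀ st → T (correct (flags Bs) (after-letter m b (constraints F)) st) →
                 count n (concat Bs) (good N Θ (constraints F) ∘ (c ∷_)) ≡ outcome st (map length Bs)
    count-step n F b {Θ} {Bs} {N} {c} mono mono′ tiled Θ₀ refl (l , h) b<m lenBs len nothing ok =
      count-false n (concat Bs) len λ w w↭ → dec-false (good? N Θ (constraints F) (c ∷ w)) λ g →
        All.head (entails-sound mono′ tiled w↭ [] ok
          (proj₂ (Equivalence.to (after-letter-sound mono Θ₀ l h b<m (constraints F) w) g)))
    count-step n F b {Θ} {Bs} {N} {c} mono mono′ tiled Θ₀ refl (l , h) b<m lenBs len (just (step G g hs)) ok =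
      let K    = constraints F
          R    = after-letter (width F) b K
          L    = map (rename (cut g)) (constraints G)
          okg , ok₁ = Equivalence.to (T-∧ {length g ≡ᵇ width G}) ok
          oks , ok₂ = Equivalence.to (T-∧ {sum g ≡ᵇ length (flags Bs)}) ok₁
          okf , ok₃ = Equivalence.to (T-∧ {fits G g (flags Bs)}) ok₂
          ok→ , ok← = Equivalence.to
            (T-∧ {is-just (Entailment.entails (rank (flags Bs)) (length (flags Bs)) R hs L)}) ok₃
          g≡   = ≡ᵇ⇒≡ (length g) (width G) okg
          sum≡ = trans (≡ᵇ⇒≡ (sum g) _ oks) (length-map occupied Bs)
          Θ′   = insert b (suc c) Θ
          conc = concat-group g Bs sum≡
          step-⇔ : ∀ w → w ↭ concat Bs →
                   (Av (Θ (width F)) (c ∷ w) × Sat Θ (c ∷ w) K) ⇔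
                   (Av (Θ (width F)) w × Sat (Θ′ ∘ cut g) w (constraints G))
          step-⇔ w w↭ =
            let A⇔ = after-letter-sound mono Θ₀ l h b<m K w
                R⇔ = sat-rename (cut g) (constraints G)
            in mk⇔
              (λ p → let a , s = Equivalence.to A⇔ p in
                     a , Equivalence.to R⇔ (entails-sound mono′ tiled w↭ hs ok→ s))
              (λ (a , s) → Equivalence.from A⇔
                     (a , entails-sound mono′ tiled w↭ [] ok← (Equivalence.from R⇔ s)))
          top : Θ′ (cut g (width G)) ≡ Θ (width F)
          top = trans (cong Θ′ (trans (cong (cut g) (sym g≡)) (trans (cut-total g) (trans sum≡ lenBs))))
                      (insert-top Θ b<m)
      in begin
        count n (concat Bs) (good N Θ K ∘ (c ∷_))
          ≡⟨ count-cong n (concat Bs) len (λ w w↭ →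
               does-⇔ (step-⇔ w w↭) (good? N Θ K (c ∷ w)) (good? N (Θ′ ∘ cut g) (constraints G) w)) ⟩
        count n (concat Bs) (good N (Θ′ ∘ cut g) (constraints G))
          ≡⟨ cong (λ R → count n R (good N (Θ′ ∘ cut g) (constraints G))) conc ⟨
        count n (concat (group g Bs)) (good N (Θ′ ∘ cut g) (constraints G))
          ≡⟨ count-family n G (mono′ ∘ cut-mono g) (trans (insert-zero b Θ) Θ₀) top
               (tiled-group g mono′ tiled sum≡) (fits-sound G g g≡ okf)
               (trans len (cong length (sym conc))) ⟩
        val G (map length (group g Bs))
          ≡⟨ cong (val G) (group-sizes g Bs) ⟩
        val G (sums g (map length Bs)) ∎
      where open ≡-Reasoning

    -- Without letters only `done` survives: a full family has at least one block, and its blocks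
    -- are nonempty.
    count-family zero F {Bs = []} mono Θ₀ ΘN t (full wid occ) len =
      ⊥-elim (<⇒≢ (width-positive F) wid)
    count-family zero F {Bs = [] ∷ _} mono Θ₀ ΘN t (full wid (() ∷ _)) len
    count-family zero F {Bs = (_ ∷ _) ∷ _} mono Θ₀ ΘN t (full wid occ) ()
    count-family zero _ mono Θ₀ ΘN t done len = sym val-done
    count-family (suc n) F {Θ} {Bs} {N} mono Θ₀ ΘN t (full wid occ) len =
      trans (go [] Bs refl) (sym (val-step F (map length Bs) (trans (length-map length Bs) wid) (sizes Bs occ)))
      where
      sizes : ∀ Bs → All Occupied Bs → All (0 <_) (map length Bs)
      sizes []             []      = []
      sizes ((_ ∷ _) ∷ Bs) (_ ∷ o) = s≤s z≤n ∷ sizes Bs o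

      p : List ℕ → Bool
      p = good N Θ (constraints F)

      φ : List ℕ → ℕ → List ℕ → ℕ
      φ xs c ys = count n (xs ++ ys) (p ∘ (c ∷_))

      leaf : ∀ pre B post → Bs ≡ pre ++ B ∷ post → ∀ xs c ys → B ≡ xs ++ c ∷ ys →
             φ (concat pre ++ xs) c (ys ++ concat post) ≡
             branch F (map length pre) (length xs) (length ys) (map length post)
      leaf pre _ post refl xs c ys refl = begin
        count n ((concat pre ++ xs) ++ (ys ++ concat post)) (p ∘ (c ∷_))
          ≡⟨ cong (λ R → count n R (p ∘ (c ∷_))) (concat-fine pre xs ys post) ⟨
        count n (concat fine) (p ∘ (c ∷_))
          ≡⟨ count-step n F b mono (insert-mono b mono (≤-trans (proj₁ range) (n≤1+n c)) (proj₂ range))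
               (proj₂ (tiled-split pre t)) Θ₀ ΘN range b<m lenfine lenR st ok ⟩
        outcome st (map length fine)
          ≡⟨ cong₂ outcome
               (trans (cong (λ b → next F b (occupied xs) (occupied ys)) (sym (length-map length pre)))
                      (cong₂ (next F (length (map length pre)))
                        (sym (occupied-length xs)) (sym (occupied-length ys))))
               (map-++ length pre (xs ∷ ys ∷ post)) ⟩
        branch F (map length pre) (length xs) (length ys) (map length post) ∎
        where
        open ≡-Reasoning
        b = length pre
        m = width F
        fine = pre ++ xs ∷ ys ∷ post
        range = proj₁ (tiled-split pre t)
        lenpre : b + suc (length post) ≡ m
        lenpre = trans (sym (length-++ pre)) wid
        b<m : b < m
        b<m = ≤-trans (≤-reflexive (+-comm 1 b)) (≤-trans (+-monoʳ-≤ b (s≤s z≤n)) (≤-reflexive lenpre))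
        lenfine : length fine ≡ suc m
        lenfine = trans (length-++ pre) (trans (+-suc b _) (cong suc lenpre))
        lenR : n ≡ length (concat fine)
        lenR = trans (length-split (concat pre ++ xs) (ys ++ concat post) len
                 (trans (sym (concat-++ pre _)) (trans (cong (concat pre ++_) (++-assoc xs (c ∷ ys) _))
                   (sym (++-assoc (concat pre) xs _)))))
                 (cong length (sym (concat-fine pre xs ys post)))
        st = next F b (occupied xs) (occupied ys)
        ok : T (correct (flags fine) (after-letter m b (constraints F)) st)
        ok = subst (λ fs → T (correct fs (after-letter m b (constraints F)) st))
               (sym (fine-flags pre xs ys post lenpre (Allₚ.++⁻ˡ pre occ) (All.tail (Allₚ.++⁻ʳ pre occ))))
               (correct-at-sound F (occupied xs) (occupied ys) b<m)

      go : ∀ pre post → Bs ≡ pre ++ post →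
           Σ-splits (concat post) (λ xs → φ (concat pre ++ xs)) ≡ expand F (map length pre) (map length post)
      go pre []         eq = refl
      go pre (B ∷ post) eq = begin
        Σ-splits (B ++ concat post) (λ xs → φ (concat pre ++ xs))
          ≡⟨ Σ-splits-++ B (concat post) ⟩
        Σ-splits B (λ xs c ys → φ (concat pre ++ xs) c (ys ++ concat post)) +
        Σ-splits (concat post) (λ xs → φ (concat pre ++ (B ++ xs)))
          ≡⟨ cong₂ _+_
               (trans (Σ-splits-cong B (leaf pre B post eq)) (Σ-splits-length B))
               (trans (Σ-splits-cong (concat post) λ xs c ys _ → cong (λ R → φ R c ys) (snoc xs))
                 (trans (go (pre ++ B ∷ []) post (trans eq (sym (++-assoc pre (B ∷ []) post))))
                   (cong (λ ss → expand F ss (map length post)) (map-++ length pre (B ∷ []))))) ⟩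
        expand F (map length pre) (map length (B ∷ post)) ∎
        where
        open ≡-Reasoning
        snoc : ∀ xs → concat pre ++ (B ++ xs) ≡ concat (pre ++ B ∷ []) ++ xs
        snoc xs = trans (sym (++-assoc (concat pre) B xs)) (cong (_++ xs)
          (trans (cong (concat pre ++_) (sym (++-identityʳ B))) (concat-++ pre (B ∷ []))))

-- From words to arrangements

countB-++ : {A : Set} (p : A → Bool) → ∀ xs ys → countB p (xs ++ ys) ≡ countB p xs + countB p ys
countB-++ p []       ys = refl
countB-++ p (x ∷ xs) ys with p x
... | true  = cong suc (countB-++ p xs ys)
... | false = countB-++ p xs ys

countB-map : {A B : Set} (p : B → Bool) (f : A → B) → ∀ xs → countB p (map f xs) ≡ countB (p ∘ f) xs
countB-map p f []       = refl
countB-map p f (x ∷ xs) with p (f x)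
... | true  = cong suc (countB-map p f xs)
... | false = countB-map p f xs

countB-cong : {A : Set} {p q : A → Bool} → (∀ x → p x ≡ q x) → ∀ xs → countB p xs ≡ countB q xs
countB-cong h []       = refl
countB-cong h (x ∷ xs) rewrite h x = cong₂ (if_then_else_ _) (cong suc (countB-cong h xs)) (countB-cong h xs)

countB-false : {A : Set} (xs : List A) → countB (λ _ → false) xs ≡ 0
countB-false []       = refl
countB-false (x ∷ xs) = countB-false xs

countB-words : ∀ n k (p : List ℕ → Bool) L →
               countB p (concatMap (λ a → map (a ∷_) (words n k)) L) ≡
               sum (map (λ a → countB (p ∘ (a ∷_)) (words n k)) L)
countB-words n k p []      = refl
countB-words n k p (a ∷ L) = trans (countB-++ p (map (a ∷_) (words n k)) _)
  (cong₂ _+_ (countB-map p (a ∷_) (words n k)) (countB-words n k p L))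

_without_ : (ℕ → Bool) → ℕ → ℕ → Bool
(χ without a) v = χ v ∧ not (a ≡ᵇ v)

allB-without : ∀ χ a w → allB (χ without a) w ≡ allB χ w ∧ not (anyB (a ≡ᵇ_) w)
allB-without χ a []      = refl
allB-without χ a (v ∷ w) rewrite allB-without χ a w with χ v | a ≡ᵇ v | allB χ w
... | false | _     | _     = refl
... | true  | true  | true  = refl
... | true  | true  | false = refl
... | true  | false | _     = refl

≡ᵇ-refl : ∀ n → (n ≡ᵇ n) ≡ true
≡ᵇ-refl n = Equivalence.to T-≡ (≡⇒≡ᵇ n n refl)

≢⇒≡ᵇ : ∀ {m n} → m ≢ n → (m ≡ᵇ n) ≡ false
≢⇒≡ᵇ {m} {n} ne with m ≡ᵇ n in eq
... | true  = ⊥-elim (ne (≡ᵇ⇒≡ m n (Equivalence.from T-≡ eq)))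
... | false = refl

filter-without : ∀ χ {a L} → All (a ≢_) L → filterᵇ (χ without a) L ≡ filterᵇ χ L
filter-without χ []                      = refl
filter-without χ {a} {v ∷ L} (ne ∷ nes) rewrite ≢⇒≡ᵇ ne with χ v
... | true  = cong (v ∷_) (filter-without χ nes)
... | false = filter-without χ nes

map-cong-All : ∀ {f g : ℕ → ℕ} {L} → All (λ a → f a ≡ g a) L → map f L ≡ map g L
map-cong-All []       = refl
map-cong-All (e ∷ es) = cong₂ _∷_ e (map-cong-All es)

filter-keep : ∀ χ l (L : List ℕ) → χ l ≡ true → filterᵇ χ (l ∷ L) ≡ l ∷ filterᵇ χ L
filter-keep χ l L eq rewrite eq = refl

filter-drop : ∀ χ l (L : List ℕ) → χ l ≡ false → filterᵇ χ (l ∷ L) ≡ filterᵇ χ L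
filter-drop χ l L eq rewrite eq = refl

-- Removing a later letter leaves the head `l` in place, so the induction passes to the tail with
-- `l` put in front of the list argument of `g`.
sum-splits : ∀ χ {L} → Unique L → (g : ℕ → List ℕ → ℕ) →
             sum (map (λ a → if χ a then g a (filterᵇ (χ without a) L) else 0) L) ≡
             Σ-splits (filterᵇ χ L) (λ xs c ys → g c (xs ++ ys))
sum-splits χ []                       g = refl
sum-splits χ {l ∷ L} (l∉L ∷ unique) g = by-value (χ l) refl
  where
  f : ℕ → ℕ
  f a = if χ a then g a (filterᵇ (χ without a) (l ∷ L)) else 0
  φ : List ℕ → ℕ → List ℕ → ℕ
  φ xs c ys = g c (xs ++ ys)
  if-true : ∀ {b} {x y : ℕ} → b ≡ true → (if b then x else y) ≡ x
  if-true refl = refl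
  if-false : ∀ {b} {x y : ℕ} → b ≡ false → (if b then x else y) ≡ y
  if-false refl = refl
  self : (χ without l) l ≡ false
  self rewrite ≡ᵇ-refl l = ∧-zeroʳ (χ l)
  by-value : ∀ b → χ l ≡ b → sum (map f (l ∷ L)) ≡ Σ-splits (filterᵇ χ (l ∷ L)) φ
  by-value true  eq = trans
    (cong₂ _+_
      (trans (if-true eq) (cong (g l) (trans (filter-drop (χ without l) l L self) (filter-without χ l∉L))))
      (trans
        (cong sum (map-cong-All (All.map (λ {a} l≢a → cong (λ R → if χ a then g a R else 0)
          (filter-keep (χ without a) l L (cong₂ (λ x y → x ∧ not y) eq (≢⇒≡ᵇ (l≢a ∘ sym))))) l∉L)))
        (sum-splits χ unique (λ a zs → g a (l ∷ zs)))))
    (cong (λ R → Σ-splits R φ) (sym (filter-keep χ l L eq)))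
  by-value false eq = trans
    (cong₂ _+_ (if-false eq)
      (trans
        (cong sum (map-cong-All (All.map (λ {a} l≢a → cong (λ R → if χ a then g a R else 0)
          (filter-drop (χ without a) l L (cong (_∧ not (a ≡ᵇ l)) eq))) l∉L)))
        (sum-splits χ unique g)))
    (cong (λ R → Σ-splits R φ) (sym (filter-drop χ l L eq)))

-- Generalised to a set χ of admissible letters: once the first letter `a` is chosen, distinctness
-- turns into admissibility for `χ without a`.
count-words : ∀ n k χ q → countB (λ w → distinct w ∧ (allB χ w ∧ q w)) (words n k) ≡
              count k (filterᵇ χ (upTo n)) q
count-words n zero    χ q with q []
... | true  = refl
... | false = refl
count-words n (suc k) χ q = begin
  countB p (words n (suc k))
    ≡⟨ countB-words n k p (upTo n) ⟩
  sum (map (λ a → countB (p ∘ (a ∷_)) (words n k)) (upTo n))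
    ≡⟨ cong sum (map-cong-All (All.tabulate {xs = upTo n} λ {a} _ → letter a)) ⟩
  sum (map (λ a → if χ a then count k (filterᵇ (χ without a) (upTo n)) (q ∘ (a ∷_)) else 0) (upTo n))
    ≡⟨ sum-splits χ (Uniqueₚ.upTo⁺ n) (λ a R → count k R (q ∘ (a ∷_))) ⟩
  count (suc k) (filterᵇ χ (upTo n)) q ∎
  where
  open ≡-Reasoning
  p : List ℕ → Bool
  p w = distinct w ∧ (allB χ w ∧ q w)
  bool : ∀ x d y z → (not x ∧ d) ∧ (y ∧ z) ≡ d ∧ ((y ∧ not x) ∧ z)
  bool true  true  true  z = refl
  bool true  true  false z = refl
  bool true  false y     z = refl
  bool false d     true  z = refl
  bool false d     false z = refl
  letter : ∀ a → countB (p ∘ (a ∷_)) (words n k) ≡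
                 (if χ a then count k (filterᵇ (χ without a) (upTo n)) (q ∘ (a ∷_)) else 0)
  letter a with χ a
  ... | true  = trans
    (countB-cong (λ w → trans (bool (anyB (a ≡ᵇ_) w) (distinct w) (allB χ w) (q (a ∷ w)))
                         (cong (λ b → distinct w ∧ (b ∧ q (a ∷ w))) (sym (allB-without χ a w)))) (words n k))
    (count-words n k (χ without a) (q ∘ (a ∷_)))
  ... | false = trans (countB-cong (λ w → ∧-zeroʳ (distinct (a ∷ w))) (words n k)) (countB-false (words n k))

count-permutations : ∀ n q → countB (λ w → distinct w ∧ q w) (words n n) ≡ count n (upTo n) q
count-permutations n q = trans
  (countB-cong (λ w → cong (λ b → distinct w ∧ (b ∧ q w)) (sym (allB-true w))) (words n n))
  (trans (count-words n n (λ _ → true) q) (cong (λ R → count n R q) (filter-true (upTo n))))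
  where
  allB-true : ∀ w → allB (λ _ → true) w ≡ true
  allB-true []      = refl
  allB-true (_ ∷ w) = allB-true w
  filter-true : ∀ (L : List ℕ) → filterᵇ (λ _ → true) L ≡ L
  filter-true []      = refl
  filter-true (a ∷ L) = cong (a ∷_) (filter-true L)

-- Pattern containment

anyB-subseqs : ∀ p w → T (anyB p (subseqs w)) ⇔ ∃ λ s → s ⊆ w × T (p s)
anyB-subseqs p w = mk⇔ (to p w) (λ (s , s⊆ , t) → from p s⊆ t)
  where
  anyB-++ : ∀ (p : List ℕ → Bool) xs ys → anyB p (xs ++ ys) ≡ anyB p xs ∨ anyB p ys
  anyB-++ p []       ys = refl
  anyB-++ p (x ∷ xs) ys with p x
  ... | true  = refl
  ... | false = anyB-++ p xs ys
  anyB-map : ∀ (p : List ℕ → Bool) (f : List ℕ → List ℕ) xs → anyB p (map f xs) ≡ anyB (p ∘ f) xs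
  anyB-map p f []       = refl
  anyB-map p f (x ∷ xs) = cong (p (f x) ∨_) (anyB-map p f xs)
  unfold : ∀ p c w → anyB p (subseqs (c ∷ w)) ≡ anyB (p ∘ (c ∷_)) (subseqs w) ∨ anyB p (subseqs w)
  unfold p c w = trans (anyB-++ p (map (c ∷_) (subseqs w)) (subseqs w))
    (cong (_∨ anyB p (subseqs w)) (anyB-map p (c ∷_) (subseqs w)))
  to : ∀ p w → T (anyB p (subseqs w)) → ∃ λ s → s ⊆ w × T (p s)
  to p [] t with p [] in eq
  ... | true = [] , [] , Equivalence.from T-≡ eq
  to p (c ∷ w) t with Equivalence.to (T-∨ {anyB (p ∘ (c ∷_)) (subseqs w)}) (subst T (unfold p c w) t)
  ... | inj₁ t′ = let s , s⊆ , h = to (p ∘ (c ∷_)) w t′ in c ∷ s , refl ∷ s⊆ , h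
  ... | inj₂ t′ = let s , s⊆ , h = to p w t′ in s , c ∷ʳ s⊆ , h
  from : ∀ p {s w} → s ⊆ w → T (p s) → T (anyB p (subseqs w))
  from p [] h = Equivalence.from (T-∨ {p []}) (inj₁ h)
  from p {w = c ∷ w} (_ ∷ʳ s⊆) h = subst T (sym (unfold p c w))
    (Equivalence.from (T-∨ {anyB (p ∘ (c ∷_)) (subseqs w)}) (inj₂ (from p s⊆ h)))
  from p {w = c ∷ w} (refl ∷ s⊆) h = subst T (sym (unfold p c w))
    (Equivalence.from (T-∨ {anyB (p ∘ (c ∷_)) (subseqs w)}) (inj₁ (from (p ∘ (c ∷_)) s⊆ h)))

T-<ᵇ : ∀ {m n} → m < n → (m <ᵇ n) ≡ true
T-<ᵇ lt = Equivalence.to T-≡ (<⇒<ᵇ lt)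

F-<ᵇ : ∀ {m n} → n ≤ m → (m <ᵇ n) ≡ false
F-<ᵇ {m} {n} le with m <ᵇ n in eq
... | true  = ⊥-elim (<⇒≱ (<ᵇ⇒< m n (Equivalence.from T-≡ eq)) le)
... | false = refl

-- The comparisons are split in the order in which `orderIso` evaluates them, so that each mismatch
-- is absurd at once. The three that generate the order are recorded.
iso-1234 : ∀ a b c d → T (orderIso (a ∷ b ∷ c ∷ d ∷ []) (0 ∷ 1 ∷ 2 ∷ 3 ∷ [])) ⇔ (a < b × b < c × c < d)
iso-1234 a b c d = mk⇔ to from
  where
  to : T (orderIso (a ∷ b ∷ c ∷ d ∷ []) (0 ∷ 1 ∷ 2 ∷ 3 ∷ [])) → a < b × b < c × c < d
  to t
    rewrite F-<ᵇ (≤-refl {a}) | F-<ᵇ (≤-refl {b}) | F-<ᵇ (≤-refl {c})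
    with a <ᵇ b in ab
  ... | false = ⊥-elim t
  ... | true  with a <ᵇ c
  ... | false = ⊥-elim t
  ... | true  with a <ᵇ d
  ... | false = ⊥-elim t
  ... | true  with b <ᵇ a
  ... | true  = ⊥-elim t
  ... | false with b <ᵇ c in bc
  ... | false = ⊥-elim t
  ... | true  with b <ᵇ d
  ... | false = ⊥-elim t
  ... | true  with c <ᵇ a
  ... | true  = ⊥-elim t
  ... | false with c <ᵇ b
  ... | true  = ⊥-elim t
  ... | false with c <ᵇ d in cd
  ... | false = ⊥-elim t
  ... | true  =
    <ᵇ⇒< a b (Equivalence.from T-≡ ab) ,
    <ᵇ⇒< b c (Equivalence.from T-≡ bc) ,
    <ᵇ⇒< c d (Equivalence.from T-≡ cd)
  from : a < b × b < c × c < d → T (orderIso (a ∷ b ∷ c ∷ d ∷ []) (0 ∷ 1 ∷ 2 ∷ 3 ∷ []))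
  from (p , q , r)
    rewrite F-<ᵇ (≤-refl {a}) | F-<ᵇ (≤-refl {b}) | F-<ᵇ (≤-refl {c}) | F-<ᵇ (≤-refl {d})
          | T-<ᵇ p | F-<ᵇ (<⇒≤ p) | T-<ᵇ (<-trans p q) | F-<ᵇ (<⇒≤ (<-trans p q))
          | T-<ᵇ (<-trans p (<-trans q r)) | F-<ᵇ (<⇒≤ (<-trans p (<-trans q r))) | T-<ᵇ q | F-<ᵇ (<⇒≤ q)
          | T-<ᵇ (<-trans q r) | F-<ᵇ (<⇒≤ (<-trans q r)) | T-<ᵇ r | F-<ᵇ (<⇒≤ r)
    = tt

iso-2341 : ∀ a b c d → T (orderIso (a ∷ b ∷ c ∷ d ∷ []) (1 ∷ 2 ∷ 3 ∷ 0 ∷ [])) ⇔ (a < b × b < c × d < a)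
iso-2341 a b c d = mk⇔ to from
  where
  to : T (orderIso (a ∷ b ∷ c ∷ d ∷ []) (1 ∷ 2 ∷ 3 ∷ 0 ∷ [])) → a < b × b < c × d < a
  to t
    rewrite F-<ᵇ (≤-refl {a}) | F-<ᵇ (≤-refl {b}) | F-<ᵇ (≤-refl {c})
    with a <ᵇ b in ab
  ... | false = ⊥-elim t
  ... | true  with a <ᵇ c
  ... | false = ⊥-elim t
  ... | true  with a <ᵇ d
  ... | true  = ⊥-elim t
  ... | false with b <ᵇ a
  ... | true  = ⊥-elim t
  ... | false with b <ᵇ c in bc
  ... | false = ⊥-elim t
  ... | true  with b <ᵇ d
  ... | true  = ⊥-elim t
  ... | false with c <ᵇ a
  ... | true  = ⊥-elim t
  ... | false with c <ᵇ b
  ... | true  = ⊥-elim t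
  ... | false with c <ᵇ d
  ... | true  = ⊥-elim t
  ... | false with d <ᵇ a in da
  ... | false = ⊥-elim t
  ... | true  =
    <ᵇ⇒< a b (Equivalence.from T-≡ ab) ,
    <ᵇ⇒< b c (Equivalence.from T-≡ bc) ,
    <ᵇ⇒< d a (Equivalence.from T-≡ da)
  from : a < b × b < c × d < a → T (orderIso (a ∷ b ∷ c ∷ d ∷ []) (1 ∷ 2 ∷ 3 ∷ 0 ∷ []))
  from (p , q , r)
    rewrite F-<ᵇ (≤-refl {a}) | F-<ᵇ (≤-refl {b}) | F-<ᵇ (≤-refl {c}) | F-<ᵇ (≤-refl {d})
          | T-<ᵇ r | F-<ᵇ (<⇒≤ r) | T-<ᵇ (<-trans r p) | F-<ᵇ (<⇒≤ (<-trans r p))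
          | T-<ᵇ (<-trans r (<-trans p q)) | F-<ᵇ (<⇒≤ (<-trans r (<-trans p q))) | T-<ᵇ p | F-<ᵇ (<⇒≤ p)
          | T-<ᵇ (<-trans p q) | F-<ᵇ (<⇒≤ (<-trans p q)) | T-<ᵇ q | F-<ᵇ (<⇒≤ q)
    = tt

iso-4123 : ∀ a b c d → T (orderIso (a ∷ b ∷ c ∷ d ∷ []) (3 ∷ 0 ∷ 1 ∷ 2 ∷ [])) ⇔ (b < c × c < d × d < a)
iso-4123 a b c d = mk⇔ to from
  where
  to : T (orderIso (a ∷ b ∷ c ∷ d ∷ []) (3 ∷ 0 ∷ 1 ∷ 2 ∷ [])) → b < c × c < d × d < a
  to t
    rewrite F-<ᵇ (≤-refl {a}) | F-<ᵇ (≤-refl {b}) | F-<ᵇ (≤-refl {c})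
    with a <ᵇ b
  ... | true  = ⊥-elim t
  ... | false with a <ᵇ c
  ... | true  = ⊥-elim t
  ... | false with a <ᵇ d
  ... | true  = ⊥-elim t
  ... | false with b <ᵇ a
  ... | false = ⊥-elim t
  ... | true  with b <ᵇ c in bc
  ... | false = ⊥-elim t
  ... | true  with b <ᵇ d
  ... | false = ⊥-elim t
  ... | true  with c <ᵇ a
  ... | false = ⊥-elim t
  ... | true  with c <ᵇ b
  ... | true  = ⊥-elim t
  ... | false with c <ᵇ d in cd
  ... | false = ⊥-elim t
  ... | true  with d <ᵇ a in da
  ... | false = ⊥-elim t
  ... | true  =
    <ᵇ⇒< b c (Equivalence.from T-≡ bc) ,
    <ᵇ⇒< c d (Equivalence.from T-≡ cd) ,
    <ᵇ⇒< d a (Equivalence.from T-≡ da)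
  from : b < c × c < d × d < a → T (orderIso (a ∷ b ∷ c ∷ d ∷ []) (3 ∷ 0 ∷ 1 ∷ 2 ∷ []))
  from (p , q , r)
    rewrite F-<ᵇ (≤-refl {a}) | F-<ᵇ (≤-refl {b}) | F-<ᵇ (≤-refl {c}) | F-<ᵇ (≤-refl {d})
          | T-<ᵇ p | F-<ᵇ (<⇒≤ p) | T-<ᵇ (<-trans p q) | F-<ᵇ (<⇒≤ (<-trans p q))
          | T-<ᵇ (<-trans p (<-trans q r)) | F-<ᵇ (<⇒≤ (<-trans p (<-trans q r))) | T-<ᵇ q | F-<ᵇ (<⇒≤ q)
          | T-<ᵇ (<-trans q r) | F-<ᵇ (<⇒≤ (<-trans q r)) | T-<ᵇ r | F-<ᵇ (<⇒≤ r)
    = tt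

Four : (ℕ → ℕ → ℕ → ℕ → Set) → List ℕ → Set
Four P w = ∃ λ a → ∃ λ b → ∃ λ c → ∃ λ d → a ∷ b ∷ c ∷ d ∷ [] ⊆ w × P a b c d

contains-four : ∀ {P : ℕ → ℕ → ℕ → ℕ → Set} {i j k l} w →
                (∀ a b c d → T (orderIso (a ∷ b ∷ c ∷ d ∷ []) (i ∷ j ∷ k ∷ l ∷ [])) ⇔ P a b c d) →
                T (contains w (i ∷ j ∷ k ∷ l ∷ [])) ⇔ Four P w
contains-four {P} {i} {j} {k} {l} w iso = mk⇔
  (λ t → let s , s⊆ , h = Equivalence.to (anyB-subseqs _ w) t in four s s⊆ h)
  (λ (a , b , c , d , s⊆ , h) →
    Equivalence.from (anyB-subseqs _ w) (_ , s⊆ , Equivalence.from (iso a b c d) h))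
  where
  four : ∀ s → s ⊆ w → T (orderIso s (i ∷ j ∷ k ∷ l ∷ [])) → Four P w
  four (a ∷ b ∷ c ∷ d ∷ []) s⊆ h = a , b , c , d , s⊆ , Equivalence.to (iso a b c d) h

Asc Rot₁ Rot₃ : ℕ → ℕ → ℕ → ℕ → Set
Asc  a b c d = a < b × b < c × c < d
Rot₁ a b c d = a < b × b < c × d < a
Rot₃ a b c d = b < c × c < d × d < a

head-distinct : ∀ {w x} {ys : List ℕ} → Unique w → x ∷ ys ⊆ w → All (x ≢_) ys
head-distinct (_ ∷ u)  (_ ∷ʳ s)   = head-distinct u s
head-distinct (ne ∷ _) (refl ∷ s) = All-resp-⊆ s ne

-- The bound `suc c` in `Av` admits values up to `c`, while the patterns ask for strictly smaller
-- ones; the distinctness of the letters closes this gap. For 1234 the upper end n is a bound on all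
-- letters.
av-four : ∀ {n w} → Unique w → All (_< n) w →
          (¬ Four Asc w × ¬ Four Rot₁ w × ¬ Four Rot₃ w) ⇔ Av n w
av-four {n} {w} u bound = mk⇔
  (λ (asc , rot₁ , rot₃) → along-tabulate w λ g →
    →inc (λ s l xy yz h → asc (_ , _ , _ , _ , g s , l , xy , yz)) ,
    →inc (λ s l xy yz h → rot₃ (_ , _ , _ , _ , g s , xy , yz ,
      ≤∧≢⇒< (≤-pred h) (All.lookup (head-distinct u (g s)) (there (there (here refl))) ∘ sym))) ,
    →cyc (λ s l xy h → rot₁ (_ , _ , _ , _ , g s , l , xy ,
      ≤∧≢⇒< (≤-pred h) (All.lookup (head-distinct u (g s)) (there (there (here refl))) ∘ sym))))
  (λ av →
    (λ (_ , _ , _ , _ , s , ab , bc , cd) →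
      let _ , (i , _ , _) , s′ = along-lookup av s in
      inc→ i s′ ab bc cd (All.lookup bound (to∈ (rest (rest (rest s)))))) ,
    (λ (_ , _ , _ , _ , s , ab , bc , da) →
      let _ , (_ , _ , c) , s′ = along-lookup av s in cyc→ c s′ ab bc (m<n⇒m<1+n da)) ,
    (λ (_ , _ , _ , _ , s , bc , cd , da) →
      let _ , (_ , i , _) , s′ = along-lookup av s in inc→ i s′ z≤n bc cd (m<n⇒m<1+n da)))

T-not : ∀ {b} → T (not b) ⇔ (¬ T b)
T-not {true}  = mk⇔ (λ ()) (λ f → f tt)
T-not {false} = mk⇔ (λ _ ()) (λ _ → tt)

⇔-does : ∀ {b} {P : Set} (d : Dec P) → T b ⇔ P → b ≡ does d
⇔-does {true}  (yes p) e = refl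
⇔-does {false} (yes p) e = ⊥-elim (Equivalence.from e p)
⇔-does {true}  (no ¬p) e = ⊥-elim (¬p (Equivalence.to e tt))
⇔-does {false} (no ¬p) e = refl

avoidsAll-sound : ∀ w → T (avoidsAll T3p29 w) ⇔ (¬ Four Asc w × ¬ Four Rot₁ w × ¬ Four Rot₃ w)
avoidsAll-sound w = mk⇔
  (λ t → let p , t′  = Equivalence.to (T-∧ {not (contains w p₁)}) t
             q , t″  = Equivalence.to (T-∧ {not (contains w p₂)}) t′
             r , _   = Equivalence.to (T-∧ {not (contains w p₃)}) t″
         in Equivalence.to T-not p ∘ Equivalence.from (contains-four w iso-1234) ,
            Equivalence.to T-not q ∘ Equivalence.from (contains-four w iso-2341) ,
            Equivalence.to T-not r ∘ Equivalence.from (contains-four w iso-4123))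
  (λ (p , q , r) →
    Equivalence.from (T-∧ {not (contains w p₁)})
      (Equivalence.from T-not (p ∘ Equivalence.to (contains-four w iso-1234)) ,
    Equivalence.from (T-∧ {not (contains w p₂)})
      (Equivalence.from T-not (q ∘ Equivalence.to (contains-four w iso-2341)) ,
    Equivalence.from (T-∧ {not (contains w p₃)})
      (Equivalence.from T-not (r ∘ Equivalence.to (contains-four w iso-4123)) , tt))))
  where
  p₁ p₂ p₃ : List ℕ
  p₁ = 0 ∷ 1 ∷ 2 ∷ 3 ∷ []
  p₂ = 1 ∷ 2 ∷ 3 ∷ 0 ∷ []
  p₃ = 3 ∷ 0 ∷ 1 ∷ 2 ∷ []

-- The position before any letter is read: a single block containing everything.
extremes : ℕ → ℕ → ℕ
extremes n zero    = 0
extremes n (suc _) = n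

extremes-mono : ∀ n → Mono (extremes n)
extremes-mono n z≤n     = z≤n
extremes-mono n (s≤s _) = ≤-refl

upTo-tiled : ∀ n → Tiled (extremes n) (upTo n ∷ [])
upTo-tiled n = (All.map (z≤n ,_) (Allₚ.all-upTo n) , AllPairsₚ.applyUpTo⁺₁ id n (λ i<j _ → i<j)) ∷ []

countAvoiders-count : ∀ n → let R = concat (upTo n ∷ []) in
                      countAvoiders T3p29 n ≡ count n R (good n (extremes n) (constraints free))
countAvoiders-count n = trans (count-permutations n (avoidsAll T3p29))
  (trans (cong (λ R → count n R (avoidsAll T3p29)) (sym (++-identityʳ (upTo n))))
    (count-cong n R (sym (trans (cong length (++-identityʳ (upTo n))) (length-upTo n))) λ w w↭ →
      let unique = arrangement-unique (extremes-mono n) (upTo-tiled n) w↭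
          bound  = All.tabulate λ v∈ → proj₂
                 (All.lookup (tiled-range (extremes-mono n) (upTo-tiled n)) (∈-resp-↭ w↭ v∈))
          av     = av-four unique bound
          av′    = avoidsAll-sound w
      in ⇔-does (good? n (extremes n) [] w)
           (mk⇔ (λ t → Equivalence.to av (Equivalence.to av′ t) , [])
                (λ (a , _) → Equivalence.from av′ (Equivalence.from av a)))))
  where
  R = concat (upTo n ∷ [])

module _ (val : Family → List ℕ → ℕ) (val-done : val line (0 ∷ []) ≡ 1)
         (val-step : ∀ F ss → length ss ≡ width F → All (0 <_) ss → val F ss ≡ Values.expand val F [] ss) where

  countAvoiders-val : ∀ n → countAvoiders T3p29 (suc n) ≡ val free (suc n ∷ [])
  countAvoiders-val n = trans (countAvoiders-count (suc n))
    (trans (Values.count-family val val-done val-step (suc n) free (extremes-mono (suc n)) refl refl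
              (upTo-tiled (suc n)) (full refl (tt ∷ []))
              (sym (trans (cong length (++-identityʳ (upTo (suc n)))) (length-upTo (suc n)))))
      (cong (λ k → val free (k ∷ [])) (length-upTo (suc n))))

-- The numbers of words in the families

Σ-sizes-cong : ∀ n {φ ψ} → (∀ x y → φ x y ≡ ψ x y) → Σ-sizes n φ ≡ Σ-sizes n ψ
Σ-sizes-cong zero    h = refl
Σ-sizes-cong (suc n) h = cong₂ _+_ (h 0 n) (Σ-sizes-cong n λ x → h (suc x))

Σ-sizes-none : ∀ n {φ} → (∀ x y → φ x y ≡ 0) → Σ-sizes n φ ≡ 0
Σ-sizes-none zero    h = refl
Σ-sizes-none (suc n) h rewrite h 0 n = Σ-sizes-none n λ x → h (suc x)

Σ-sizes-last : ∀ n φ → Σ-sizes (suc n) φ ≡ Σ-sizes n (λ x y → φ x (suc y)) + φ n 0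
Σ-sizes-last zero    φ = +-identityʳ (φ 0 0)
Σ-sizes-last (suc n) φ = trans
  (cong (φ 0 (suc n) +_) (Σ-sizes-last n (λ x → φ (suc x))))
  (sym (+-assoc (φ 0 (suc n)) _ _))

Σ-sizes-top : ∀ n φ → (∀ x y → φ x (suc y) ≡ 0) → Σ-sizes (suc n) φ ≡ φ n 0
Σ-sizes-top n φ h = trans (Σ-sizes-last n φ) (cong (_+ φ n 0) (Σ-sizes-none n h))

-- Ballot numbers: `β b j` is the difference of the binomial coefficients of 2b + j over b and over
-- b - 1, and `β n 0` is the n-th Catalan number.
β : ℕ → ℕ → ℕ
β zero    j       = 1
β (suc b) zero    = β b 1
β (suc b) (suc j) = β b (2 + j) + β (suc b) j

-- Splitting off the summand with y = 0 raises the offset of the others by one, which is the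
-- recursion of `β`.
ballot-sum : ∀ b j → Σ-sizes (suc b) (λ x y → β x (y + j)) ≡ β b (suc j)
ballot-sum zero    j = refl
ballot-sum (suc b) j = trans (Σ-sizes-last (suc b) (λ x y → β x (y + j)))
  (cong (_+ β (suc b) j) (trans
    (Σ-sizes-cong (suc b) λ x y → cong (β x) (sym (+-suc y j)))
    (ballot-sum b (suc j))))

ballot-sum₀ : ∀ b → Σ-sizes (suc b) β ≡ β (suc b) 0
ballot-sum₀ b = trans (Σ-sizes-cong (suc b) λ x y → cong (β x) (sym (+-identityʳ y))) (ballot-sum b 0)

-- μ t = 2 ^ t - 1 and η t = 2 ^ t - 1 - t
μ : ℕ → ℕ
μ zero    = 0
μ (suc t) = μ t + 2 ^ t

η : ℕ → ℕ
η zero    = 0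
η (suc t) = η t + μ t

μ-sum : ∀ t → Σ-sizes t (λ x _ → 2 ^ x) ≡ μ t
μ-sum zero    = refl
μ-sum (suc t) = trans (Σ-sizes-last t (λ x _ → 2 ^ x)) (cong (_+ 2 ^ t) (μ-sum t))

2^≡1+μ : ∀ t → 2 ^ t ≡ suc (μ t)
2^≡1+μ zero    = refl
2^≡1+μ (suc t) = trans
  (cong (2 ^ t +_) (trans (+-identityʳ _) (2^≡1+μ t)))
  (trans (+-suc (2 ^ t) (μ t)) (cong suc (+-comm (2 ^ t) (μ t))))

μ≡t+η : ∀ t → μ t ≡ t + η t
μ≡t+η zero    = refl
μ≡t+η (suc t) = begin
  μ t + 2 ^ t     ≡⟨ cong (μ t +_) (2^≡1+μ t) ⟩
  μ t + suc (μ t) ≡⟨ cong (λ q → q + suc (μ t)) (μ≡t+η t) ⟩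
  (t + η t) + suc (μ t) ≡⟨ lemma t (η t) (μ t) ⟩
  suc t + (η t + μ t) ∎
  where
  open ≡-Reasoning
  lemma : ∀ t η μ → (t + η) + suc μ ≡ suc t + (η + μ)
  lemma = ℕ-Solver.solve-∀

-- L b m t counts the words of the family shuffle beyond the ballot ones; 1 + L 0 m t is a binomial
-- coefficient.
L : ℕ → ℕ → ℕ → ℕ
L zero    zero    t       = 0
L zero    (suc m) zero    = 0
L zero    (suc m) (suc t) = suc (L zero m (suc t) + L zero (suc m) t)
L (suc b) zero    t       = 0
L (suc b) (suc m) t       = L b (suc m) t + L (suc b) m t

-- The sum of `β b (m + i)` for i from 0 to t.
σ : ℕ → ℕ → ℕ → ℕ
σ b m zero    = β b m
σ b m (suc t) = σ b m t + β b (m + suc t)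

d₂ : ℕ → ℕ → ℕ → ℕ
d₂ b m t = σ b m t + 2 ^ b * η t

-- The count after reading a letter in the top block of `desc₁` with x letters of that block below
-- it: `asc₁` if there are none above, `cap₁` otherwise. The formulas also cover x = 0.
h₁ : ℕ → ℕ → ℕ → ℕ → ℕ
h₁ b m x zero    = β b (m + x) + (m * x + η x)
h₁ b m x (suc _) = β b (m + x) + μ x

-- The recursion of `desc₁`, with letters from the lowest, middle and top block. The middle block is
-- decreasing, so only its largest letter can be read, whence `pred m`. At b = 0 the family
-- degenerates to `base₁`.
d₁ : ℕ → ℕ → ℕ → ℕ
d₁ zero    m t = 1 + L 0 m t + η t
d₁ (suc b) m t =
  (Σ-sizes b (λ x y → d₂ x (suc y + m) t) + d₁ b m t) +
  ((β (suc b) (pred m) + L (suc b) (pred m) t) + Σ-sizes t (h₁ (suc b) m))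

h₀ : ℕ → ℕ → ℕ → ℕ
h₀ b x zero    = β b x + η x
h₀ b x (suc y) = β b x + L b x (suc y) + η x

-- The recursion of `desc₀`, which degenerates to `avoid` at b = 0; `h₀` combines `asc₀` and `cap₀`
-- as `h₁` does `asc₁` and `cap₁`.
d₀ : ℕ → ℕ → ℕ
d₀ zero    t = β t 0
d₀ (suc b) t = (Σ-sizes b (λ x y → d₁ x (suc y) t) + d₀ b t) + Σ-sizes t (h₀ (suc b))

value : Family → List ℕ → ℕ
value free    (n ∷ [])             = Σ-sizes n d₀
value avoid   (n ∷ [])             = β n 0
value line    _                    = 1
value ballot  (b ∷ j ∷ [])         = β b j
value merge   (m ∷ t ∷ [])         = 1 + L 0 m t
value stack   _                    = 1
value tail    (b ∷ _ ∷ [])         = β b 0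
value final   (b ∷ m ∷ _ ∷ [])     = β b m
value power   (_ ∷ x ∷ _ ∷ [])     = 2 ^ x
value linear  (_ ∷ m ∷ _ ∷ [])     = suc m
value asc₀    (b ∷ t ∷ [])         = β b t + η t
value asc₁    (b ∷ m ∷ t ∷ [])     = β b (m + t) + (m * t + η t)
value asc₂    (b ∷ m ∷ n ∷ t ∷ []) = β b (m + (n + t)) + (t + η t)
value shuffle (b ∷ m ∷ t ∷ [])     = β b m + L b m t
value cap₀    (b ∷ m ∷ t ∷ [])     = β b m + L b m t + η m
value cap₁    (b ∷ m ∷ x ∷ _ ∷ []) = β b (m + x) + μ x
value base₁   (m ∷ t ∷ [])         = d₁ 0 m t
value base₂   (_ ∷ _ ∷ t ∷ [])     = 2 ^ t
value desc₀   (b ∷ t ∷ [])         = d₀ b t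
value desc₁   (b ∷ m ∷ t ∷ [])     = d₁ b m t
value desc₂   (b ∷ m ∷ n ∷ t ∷ []) = d₂ b (m + n) t
value _       _                    = 0

Σ-sizes-+ : ∀ n (φ ψ : ℕ → ℕ → ℕ) → Σ-sizes n (λ x y → φ x y + ψ x y) ≡ Σ-sizes n φ + Σ-sizes n ψ
Σ-sizes-+ zero    φ ψ = refl
Σ-sizes-+ (suc n) φ ψ = trans
  (cong (φ 0 n + ψ 0 n +_) (Σ-sizes-+ n (λ x → φ (suc x)) (λ x → ψ (suc x))))
  (exchange (φ 0 n) (ψ 0 n) _ _)
  where
  exchange : ∀ a b c d → (a + b) + (c + d) ≡ (a + c) + (b + d)
  exchange = ℕ-Solver.solve-∀

Σ-sizes-* : ∀ n (φ : ℕ → ℕ → ℕ) k → Σ-sizes n (λ x y → φ x y * k) ≡ Σ-sizes n φ * k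
Σ-sizes-* zero    φ k = refl
Σ-sizes-* (suc n) φ k = trans (cong (φ 0 n * k +_) (Σ-sizes-* n (λ x → φ (suc x)) k))
  (sym (*-distribʳ-+ k (φ 0 n) _))

η-sum : ∀ t → Σ-sizes t (λ x _ → μ x) ≡ η t
η-sum zero    = refl
η-sum (suc t) = trans (Σ-sizes-last t (λ x _ → μ x)) (cong (_+ μ t) (η-sum t))

ballot-last : ∀ b j → Σ-sizes b (λ x y → β x (suc y + j)) + β b j ≡ β b (suc j)
ballot-last b j = trans (sym (Σ-sizes-last b (λ x y → β x (y + j)))) (ballot-sum b j)

L-zero : ∀ b m → L b m 0 ≡ 0
L-zero zero    zero    = refl
L-zero zero    (suc m) = refl
L-zero (suc b) zero    = refl
L-zero (suc b) (suc m) = cong₂ _+_ (L-zero b (suc m)) (L-zero (suc b) m)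

d₁-zero : ∀ b m → d₁ b (suc m) 0 ≡ β b (suc m)
d₁-zero zero    m = refl
d₁-zero (suc b) m = cong₂ _+_
  (trans (cong₂ _+_ (Σ-sizes-cong b λ x y →
                      trans (cong (β x (suc y + suc m) +_) (*-zeroʳ (2 ^ x))) (+-identityʳ _))
                    (d₁-zero b m))
         (ballot-last b (suc m)))
  (trans (+-identityʳ _) (trans (cong (β (suc b) m +_) (L-zero (suc b) m)) (+-identityʳ _)))

-- With an empty upper block `desc₀` also turns into `avoid`; thus `d₀` serves for every first
-- letter in `step-free`.
d₀-zero : ∀ b → d₀ b 0 ≡ β b 0
d₀-zero zero    = refl
d₀-zero (suc b) = trans (+-identityʳ _)
  (trans (cong₂ _+_
           (Σ-sizes-cong b λ x y → trans (d₁-zero x y) (cong (β x) (sym (+-identityʳ (suc y)))))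
           (d₀-zero b))
    (ballot-last b 0))

-- With an empty lowest block `desc₂` turns into `base₂`.
d₂-zero : ∀ m t → d₂ 0 m t ≡ 2 ^ t
d₂-zero m t = trans (cong₂ _+_ (σ-zero t) (*-identityˡ (η t)))
  (trans (cong suc (sym (μ≡t+η t))) (sym (2^≡1+μ t)))
  where
  σ-zero : ∀ t → σ 0 m t ≡ suc t
  σ-zero zero    = refl
  σ-zero (suc t) = trans (cong (_+ 1) (σ-zero t)) (+-comm (suc t) 1)

-- The ballot part of the recursion of `desc₂`; raising t by one adds an instance of `ballot-sum`.
σ-step : ∀ b m t →
  Σ-sizes (suc b) (λ x y → σ x (y + suc m) t) +
  (β (suc b) m + Σ-sizes t (λ x _ → β (suc b) (suc m + x))) ≡ σ (suc b) (suc m) t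
σ-step b m zero    = cong₂ _+_ (ballot-sum b (suc m)) (+-identityʳ _)
σ-step b m (suc t) = begin
  Σ-sizes (suc b) (λ x y → σ x (y + suc m) t + β x (y + suc m + suc t)) +
  (β (suc b) m + Σ-sizes (suc t) (λ x _ → β (suc b) (suc m + x)))
    ≡⟨ cong₂ (λ u v → u + (β (suc b) m + v))
         (trans (Σ-sizes-+ (suc b) (λ x y → σ x (y + suc m) t) (λ x y → β x (y + suc m + suc t)))
                (cong (S +_) (trans (Σ-sizes-cong (suc b) λ x y → cong (β x) (+-assoc y (suc m) (suc t)))
                                    (ballot-sum b (suc m + suc t)))))
         (Σ-sizes-last t (λ x _ → β (suc b) (suc m + x))) ⟩
  (S + β b (2 + (m + suc t))) + (β (suc b) m + (S′ + β (suc b) (suc m + t)))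
    ≡⟨ shuffle-sums S _ (β (suc b) m) S′ _ ⟩
  (S + (β (suc b) m + S′)) + (β b (2 + (m + suc t)) + β (suc b) (suc m + t))
    ≡⟨ cong₂ _+_ (σ-step b m t) (cong (λ k → β b (2 + (m + suc t)) + β (suc b) k) (sym (+-suc m t))) ⟩
  σ (suc b) (suc m) (suc t) ∎
  where
  open ≡-Reasoning
  S  = Σ-sizes (suc b) (λ x y → σ x (y + suc m) t)
  S′ = Σ-sizes t (λ x _ → β (suc b) (suc m + x))
  shuffle-sums : ∀ a b c d η → (a + b) + (c + (d + η)) ≡ (a + (c + d)) + (b + η)
  shuffle-sums = ℕ-Solver.solve-∀

-- The multiple of `η t` comes `μ (suc b)` times from the lowest block and once from the top block,
-- together `2 ^ suc b` times.
d₂-step : ∀ b m t →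
  Σ-sizes (suc b) (λ x y → d₂ x (y + suc m) t) +
  (β (suc b) m + Σ-sizes t (λ x _ → β (suc b) (suc m + x) + μ x)) ≡ d₂ (suc b) (suc m) t
d₂-step b m t = begin
  Σ-sizes (suc b) (λ x y → σ x (y + suc m) t + 2 ^ x * η t) +
  (β (suc b) m + Σ-sizes t (λ x _ → β (suc b) (suc m + x) + μ x))
    ≡⟨ cong₂ (λ u v → u + (β (suc b) m + v))
         (trans (Σ-sizes-+ (suc b) (λ x y → σ x (y + suc m) t) (λ x _ → 2 ^ x * η t))
                (cong (S +_) (trans (Σ-sizes-* (suc b) (λ x _ → 2 ^ x) (η t))
                                    (cong (_* η t) (μ-sum (suc b))))))
         (trans (Σ-sizes-+ t (λ x _ → β (suc b) (suc m + x)) (λ x _ → μ x)) (cong (S′ +_) (η-sum t))) ⟩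
  (S + μ (suc b) * η t) + (β (suc b) m + (S′ + η t))
    ≡⟨ regroup S (μ (suc b)) (η t) (β (suc b) m) S′ ⟩
  (S + (β (suc b) m + S′)) + suc (μ (suc b)) * η t
    ≡⟨ cong₂ (λ u v → u + v * η t) (σ-step b m t) (sym (2^≡1+μ (suc b))) ⟩
  d₂ (suc b) (suc m) t ∎
  where
  open ≡-Reasoning
  S  = Σ-sizes (suc b) (λ x y → σ x (y + suc m) t)
  S′ = Σ-sizes t (λ x _ → β (suc b) (suc m + x))
  regroup : ∀ a μ η c d → (a + μ * η) + (c + (d + η)) ≡ (a + (c + d)) + suc μ * η
  regroup = ℕ-Solver.solve-∀

-- Verification of the recursion for each family

open Values value

-- A record, so that the choices of a block can be inferred by unification.
record Choices (F : Family) (pre : List ℕ) (n : ℕ) (post : List ℕ) (X : ℕ) : Set where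
  constructor choices
  field sum-of : Σ-sizes n (λ x y → branch F pre x y post) ≡ X

open Choices

expand₁ : ∀ F s {X} → Choices F [] s [] X → expand F [] (s ∷ []) ≡ X
expand₁ F s c = trans (+-identityʳ _) (sum-of c)

expand₂ : ∀ F s t {X Y} → Choices F [] s (t ∷ []) X → Choices F (s ∷ []) t [] Y →
      expand F [] (s ∷ t ∷ []) ≡ X + Y
expand₂ F s t c d = cong₂ _+_ (sum-of c) (trans (+-identityʳ _) (sum-of d))

expand₃ : ∀ F s t u {X Y Z} → Choices F [] s (t ∷ u ∷ []) X → Choices F (s ∷ []) t (u ∷ []) Y →
        Choices F (s ∷ t ∷ []) u [] Z → expand F [] (s ∷ t ∷ u ∷ []) ≡ X + (Y + Z)
expand₃ F s t u c d f = cong₂ _+_ (sum-of c) (cong₂ _+_ (sum-of d) (trans (+-identityʳ _) (sum-of f)))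

expand₄ : ∀ F s t u v {X Y Z W} → Choices F [] s (t ∷ u ∷ v ∷ []) X → Choices F (s ∷ []) t (u ∷ v ∷ []) Y →
       Choices F (s ∷ t ∷ []) u (v ∷ []) Z → Choices F (s ∷ t ∷ u ∷ []) v [] W →
       expand F [] (s ∷ t ∷ u ∷ v ∷ []) ≡ X + (Y + (Z + W))
expand₄ F s t u v c d f g =
  cong₂ _+_ (sum-of c) (cong₂ _+_ (sum-of d) (cong₂ _+_ (sum-of f) (trans (+-identityʳ _) (sum-of g))))

module _ {F : Family} {pre post : List ℕ} where

  each : ∀ {n} ψ → (∀ x y → branch F pre x y post ≡ ψ x y) → Choices F pre n post (Σ-sizes n ψ)
  each {n} ψ h = choices (Σ-sizes-cong n h)

  private
    blocked : Bool → Bool → Bool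
    blocked x y = is-nothing (next F (length pre) x y)

    blocked-sound : ∀ x y → T (blocked (positive x) (positive y)) → branch F pre x y post ≡ 0
    blocked-sound x y t with next F (length pre) (positive x) (positive y)
    ... | nothing = refl

  none : ∀ {n} {_ : T (all-cases blocked)} → Choices F pre n post 0
  none {n} {t} = choices (Σ-sizes-none n λ x y →
    blocked-sound x y (all-cases-sound blocked t (positive x) (positive y)))

  -- For blocks that are in effect decreasing: every choice with a letter of the block above it is
  -- blocked in the table.
  only-top : ∀ {n X} {_ : T (blocked false true)} {_ : T (blocked true true)} →
        branch F pre n 0 post ≡ X → Choices F pre (suc n) post X
  only-top {n} {_} {t₀} {t₁} e₀ = choices (trans (Σ-sizes-top n (λ x y → branch F pre x y post) λ where
    zero    y → blocked-sound zero (suc y) t₀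
    (suc x) y → blocked-sound (suc x) (suc y) t₁) e₀)

  all-then-top : ∀ {n X} ψ → (∀ x y → branch F pre x (suc y) post ≡ ψ x y) → branch F pre n 0 post ≡ X →
         Choices F pre (suc n) post (Σ-sizes n ψ + X)
  all-then-top {n} ψ h e₀ = choices (trans (Σ-sizes-last n (λ x y → branch F pre x y post))
    (cong₂ _+_ (Σ-sizes-cong n h) e₀))

  powers-last : ∀ {n X} → (∀ x y → branch F pre x (suc y) post ≡ 2 ^ x) → branch F pre n 0 post ≡ X →
                Choices F pre (suc n) post (μ n + X)
  powers-last {n} h e₀ = choices (trans (Σ-sizes-last n (λ x y → branch F pre x y post))
    (cong₂ _+_ (trans (Σ-sizes-cong n h) (μ-sum n)) e₀))

  powers : ∀ {n} → (∀ x y → branch F pre x y post ≡ 2 ^ x) → Choices F pre n post (μ n)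
  powers {n} h = choices (trans (Σ-sizes-cong n h) (μ-sum n))

  ballots : ∀ {b} j → (∀ x y → branch F pre x y post ≡ β x (y + j)) → Choices F pre (suc b) post (β b (suc j))
  ballots {b} j h = choices (trans (Σ-sizes-cong (suc b) h) (ballot-sum b j))

  ballots₀ : ∀ {b} → (∀ x y → branch F pre x y post ≡ β x y) → Choices F pre (suc b) post (β (suc b) 0)
  ballots₀ {b} h = choices (trans (Σ-sizes-cong (suc b) h) (ballot-sum₀ b))

Step-of : Family → List ℕ → Set
Step-of F ss = value F ss ≡ expand F [] ss

step-free : ∀ n → Step-of free (suc n ∷ [])
step-free n = sym (expand₁ free (suc n) (each d₀ λ where
  zero    zero    → refl
  zero    (suc y) → refl
  (suc x) zero    → trans (cong (λ k → β k 0) (+-identityʳ (suc x))) (sym (d₀-zero (suc x)))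
  (suc x) (suc y) → refl))

step-avoid : ∀ n → Step-of avoid (suc n ∷ [])
step-avoid n = sym (expand₁ avoid (suc n) (ballots₀ λ where
  zero    zero    → refl
  zero    (suc y) → refl
  (suc x) zero    → cong (λ k → β k 0) (+-identityʳ (suc x))
  (suc x) (suc y) → refl))

step-line : ∀ n → Step-of line (suc n ∷ [])
step-line n = sym (expand₁ line (suc n) (only-top (case n)))
  where
  case : ∀ n → branch line [] n 0 [] ≡ 1
  case zero    = refl
  case (suc n) = refl

step-ballot : ∀ b j → Step-of ballot (suc b ∷ suc j ∷ [])
step-ballot b j = sym (expand₂ ballot (suc b) (suc j)
  (ballots (suc j) λ { zero y → refl ; (suc x) y → refl })
  (only-top (case j)))
  where
  case : ∀ j → branch ballot (suc b ∷ []) j 0 [] ≡ β (suc b) j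
  case zero    = cong (λ k → β k 0) (+-identityʳ (suc b))
  case (suc j) = cong (β (suc b)) (+-identityʳ (suc j))

step-merge : ∀ m t → Step-of merge (suc m ∷ suc t ∷ [])
step-merge m t = sym (trans (expand₂ merge (suc m) (suc t)
  (only-top (case₀ m))
  (only-top (case₁ t)))
  (cong suc (+-suc (L 0 m (suc t)) (L 0 (suc m) t))))
  where
  case₀ : ∀ m → branch merge [] m 0 (suc t ∷ []) ≡ 1 + L 0 m (suc t)
  case₀ zero    = refl
  case₀ (suc m) = refl
  case₁ : ∀ t → branch merge (suc m ∷ []) t 0 [] ≡ 1 + L 0 (suc m) t
  case₁ zero    = refl
  case₁ (suc t) = cong (λ k → 1 + L 0 (suc m) k) (+-identityʳ (suc t))

step-stack : ∀ m t → Step-of stack (suc m ∷ suc t ∷ [])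
step-stack m t = sym (expand₂ stack (suc m) (suc t)
  (only-top (case m))
  none)
  where
  case : ∀ m → branch stack [] m 0 (suc t ∷ []) ≡ 1
  case zero    = refl
  case (suc m) = refl

step-tail : ∀ b t → Step-of tail (suc b ∷ suc t ∷ [])
step-tail b t = sym (trans (expand₂ tail (suc b) (suc t)
  (ballots₀ λ { zero zero → refl ; zero (suc y) → refl ; (suc x) zero → refl ; (suc x) (suc y) → refl })
  none)
  (+-identityʳ _))

step-final : ∀ b m t → Step-of final (suc b ∷ suc m ∷ suc t ∷ [])
step-final b m t = sym (trans (expand₃ final (suc b) (suc m) (suc t)
  (ballots (suc m) λ { zero y → refl ; (suc x) y → refl })
  (only-top (case m))
  none)
  (cong (β b (2 + m) +_) (+-identityʳ (β (suc b) m))))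
  where
  case : ∀ m → branch final (suc b ∷ []) m 0 (suc t ∷ []) ≡ β (suc b) m
  case zero    = refl
  case (suc m) = refl

step-power : ∀ b x y → Step-of power (suc b ∷ suc x ∷ suc y ∷ [])
step-power b x y = sym (trans (expand₃ power (suc b) (suc x) (suc y)
  (only-top (case b))
  (powers λ { zero y → refl ; (suc x) y → refl })
  none)
  (trans (cong suc (+-identityʳ (μ (suc x)))) (sym (2^≡1+μ (suc x)))))
  where
  case : ∀ b → branch power [] b 0 (suc x ∷ suc y ∷ []) ≡ 1
  case zero    = refl
  case (suc b) = refl

step-linear : ∀ b m t → Step-of linear (suc b ∷ suc m ∷ suc t ∷ [])
step-linear b m t = sym (trans (expand₃ linear (suc b) (suc m) (suc t)
  (only-top (case₀ b))
  (only-top (case₁ m))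
  none)
  (cong suc (+-identityʳ (suc m))))
  where
  case₀ : ∀ b → branch linear [] b 0 (suc m ∷ suc t ∷ []) ≡ 1
  case₀ zero    = refl
  case₀ (suc b) = refl
  case₁ : ∀ m → branch linear (suc b ∷ []) m 0 (suc t ∷ []) ≡ suc m
  case₁ zero    = refl
  case₁ (suc m) = refl

step-asc₀ : ∀ b t → Step-of asc₀ (suc b ∷ suc t ∷ [])
step-asc₀ b t = sym (trans (expand₂ asc₀ (suc b) (suc t)
  (ballots (suc t) λ { zero y → refl ; (suc x) y → refl })
  (powers-last (λ { zero y → refl ; (suc x) y → refl }) (case t)))
  (regroup (β b (2 + t)) (μ t) (β (suc b) t) (η t)))
  where
  case : ∀ t → branch asc₀ (suc b ∷ []) t 0 [] ≡ β (suc b) t + η t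
  case zero    = trans (cong (λ k → β k 0) (+-identityʳ (suc b))) (sym (+-identityʳ _))
  case (suc t) = cong (λ k → β (suc b) k + η k) (+-identityʳ (suc t))
  regroup : ∀ a μ b η → a + (μ + (b + η)) ≡ (a + b) + (η + μ)
  regroup = ℕ-Solver.solve-∀

step-asc₁ : ∀ b m t → Step-of asc₁ (suc b ∷ suc m ∷ suc t ∷ [])
step-asc₁ b m t = sym (trans (expand₃ asc₁ (suc b) (suc m) (suc t)
  (ballots (suc m + suc t) λ { zero y → refl ; (suc x) y → refl })
  (only-top (case₁ m))
  (powers-last (λ { zero y → refl ; (suc x) y → refl }) (case₂ t)))
  (trans (regroup (β b (2 + (m + suc t))) m (μ t) (β (suc b) (suc m + t)) t (η t))
    (cong (λ k → β b (2 + (m + suc t)) + β (suc b) k + (suc m * suc t + (η t + μ t))) (sym (+-suc m t)))))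
  where
  case₁ : ∀ m → branch asc₁ (suc b ∷ []) m 0 (suc t ∷ []) ≡ suc m
  case₁ zero    = refl
  case₁ (suc m) = refl
  case₂ : ∀ t → branch asc₁ (suc b ∷ suc m ∷ []) t 0 [] ≡ β (suc b) (suc m + t) + (suc m * t + η t)
  case₂ zero    = trans (sym (+-identityʳ _))
    (cong (β (suc b) (suc m + 0) +_) (sym (trans (+-identityʳ (m * 0)) (*-zeroʳ m))))
  case₂ (suc t) = cong (λ k → β (suc b) (suc m + k) + (suc m * k + η k)) (+-identityʳ (suc t))
  regroup : ∀ a m μ b t η → a + (suc m + (μ + (b + (suc m * t + η)))) ≡ (a + b) + (suc m * suc t + (η + μ))
  regroup = ℕ-Solver.solve-∀

step-asc₂ : ∀ b m n t → Step-of asc₂ (suc b ∷ suc m ∷ suc n ∷ suc t ∷ [])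
step-asc₂ b m n t = sym (trans (expand₄ asc₂ (suc b) (suc m) (suc n) (suc t)
  (ballots (suc m + (suc n + suc t)) λ { zero y → refl ; (suc x) y → refl })
  none
  (only-top (case₂ n))
  (powers-last (λ { zero y → refl ; (suc x) y → refl }) (case₃ t)))
  (trans (regroup (β b (2 + (m + (suc n + suc t)))) (μ t) (β (suc b) (suc m + (suc n + t))) t (η t))
    (cong (λ k → β b (2 + (m + (suc n + suc t))) + β (suc b) k + (suc t + (η t + μ t)))
      (trans (sym (+-suc m (suc n + t))) (cong (m +_) (sym (+-suc (suc n) t)))))))
  where
  case₂ : ∀ n → branch asc₂ (suc b ∷ suc m ∷ []) n 0 (suc t ∷ []) ≡ 1
  case₂ zero    = refl
  case₂ (suc n) = refl
  case₃ : ∀ t → branch asc₂ (suc b ∷ suc m ∷ suc n ∷ []) t 0 [] ≡ β (suc b) (suc m + (suc n + t)) + (t + η t)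
  case₃ zero    = sym (+-identityʳ _)
  case₃ (suc t) = cong (λ k → β (suc b) (suc m + (suc n + k)) + (k + η k)) (+-identityʳ (suc t))
  regroup : ∀ a μ b t η → a + (0 + (1 + (μ + (b + (t + η))))) ≡ (a + b) + (suc t + (η + μ))
  regroup = ℕ-Solver.solve-∀

step-cap₁ : ∀ b m x y → Step-of cap₁ (suc b ∷ suc m ∷ suc x ∷ suc y ∷ [])
step-cap₁ b m x y = sym (trans (expand₄ cap₁ (suc b) (suc m) (suc x) (suc y)
  (ballots (suc m + suc x) λ { zero y → refl ; (suc x) y → refl })
  (only-top (case₁ m))
  (powers-last (λ { zero y → refl ; (suc x) y → refl }) (case₂ x))
  none)
  (trans (regroup (β b (2 + (m + suc x))) (μ x) (β (suc b) (suc m + x)))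
    (cong₂ (λ k q → β b (2 + (m + suc x)) + β (suc b) k + (μ x + q)) (sym (+-suc m x)) (sym (2^≡1+μ x)))))
  where
  case₁ : ∀ m → branch cap₁ (suc b ∷ []) m 0 (suc x ∷ suc y ∷ []) ≡ 1
  case₁ zero    = refl
  case₁ (suc m) = refl
  case₂ : ∀ x → branch cap₁ (suc b ∷ suc m ∷ []) x 0 (suc y ∷ []) ≡ β (suc b) (suc m + x) + μ x
  case₂ zero    = trans (cong (β (suc b)) (sym (+-identityʳ (suc m)))) (sym (+-identityʳ _))
  case₂ (suc x) = refl
  regroup : ∀ a μ b → a + (1 + ((μ + (b + μ)) + 0)) ≡ (a + b) + (μ + suc μ)
  regroup = ℕ-Solver.solve-∀

step-shuffle : ∀ b m t → Step-of shuffle (suc b ∷ suc m ∷ suc t ∷ [])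
step-shuffle b m t = sym (trans (expand₃ shuffle (suc b) (suc m) (suc t)
  (all-then-top (λ x y → β x (suc y + suc m)) (λ { zero y → refl ; (suc x) y → refl }) (case₀ b))
  (only-top (case₁ m))
  none)
  (trans (regroup (Σ-sizes b (λ x y → β x (suc y + suc m))) (β b (suc m))
            (L b (suc m) (suc t)) (β (suc b) m) (L (suc b) m (suc t)))
    (cong (λ k → k + β (suc b) m + (L b (suc m) (suc t) + L (suc b) m (suc t))) (ballot-last b (suc m)))))
  where
  case₀ : ∀ b → branch shuffle [] b 0 (suc m ∷ suc t ∷ []) ≡ β b (suc m) + L b (suc m) (suc t)
  case₀ zero    = refl
  case₀ (suc b) = refl
  case₁ : ∀ m → branch shuffle (suc b ∷ []) m 0 (suc t ∷ []) ≡ β (suc b) m + L (suc b) m (suc t)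
  case₁ zero    = sym (+-identityʳ _)
  case₁ (suc m) = refl
  regroup : ∀ a b c d η → (a + (b + c)) + ((d + η) + 0) ≡ ((a + b) + d) + (c + η)
  regroup = ℕ-Solver.solve-∀

step-cap₀ : ∀ b m t → Step-of cap₀ (suc b ∷ suc m ∷ suc t ∷ [])
step-cap₀ b m t = sym (trans (expand₃ cap₀ (suc b) (suc m) (suc t)
  (all-then-top (λ x y → β x (suc y + suc m)) (λ { zero y → refl ; (suc x) y → refl }) (case₀ b))
  (powers-last (λ { zero y → refl ; (suc x) y → refl }) (case₁ m))
  none)
  (trans (regroup (Σ-sizes b (λ x y → β x (suc y + suc m))) (β b (suc m))
            (L b (suc m) (suc t)) (μ m) (β (suc b) m) (L (suc b) m (suc t)) (η m))
    (cong (λ k → k + β (suc b) m + (L b (suc m) (suc t) + L (suc b) m (suc t)) + (η m + μ m))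
      (ballot-last b (suc m)))))
  where
  case₀ : ∀ b → branch cap₀ [] b 0 (suc m ∷ suc t ∷ []) ≡ β b (suc m) + L b (suc m) (suc t)
  case₀ zero    = refl
  case₀ (suc b) = refl
  case₁ : ∀ m → branch cap₀ (suc b ∷ []) m 0 (suc t ∷ []) ≡ β (suc b) m + L (suc b) m (suc t) + η m
  case₁ zero    = sym (trans (+-identityʳ _) (+-identityʳ _))
  case₁ (suc m) = refl
  regroup : ∀ a b c μ d η f → (a + (b + c)) + ((μ + ((d + η) + f)) + 0) ≡ ((a + b) + d) + (c + η) + (f + μ)
  regroup = ℕ-Solver.solve-∀

step-base₁ : ∀ m t → Step-of base₁ (suc m ∷ suc t ∷ [])
step-base₁ m t = sym (trans (expand₂ base₁ (suc m) (suc t)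
  (only-top (case₀ m))
  (powers-last (λ { zero y → refl ; (suc x) y → refl }) (case₁ t)))
  (regroup (L 0 m (suc t)) (μ t) (L 0 (suc m) t) (η t)))
  where
  case₀ : ∀ m → branch base₁ [] m 0 (suc t ∷ []) ≡ 1 + L 0 m (suc t)
  case₀ zero    = refl
  case₀ (suc m) = refl
  case₁ : ∀ t → branch base₁ (suc m ∷ []) t 0 [] ≡ 1 + L 0 (suc m) t + η t
  case₁ zero    = refl
  case₁ (suc t) = cong (λ k → 1 + L 0 (suc m) k + η k) (+-identityʳ (suc t))
  regroup : ∀ a μ b η → (1 + a) + (μ + (1 + b + η)) ≡ 1 + suc (a + b) + (η + μ)
  regroup = ℕ-Solver.solve-∀

step-base₂ : ∀ m n t → Step-of base₂ (suc m ∷ suc n ∷ suc t ∷ [])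
step-base₂ m n t = sym (trans (expand₃ base₂ (suc m) (suc n) (suc t)
  none
  (only-top (case₁ n))
  (powers-last (λ { zero y → refl ; (suc x) y → refl }) (case₂ t)))
  (sym (2^≡1+μ (suc t))))
  where
  case₁ : ∀ n → branch base₂ (suc m ∷ []) n 0 (suc t ∷ []) ≡ 1
  case₁ zero    = refl
  case₁ (suc n) = refl
  case₂ : ∀ t → branch base₂ (suc m ∷ suc n ∷ []) t 0 [] ≡ 2 ^ t
  case₂ zero    = refl
  case₂ (suc t) = cong (2 ^_) (+-identityʳ (suc t))

step-desc₀ : ∀ b t → Step-of desc₀ (suc b ∷ suc t ∷ [])
step-desc₀ b t = sym (expand₂ desc₀ (suc b) (suc t)
  (all-then-top (λ x y → d₁ x (suc y) (suc t)) (λ { zero y → refl ; (suc x) y → refl }) (case₀ b))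
  (each (h₀ (suc b)) λ where
    zero    zero    → trans (cong (λ k → β k 0) (+-identityʳ (suc b))) (sym (+-identityʳ _))
    zero    (suc y) → sym (trans (+-identityʳ _) (+-identityʳ _))
    (suc x) zero    → cong (λ k → β (suc b) k + η k) (+-identityʳ (suc x))
    (suc x) (suc y) → refl))
  where
  case₀ : ∀ b → branch desc₀ [] b 0 (suc t ∷ []) ≡ d₀ b (suc t)
  case₀ zero    = refl
  case₀ (suc b) = refl

step-desc₁ : ∀ b m t → Step-of desc₁ (suc b ∷ suc m ∷ suc t ∷ [])
step-desc₁ b m t = sym (expand₃ desc₁ (suc b) (suc m) (suc t)
  (all-then-top (λ x y → d₂ x (suc y + suc m) (suc t))
    (λ { zero y → sym (d₂-zero (suc y + suc m) (suc t)) ; (suc x) y → refl }) (case₀ b))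
  (only-top (case₁ m))
  (each (h₁ (suc b) (suc m)) λ where
    zero    zero    → sym (trans
      (cong (β (suc b) (suc m + 0) +_) (trans (+-identityʳ _) (*-zeroʳ m))) (+-identityʳ _))
    zero    (suc y) → trans (cong (β (suc b)) (sym (+-identityʳ (suc m)))) (sym (+-identityʳ _))
    (suc x) zero    → cong (λ k → β (suc b) (suc m + k) + (suc m * k + η k)) (+-identityʳ (suc x))
    (suc x) (suc y) → refl))
  where
  case₀ : ∀ b → branch desc₁ [] b 0 (suc m ∷ suc t ∷ []) ≡ d₁ b (suc m) (suc t)
  case₀ zero    = refl
  case₀ (suc b) = refl
  case₁ : ∀ m → branch desc₁ (suc b ∷ []) m 0 (suc t ∷ []) ≡ β (suc b) m + L (suc b) m (suc t)
  case₁ zero    = sym (+-identityʳ _)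
  case₁ (suc m) = refl

step-desc₂ : ∀ b m n t → Step-of desc₂ (suc b ∷ suc m ∷ suc n ∷ suc t ∷ [])
step-desc₂ b m n t = sym (trans (expand₄ desc₂ (suc b) (suc m) (suc n) (suc t)
  (each (λ x y → d₂ x (y + (suc m + suc n)) (suc t)) λ where
    zero    zero    → sym (d₂-zero (suc m + suc n) (suc t))
    zero    (suc y) → sym (d₂-zero (suc y + (suc m + suc n)) (suc t))
    (suc x) zero    → refl
    (suc x) (suc y) → refl)
  none
  (only-top {X = β (suc b) (m + suc n)} (case₂ n))
  (each (λ x _ → β (suc b) (suc m + suc n + x) + μ x) λ where
    zero    zero    → trans (cong (β (suc b)) (sym (+-assoc (suc m) (suc n) 0))) (sym (+-identityʳ _))
    zero    (suc y) → trans (cong (β (suc b)) (sym (+-identityʳ (suc m + suc n)))) (sym (+-identityʳ _))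
    (suc x) zero    → cong₂ _+_
      (cong (β (suc b)) (trans (cong (λ k → suc m + (suc n + k)) (+-identityʳ (suc x)))
                               (sym (+-assoc (suc m) (suc n) (suc x)))))
      (trans (cong (λ k → k + η k) (+-identityʳ (suc x))) (sym (μ≡t+η (suc x))))
    (suc x) (suc y) → refl))
  (d₂-step b (m + suc n) (suc t)))
  where
  case₂ : ∀ n → branch desc₂ (suc b ∷ suc m ∷ []) n 0 (suc t ∷ []) ≡ β (suc b) (m + suc n)
  case₂ zero    = cong (β (suc b)) (+-comm 1 m)
  case₂ (suc n) = cong (β (suc b)) (sym (+-suc m (suc n)))

value-step : ∀ F ss → length ss ≡ width F → All (0 <_) ss → Step-of F ss
value-step free    (suc b ∷ []) refl (s≤s _ ∷ []) = step-free b
value-step avoid   (suc b ∷ []) refl (s≤s _ ∷ []) = step-avoid b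
value-step line    (suc b ∷ []) refl (s≤s _ ∷ []) = step-line b
value-step ballot  (suc b ∷ suc m ∷ []) refl (s≤s _ ∷ s≤s _ ∷ []) = step-ballot b m
value-step merge   (suc b ∷ suc m ∷ []) refl (s≤s _ ∷ s≤s _ ∷ []) = step-merge b m
value-step stack   (suc b ∷ suc m ∷ []) refl (s≤s _ ∷ s≤s _ ∷ []) = step-stack b m
value-step tail    (suc b ∷ suc m ∷ []) refl (s≤s _ ∷ s≤s _ ∷ []) = step-tail b m
value-step final   (suc b ∷ suc m ∷ suc n ∷ []) refl (s≤s _ ∷ s≤s _ ∷ s≤s _ ∷ []) = step-final b m n
value-step power   (suc b ∷ suc m ∷ suc n ∷ []) refl (s≤s _ ∷ s≤s _ ∷ s≤s _ ∷ []) = step-power b m n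
value-step linear  (suc b ∷ suc m ∷ suc n ∷ []) refl (s≤s _ ∷ s≤s _ ∷ s≤s _ ∷ []) = step-linear b m n
value-step asc₀    (suc b ∷ suc m ∷ []) refl (s≤s _ ∷ s≤s _ ∷ []) = step-asc₀ b m
value-step asc₁    (suc b ∷ suc m ∷ suc n ∷ []) refl (s≤s _ ∷ s≤s _ ∷ s≤s _ ∷ []) = step-asc₁ b m n
value-step asc₂    (suc b ∷ suc m ∷ suc n ∷ suc t ∷ []) refl (s≤s _ ∷ s≤s _ ∷ s≤s _ ∷ s≤s _ ∷ []) = step-asc₂ b m n t
value-step shuffle (suc b ∷ suc m ∷ suc n ∷ []) refl (s≤s _ ∷ s≤s _ ∷ s≤s _ ∷ []) = step-shuffle b m n
value-step cap₀    (suc b ∷ suc m ∷ suc n ∷ []) refl (s≤s _ ∷ s≤s _ ∷ s≤s _ ∷ []) = step-cap₀ b m n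
value-step cap₁    (suc b ∷ suc m ∷ suc n ∷ suc t ∷ []) refl (s≤s _ ∷ s≤s _ ∷ s≤s _ ∷ s≤s _ ∷ []) = step-cap₁ b m n t
value-step base₁   (suc b ∷ suc m ∷ []) refl (s≤s _ ∷ s≤s _ ∷ []) = step-base₁ b m
value-step base₂   (suc b ∷ suc m ∷ suc n ∷ []) refl (s≤s _ ∷ s≤s _ ∷ s≤s _ ∷ []) = step-base₂ b m n
value-step desc₀   (suc b ∷ suc m ∷ []) refl (s≤s _ ∷ s≤s _ ∷ []) = step-desc₀ b m
value-step desc₁   (suc b ∷ suc m ∷ suc n ∷ []) refl (s≤s _ ∷ s≤s _ ∷ s≤s _ ∷ []) = step-desc₁ b m n
value-step desc₂   (suc b ∷ suc m ∷ suc n ∷ suc t ∷ []) refl (s≤s _ ∷ s≤s _ ∷ s≤s _ ∷ s≤s _ ∷ []) = step-desc₂ b m n t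

-- Summing over the first letter

σ-zero : ∀ m t → σ 0 m t ≡ suc t
σ-zero m zero    = refl
σ-zero m (suc t) = trans (cong (_+ 1) (σ-zero m t)) (+-comm (suc t) 1)

Σ-sizes-reverse : ∀ n (f : ℕ → ℕ) → Σ-sizes n (λ x _ → f x) ≡ Σ-sizes n (λ _ y → f y)
Σ-sizes-reverse zero    f = refl
Σ-sizes-reverse (suc n) f = trans (Σ-sizes-last n (λ x _ → f x))
  (trans (cong (_+ f n) (Σ-sizes-reverse n f)) (+-comm _ (f n)))

Σ-sizes-const : ∀ n κ → Σ-sizes n (λ _ _ → κ) ≡ n * κ
Σ-sizes-const zero    κ = refl
Σ-sizes-const (suc n) κ = cong (κ +_) (Σ-sizes-const n κ)

-- The counterpart of `σ-step` without a middle block, as it occurs for `desc₀`.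
σ-step₀ : ∀ b t → Σ-sizes (suc b) (λ x y → σ x y t) + Σ-sizes t (λ x _ → β (suc b) x) ≡ σ (suc b) 0 t
σ-step₀ b zero    = trans (+-identityʳ _) (ballot-sum₀ b)
σ-step₀ b (suc t) = begin
  Σ-sizes (suc b) (λ x y → σ x y t + β x (y + suc t)) + Σ-sizes (suc t) (λ x _ → β (suc b) x)
    ≡⟨ cong₂ _+_
         (trans (Σ-sizes-+ (suc b) (λ x y → σ x y t) (λ x y → β x (y + suc t)))
           (cong (S +_) (ballot-sum b (suc t))))
         (Σ-sizes-last t (λ x _ → β (suc b) x)) ⟩
  (S + β b (2 + t)) + (S′ + β (suc b) t)
    ≡⟨ exchange S (β b (2 + t)) S′ (β (suc b) t) ⟩
  (S + S′) + β (suc b) (suc t)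
    ≡⟨ cong (_+ β (suc b) (suc t)) (σ-step₀ b t) ⟩
  σ (suc b) 0 (suc t) ∎
  where
  open ≡-Reasoning
  S  = Σ-sizes (suc b) (λ x y → σ x y t)
  S′ = Σ-sizes t (λ x _ → β (suc b) x)
  exchange : ∀ a b c d → (a + b) + (c + d) ≡ (a + c) + (b + d)
  exchange = ℕ-Solver.solve-∀

-- The parts of d₁ and d₀ free of ballot numbers; the subtracted terms are moved to the other side.
υ : ℕ → ℕ → ℕ
υ m zero    = 0
υ m (suc t) = (η t + η t) + suc m * t

κ : ℕ → ℕ → ℕ → ℕ
κ zero    m t = L 0 (suc m) t + η t
κ (suc b) m t = κ b m t + (μ b * η t + (L (suc b) m t + υ m t))

h₁-sum : ∀ b m t → Σ-sizes t (h₁ (suc b) (suc m)) ≡ Σ-sizes t (λ x _ → β (suc b) (suc m + x)) + υ m t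
h₁-sum b m zero    = refl
h₁-sum b m (suc t) = begin
  Σ-sizes (suc t) (h₁ (suc b) (suc m))
    ≡⟨ Σ-sizes-last t (h₁ (suc b) (suc m)) ⟩
  Σ-sizes t (λ x _ → β (suc b) (suc m + x) + μ x) + (β (suc b) (suc m + t) + (suc m * t + η t))
    ≡⟨ cong (_+ (β (suc b) (suc m + t) + (suc m * t + η t)))
         (trans (Σ-sizes-+ t (λ x _ → β (suc b) (suc m + x)) (λ x _ → μ x)) (cong (S +_) (η-sum t))) ⟩
  (S + η t) + (β (suc b) (suc m + t) + (suc m * t + η t))
    ≡⟨ regroup S (η t) (β (suc b) (suc m + t)) (suc m * t) ⟩
  (S + β (suc b) (suc m + t)) + ((η t + η t) + suc m * t)
    ≡⟨ cong (_+ υ m (suc t)) (Σ-sizes-last t (λ x _ → β (suc b) (suc m + x))) ⟨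
  Σ-sizes (suc t) (λ x _ → β (suc b) (suc m + x)) + υ m (suc t) ∎
  where
  open ≡-Reasoning
  S = Σ-sizes t (λ x _ → β (suc b) (suc m + x))
  regroup : ∀ a η b c → (a + η) + (b + (c + η)) ≡ (a + b) + ((η + η) + c)
  regroup = ℕ-Solver.solve-∀

-- The t on the left is the excess of `σ 0 (suc m) t`, a sum of t + 1 ones, over the single 1 in
-- `d₁ 0`. The recursion in b hands it on unchanged.
d₁-split : ∀ b m t → d₁ b (suc m) t + t ≡ σ b (suc m) t + κ b m t
d₁-split zero    m t = trans (regroup (L 0 (suc m) t) (η t) t) (cong (_+ κ 0 m t) (sym (σ-zero (suc m) t)))
  where
  regroup : ∀ l η t → 1 + l + η + t ≡ suc t + (l + η)
  regroup = ℕ-Solver.solve-∀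
d₁-split (suc b) m t = begin
  (Σ-sizes b (λ x y → d₂ x (suc y + suc m) t) + d₁ b (suc m) t) +
  ((β (suc b) m + L (suc b) m t) + Σ-sizes t (h₁ (suc b) (suc m))) + t
    ≡⟨ cong₂ (λ a c → (a + d₁ b (suc m) t) + ((β (suc b) m + L (suc b) m t) + c) + t)
         (trans (Σ-sizes-+ b (λ x y → σ x (suc y + suc m) t) (λ x _ → 2 ^ x * η t))
                (cong (A +_) (trans (Σ-sizes-* b (λ x _ → 2 ^ x) (η t)) (cong (_* η t) (μ-sum b)))))
         (h₁-sum b m t) ⟩
  ((A + μ b * η t) + d₁ b (suc m) t) + ((β (suc b) m + L (suc b) m t) + (S + υ m t)) + t
    ≡⟨ regroup₁ A (μ b * η t) (d₁ b (suc m) t) (β (suc b) m) (L (suc b) m t) S (υ m t) t ⟩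
  (d₁ b (suc m) t + t) + (A + (β (suc b) m + S) + (μ b * η t + (L (suc b) m t + υ m t)))
    ≡⟨ cong (_+ (A + (β (suc b) m + S) + (μ b * η t + (L (suc b) m t + υ m t)))) (d₁-split b m t) ⟩
  (σ b (suc m) t + κ b m t) + (A + (β (suc b) m + S) + (μ b * η t + (L (suc b) m t + υ m t)))
    ≡⟨ regroup₂ (σ b (suc m) t) (κ b m t) A (β (suc b) m + S) _ ⟩
  ((A + σ b (suc m) t) + (β (suc b) m + S)) + κ (suc b) m t
    ≡⟨ cong (_+ κ (suc b) m t)
         (trans (cong (_+ (β (suc b) m + S)) (sym (Σ-sizes-last b (λ x y → σ x (y + suc m) t))))
           (σ-step b m t)) ⟩
  σ (suc b) (suc m) t + κ (suc b) m t ∎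
  where
  open ≡-Reasoning
  A = Σ-sizes b (λ x y → σ x (suc y + suc m) t)
  S = Σ-sizes t (λ x _ → β (suc b) (suc m + x))
  regroup₁ : ∀ a q d c l s υ t →
             ((a + q) + d) + ((c + l) + (s + υ)) + t ≡ (d + t) + (a + (c + s) + (q + (l + υ)))
  regroup₁ = ℕ-Solver.solve-∀
  regroup₂ : ∀ s κ a c r → (s + κ) + (a + c + r) ≡ ((a + s) + c) + (κ + r)
  regroup₂ = ℕ-Solver.solve-∀

-- Sums over x + y = n: once the first letter is removed, n letters are distributed below and above
-- it.
Total : (ℕ → ℕ → ℕ) → ℕ → ℕ
Total f n = Σ-sizes (suc n) f

ε₁ ε₂ : ℕ → ℕ
ε₁ = Total (λ _ → η)
ε₂ = Total (λ _ → ε₁)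

W : ℕ → ℕ → ℕ
W b = Total (L b)

ω : ℕ → ℕ → ℕ
ω b zero    = 0
ω b (suc t) = ε₁ t + W (suc b) t

h₀-sum : ∀ b t → Σ-sizes t (h₀ (suc b)) ≡ Σ-sizes t (λ x _ → β (suc b) x) + ω b t
h₀-sum b zero    = refl
h₀-sum b (suc t) = begin
  Σ-sizes (suc t) (h₀ (suc b))
    ≡⟨ Σ-sizes-last t (h₀ (suc b)) ⟩
  Σ-sizes t (λ x y → β (suc b) x + L (suc b) x (suc y) + η x) + (β (suc b) t + η t)
    ≡⟨ cong (_+ (β (suc b) t + η t))
         (trans (Σ-sizes-+ t (λ x y → β (suc b) x + L (suc b) x (suc y)) (λ x _ → η x))
                (cong (_+ Σ-sizes t (λ x _ → η x))
                  (Σ-sizes-+ t (λ x _ → β (suc b) x) (λ x y → L (suc b) x (suc y))))) ⟩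
  ((Σ-sizes t (λ x _ → β (suc b) x) + Σ-sizes t (λ x y → L (suc b) x (suc y))) + Σ-sizes t (λ x _ → η x)) +
  (β (suc b) t + η t)
    ≡⟨ regroup (Σ-sizes t (λ x _ → β (suc b) x)) (Σ-sizes t (λ x y → L (suc b) x (suc y)))
         (Σ-sizes t (λ x _ → η x)) (β (suc b) t) (η t) ⟩
  (Σ-sizes t (λ x _ → β (suc b) x) + β (suc b) t) +
  ((Σ-sizes t (λ x _ → η x) + η t) + (Σ-sizes t (λ x y → L (suc b) x (suc y)) + 0))
    ≡⟨ cong₂ _+_ (sym (Σ-sizes-last t (λ x _ → β (suc b) x)))
         (cong₂ _+_ (trans (sym (Σ-sizes-last t (λ x _ → η x))) (Σ-sizes-reverse (suc t) η))
           (trans (cong (Σ-sizes t (λ x y → L (suc b) x (suc y)) +_) (sym (L-zero (suc b) t)))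
             (sym (Σ-sizes-last t (L (suc b)))))) ⟩
  Σ-sizes (suc t) (λ x _ → β (suc b) x) + (ε₁ t + W (suc b) t) ∎
  where
  open ≡-Reasoning
  regroup : ∀ a l s b η → ((a + l) + s) + (b + η) ≡ (a + b) + ((s + η) + (l + 0))
  regroup = ℕ-Solver.solve-∀

-- Collects the subtracted terms: the t + 1 of `σ 0 0 t`, and the t of `d₁-split` for each use of
-- `d₁` in the recursion.
ν : ℕ → ℕ → ℕ
ν zero    t = suc t
ν (suc b) t = ν b t + b * t

ε : ℕ → ℕ → ℕ
ε zero    t = 0
ε (suc b) t = ε b t + (Σ-sizes b (λ x y → κ x y t) + ω b t)

-- The starting value `β t 0` at b = 0 is carried along by the recursion; summed over the first
-- letter it gives the second run of Catalan numbers.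
d₀-split : ∀ b t → d₀ b t + ν b t ≡ (σ b 0 t + β t 0) + ε b t
d₀-split zero    t = trans (+-comm (β t 0) (suc t))
  (trans (cong (_+ β t 0) (sym (σ-zero 0 t))) (sym (+-identityʳ _)))
d₀-split (suc b) t = begin
  ((B + d₀ b t) + Σ-sizes t (h₀ (suc b))) + (ν b t + b * t)
    ≡⟨ cong (λ c → ((B + d₀ b t) + c) + (ν b t + b * t)) (h₀-sum b t) ⟩
  ((B + d₀ b t) + (S + ω b t)) + (ν b t + b * t)
    ≡⟨ regroup₁ B (d₀ b t) S (ω b t) (ν b t) (b * t) ⟩
  (B + b * t) + (d₀ b t + ν b t) + (S + ω b t)
    ≡⟨ cong₂ (λ a c → a + c + (S + ω b t)) inner (d₀-split b t) ⟩
  (A + K) + ((σ b 0 t + β t 0) + ε b t) + (S + ω b t)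
    ≡⟨ regroup₂ A K (σ b 0 t) (β t 0) (ε b t) S (ω b t) ⟩
  (((A + σ b 0 t) + S) + β t 0) + ε (suc b) t
    ≡⟨ cong (λ c → (c + β t 0) + ε (suc b) t)
         (trans (cong (_+ S) (sym (Σ-sizes-last b (λ x y → σ x y t)))) (σ-step₀ b t)) ⟩
  (σ (suc b) 0 t + β t 0) + ε (suc b) t ∎
  where
  open ≡-Reasoning
  A = Σ-sizes b (λ x y → σ x (suc y) t)
  B = Σ-sizes b (λ x y → d₁ x (suc y) t)
  K = Σ-sizes b (λ x y → κ x y t)
  S = Σ-sizes t (λ x _ → β (suc b) x)
  inner : B + b * t ≡ A + K
  inner = begin
    B + b * t                                          ≡⟨ cong (B +_) (Σ-sizes-const b t) ⟨
    B + Σ-sizes b (λ _ _ → t)                          ≡⟨ Σ-sizes-+ b (λ x y → d₁ x (suc y) t) (λ _ _ → t) ⟨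
    Σ-sizes b (λ x y → d₁ x (suc y) t + t)             ≡⟨ Σ-sizes-cong b (λ x y → d₁-split x y t) ⟩
    Σ-sizes b (λ x y → σ x (suc y) t + κ x y t)
      ≡⟨ Σ-sizes-+ b (λ x y → σ x (suc y) t) (λ x y → κ x y t) ⟩
    A + K ∎
  regroup₁ : ∀ b d s ω n m → ((b + d) + (s + ω)) + (n + m) ≡ (b + m) + (d + n) + (s + ω)
  regroup₁ = ℕ-Solver.solve-∀
  regroup₂ : ∀ a κ s c η z ω → (a + κ) + ((s + c) + η) + (z + ω) ≡ (((a + s) + z) + c) + (η + (κ + ω))
  regroup₂ = ℕ-Solver.solve-∀

-- Both sides run over all triples of numbers with sum n.
Total-assoc : ∀ (f : ℕ → ℕ → ℕ → ℕ) n →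
  Total (λ b t → Total (λ x y → f x y t) b) n ≡ Total (λ x → Total (f x)) n
Total-assoc f zero    = refl
Total-assoc f (suc n) = begin
  (f 0 0 (suc n) + 0) + Total (λ b t → f 0 (suc b) t + Total (λ x y → f (suc x) y t) b) n
    ≡⟨ cong₂ _+_ (+-identityʳ (f 0 0 (suc n)))
         (trans (Σ-sizes-+ (suc n) (λ b t → f 0 (suc b) t) (λ b t → Total (λ x y → f (suc x) y t) b))
                (cong (Total (λ b t → f 0 (suc b) t) n +_) (Total-assoc (λ x → f (suc x)) n))) ⟩
  f 0 0 (suc n) + (Total (λ b t → f 0 (suc b) t) n + Total (λ x → Total (f (suc x))) n)
    ≡⟨ +-assoc (f 0 0 (suc n)) _ _ ⟨
  Total (λ x → Total (f x)) (suc n) ∎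
  where open ≡-Reasoning

Σσ Σβ ΣW Σμε Σt Σmt Σbt Συ ΣΣυ Σκ Σε Σν : ℕ → ℕ
Σσ = Total (λ b t → σ b 0 t)
Σβ = Total (λ _ t → β t 0)
ΣW  = Total (λ b → W (suc b))
Σμε  = Total (λ x r → μ x * ε₁ r)
Σt = Total (λ _ t → t)
Σmt  = Total (λ m t → suc m * t)
Σbt = Total (λ b t → b * t)
Συ  = Total υ
ΣΣυ = Total (λ _ → Συ)
Σκ  = Total (λ x → Total (κ x))
Σε  = Total ε
Σν  = Total ν

Σκω : ℕ → ℕ
Σκω n = Total (λ b t → Σ-sizes b (λ x y → κ x y t)) n + Total ω n

total-split : ∀ n → Total d₀ n + Σν n ≡ (Σσ n + Σβ n) + Σε n
total-split n = trans (sym (Σ-sizes-+ (suc n) d₀ ν))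
  (trans (Σ-sizes-cong (suc n) d₀-split)
    (trans (Σ-sizes-+ (suc n) (λ b t → σ b 0 t + β t 0) ε)
      (cong (_+ Σε n) (Σ-sizes-+ (suc n) (λ b t → σ b 0 t) (λ _ t → β t 0)))))

-- Passing to n + 1 lengthens each inner sum by one ballot number, and the added ones fill an
-- antidiagonal of `β`, whose sum is a Catalan number.
Σσ-suc : ∀ n → Σσ (suc n) ≡ Σσ n + β (2 + n) 0
Σσ-suc n = begin
  Σσ (suc n)
    ≡⟨ Σ-sizes-last (suc n) (λ b t → σ b 0 t) ⟩
  Σ-sizes (suc n) (λ b t → σ b 0 t + β b (suc t)) + β (suc n) 0
    ≡⟨ cong (_+ β (suc n) 0) (Σ-sizes-+ (suc n) (λ b t → σ b 0 t) (λ b t → β b (suc t))) ⟩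
  (Σσ n + Σ-sizes (suc n) (λ b t → β b (suc t))) + β (suc n) 0
    ≡⟨ +-assoc (Σσ n) _ _ ⟩
  Σσ n + (Σ-sizes (suc n) (λ b t → β b (suc t)) + β (suc n) 0)
    ≡⟨ cong (Σσ n +_) (trans (sym (Σ-sizes-last (suc n) β)) (ballot-sum₀ (suc n))) ⟩
  Σσ n + β (2 + n) 0 ∎
  where open ≡-Reasoning

L-empty : ∀ b t → L b 0 t ≡ 0
L-empty zero    t = refl
L-empty (suc b) t = refl

W-zero : ∀ b → W b 0 ≡ 0
W-zero b = trans (+-identityʳ _) (L-zero b 0)

W-suc : ∀ b r → W (suc b) (suc r) ≡ W b (suc r) + W (suc b) r
W-suc b r = begin
  Total (λ m t → L b (suc m) t + L (suc b) m t) r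
    ≡⟨ Σ-sizes-+ (suc r) (λ m → L b (suc m)) (L (suc b)) ⟩
  Total (λ m → L b (suc m)) r + W (suc b) r
    ≡⟨ cong (λ z → z + Total (λ m → L b (suc m)) r + W (suc b) r) (L-empty b (suc r)) ⟨
  W b (suc r) + W (suc b) r ∎
  where open ≡-Reasoning

-- A row of r + 1 binomial coefficients, each diminished by 1.
W₀ : ∀ r → W 0 r ≡ η r
W₀ zero          = refl
W₀ (suc zero)    = refl
W₀ (suc (suc r)) = begin
  Σ-sizes (suc (suc r)) (λ m → L 0 (suc m))
    ≡⟨ trans (Σ-sizes-last (suc r) (λ m → L 0 (suc m))) (+-identityʳ _) ⟩
  Σ-sizes (suc r) (λ m t → suc (L 0 m (suc t) + L 0 (suc m) t))
    ≡⟨ Σ-sizes-+ (suc r) (λ _ _ → 1) (λ m t → L 0 m (suc t) + L 0 (suc m) t) ⟩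
  Σ-sizes (suc r) (λ _ _ → 1) + Σ-sizes (suc r) (λ m t → L 0 m (suc t) + L 0 (suc m) t)
    ≡⟨ cong₂ _+_ (trans (Σ-sizes-const (suc r) 1) (*-identityʳ (suc r)))
         (trans (Σ-sizes-+ (suc r) (λ m t → L 0 m (suc t)) (λ m → L 0 (suc m)))
           (cong (_+ W 0 (suc r)) (trans (sym (+-identityʳ _))
             (trans (cong (Σ-sizes (suc r) (λ m t → L 0 m (suc t)) +_) (sym (L-zero 0 (suc r))))
               (sym (Σ-sizes-last (suc r) (L 0))))))) ⟩
  suc r + (W 0 (suc r) + W 0 (suc r))
    ≡⟨ cong (λ w → suc r + (w + w)) (W₀ (suc r)) ⟩
  suc r + (η (suc r) + η (suc r))
    ≡⟨ regroup (suc r) (η (suc r)) ⟩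
  η (suc r) + (suc r + η (suc r))
    ≡⟨ cong (η (suc r) +_) (μ≡t+η (suc r)) ⟨
  η (suc (suc r)) ∎
  where
  open ≡-Reasoning
  regroup : ∀ r η → r + (η + η) ≡ η + (r + η)
  regroup = ℕ-Solver.solve-∀

-- Doubling with an exponential inhomogeneous term: a source of n times 2 ^ n in the result, as is
-- `Σμε-suc`.
ΣW-suc : ∀ n → ΣW (suc n) ≡ η (suc n) + ΣW n + ΣW n
ΣW-suc n = begin
  Total (λ b → W (suc b)) (suc n)
    ≡⟨ trans (Σ-sizes-last (suc n) (λ b → W (suc b)))
         (trans (cong (Σ-sizes (suc n) (λ b r → W (suc b) (suc r)) +_) (W-zero (2 + n))) (+-identityʳ _)) ⟩
  Σ-sizes (suc n) (λ b r → W (suc b) (suc r))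
    ≡⟨ trans (Σ-sizes-cong (suc n) W-suc) (Σ-sizes-+ (suc n) (λ b r → W b (suc r)) (λ b → W (suc b))) ⟩
  Σ-sizes (suc n) (λ b r → W b (suc r)) + ΣW n
    ≡⟨ cong (_+ ΣW n) (trans (sym (+-identityʳ _))
         (trans (cong (Σ-sizes (suc n) (λ b r → W b (suc r)) +_) (sym (W-zero (suc n))))
           (sym (Σ-sizes-last (suc n) W)))) ⟩
  (W 0 (suc n) + ΣW n) + ΣW n
    ≡⟨ cong (λ w → w + ΣW n + ΣW n) (W₀ (suc n)) ⟩
  η (suc n) + ΣW n + ΣW n ∎
  where open ≡-Reasoning

Σμε-suc : ∀ n → Σμε (suc n) ≡ ε₂ n + Σμε n + Σμε n
Σμε-suc n = begin
  Σ-sizes (suc n) (λ x r → (μ x + 2 ^ x) * ε₁ r)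
    ≡⟨ Σ-sizes-cong (suc n) (λ x r →
         trans (cong (λ q → (μ x + q) * ε₁ r) (2^≡1+μ x)) (distribute (μ x) (ε₁ r))) ⟩
  Σ-sizes (suc n) (λ x r → (ε₁ r + μ x * ε₁ r) + μ x * ε₁ r)
    ≡⟨ Σ-sizes-+ (suc n) (λ x r → ε₁ r + μ x * ε₁ r) (λ x r → μ x * ε₁ r) ⟩
  Σ-sizes (suc n) (λ x r → ε₁ r + μ x * ε₁ r) + Σμε n
    ≡⟨ cong (_+ Σμε n) (Σ-sizes-+ (suc n) (λ _ → ε₁) (λ x r → μ x * ε₁ r)) ⟩
  ε₂ n + Σμε n + Σμε n ∎
  where
  open ≡-Reasoning
  distribute : ∀ μ η → (μ + suc μ) * η ≡ (η + μ * η) + μ * η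
  distribute = ℕ-Solver.solve-∀

Σmt-suc : ∀ n → Σmt (suc n) ≡ suc n + Σt n + Σmt n
Σmt-suc n = trans (cong₂ _+_ (*-identityˡ (suc n)) (Σ-sizes-+ (suc n) (λ _ t → t) (λ m t → suc m * t)))
  (sym (+-assoc (suc n) (Σt n) (Σmt n)))

Σbt-suc : ∀ n → Σbt (suc n) ≡ Σt n + Σbt n
Σbt-suc n = Σ-sizes-+ (suc n) (λ _ t → t) (λ b t → b * t)

Σν-suc : ∀ n → Σν (suc n) ≡ (2 + n) + (Σν n + Σbt n)
Σν-suc n = cong (2 + n +_) (Σ-sizes-+ (suc n) ν (λ b t → b * t))

Συ-suc : ∀ n → Συ (suc n) ≡ ε₁ n + ε₁ n + Σmt n
Συ-suc n = trans (Σ-sizes-last (suc n) υ) (trans (+-identityʳ _)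
  (trans (Σ-sizes-+ (suc n) (λ m t → η t + η t) (λ m t → suc m * t))
    (cong (_+ Σmt n) (Σ-sizes-+ (suc n) (λ _ → η) (λ _ → η)))))

Σκ-zero : ∀ r → Total (κ 0) r ≡ η (suc r) + ε₁ r
Σκ-zero r = trans (Σ-sizes-+ (suc r) (λ m → L 0 (suc m)) (λ _ → η)) (cong (_+ ε₁ r) (W₀ (suc r)))

Σκ-step : ∀ x r → Total (κ (suc x)) r ≡ Total (κ x) r + (μ x * ε₁ r + (W (suc x) r + Συ r))
Σκ-step x r = trans (Σ-sizes-+ (suc r) (κ x) (λ m t → μ x * η t + (L (suc x) m t + υ m t)))
  (cong (Total (κ x) r +_) (trans (Σ-sizes-+ (suc r) (λ m t → μ x * η t) (λ m t → L (suc x) m t + υ m t))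
    (cong₂ _+_
      (trans (Σ-sizes-cong (suc r) λ _ t → *-comm (μ x) (η t))
        (trans (Σ-sizes-* (suc r) (λ _ → η) (μ x)) (*-comm (ε₁ r) (μ x))))
      (Σ-sizes-+ (suc r) (L (suc x)) υ))))

Σκ-suc : ∀ n → Σκ (suc n) ≡ (η (2 + n) + ε₁ (suc n)) + (Σκ n + (Σμε n + (ΣW n + ΣΣυ n)))
Σκ-suc n = cong₂ _+_ (Σκ-zero (suc n)) (trans (Σ-sizes-cong (suc n) Σκ-step)
  (trans (Σ-sizes-+ (suc n) (λ x → Total (κ x)) (λ x r → μ x * ε₁ r + (W (suc x) r + Συ r)))
    (cong (Σκ n +_) (trans (Σ-sizes-+ (suc n) (λ x r → μ x * ε₁ r) (λ x r → W (suc x) r + Συ r))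
      (cong (Σμε n +_) (Σ-sizes-+ (suc n) (λ x → W (suc x)) (λ _ → Συ)))))))

Σκω-suc : ∀ n → Σκω (suc n) ≡ Σκ n + (ε₂ n + ΣW n)
-- The inner sum is empty for b = 0; shifting b by one turns it into a `Total`, so both sums are
-- over triples.
Σκω-suc n = cong₂ _+_ (Total-assoc κ n)
  (trans (Σ-sizes-last (suc n) ω) (trans (+-identityʳ _) (Σ-sizes-+ (suc n) (λ _ → ε₁) (λ b → W (suc b)))))

Σε-suc : ∀ n → Σε (suc n) ≡ Σε n + Σκω n
Σε-suc n = trans (Σ-sizes-+ (suc n) ε (λ b t → Σ-sizes b (λ x y → κ x y t) + ω b t))
  (cong (Σε n +_) (Σ-sizes-+ (suc n) (λ b t → Σ-sizes b (λ x y → κ x y t)) ω))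

-- Closed forms

-- The sequences n ↦ (a + b n) 2 ^ n + Σ cₖ (n choose k).
record Closed : Set where
  constructor closed
  field
    a b : ℤ
    cs  : Vec ℤ 7

-- Pascal's rule: replacing n by n + 1 adds the coefficient of (n choose k + 1) to that of (n choose
-- k).
shift-coefficients : ∀ {n} → Vec ℤ n → Vec ℤ n
shift-coefficients []           = []
shift-coefficients (c ∷ [])     = c ∷ []
shift-coefficients (c ∷ d ∷ cs) = (c ℤ.+ d) ∷ shift-coefficients (d ∷ cs)

next-term : Closed → Closed
next-term (closed a b cs) = closed ((a ℤ.+ a) ℤ.+ (b ℤ.+ b)) (b ℤ.+ b) (shift-coefficients cs)

-- Evaluation shifts the sequence n times and reads it off at 0, so that identities between shifted
-- sequences reduce to identities between coefficients.
term : Closed → ℕ → ℤ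
term (closed a b cs) zero    = a ℤ.+ Vec.head cs
term x               (suc n) = term (next-term x) n

infixl 6 _⊞_

_⊞_ : Closed → Closed → Closed
closed a b cs ⊞ closed a′ b′ cs′ = closed (a ℤ.+ a′) (b ℤ.+ b′) (Vec.zipWith ℤ._+_ cs cs′)

_⊡_ : ℤ → Closed → Closed
k ⊡ closed a b cs = closed (k ℤ.* a) (k ℤ.* b) (Vec.map (k ℤ.*_) cs)

shift-+ : ∀ {n} (cs ds : Vec ℤ n) → shift-coefficients (Vec.zipWith ℤ._+_ cs ds) ≡
          Vec.zipWith ℤ._+_ (shift-coefficients cs) (shift-coefficients ds)
shift-+ []            []            = refl
shift-+ (c ∷ [])      (d ∷ [])      = refl
shift-+ (c ∷ c′ ∷ cs) (d ∷ d′ ∷ ds) = cong₂ _∷_ (exchange c d c′ d′) (shift-+ (c′ ∷ cs) (d′ ∷ ds))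
  where
  exchange : ∀ a b c d → (a ℤ.+ b) ℤ.+ (c ℤ.+ d) ≡ (a ℤ.+ c) ℤ.+ (b ℤ.+ d)
  exchange = ℤ-Solver.solve-∀

shift-* : ∀ {n} k (cs : Vec ℤ n) → shift-coefficients (Vec.map (k ℤ.*_) cs) ≡
          Vec.map (k ℤ.*_) (shift-coefficients cs)
shift-* k []            = refl
shift-* k (c ∷ [])      = refl
shift-* k (c ∷ c′ ∷ cs) = cong₂ _∷_ (sym (ℤₚ.*-distribˡ-+ k c c′)) (shift-* k (c′ ∷ cs))

closed-cong : ∀ {a a′ b b′ cs cs′} → a ≡ a′ → b ≡ b′ → cs ≡ cs′ → closed a b cs ≡ closed a′ b′ cs′
closed-cong refl refl refl = refl

term-+ : ∀ x y n → term (x ⊞ y) n ≡ term x n ℤ.+ term y n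
term-+ (closed a b (c ∷ _)) (closed a′ b′ (c′ ∷ _)) zero = exchange a a′ c c′
  where
  exchange : ∀ a b c d → (a ℤ.+ b) ℤ.+ (c ℤ.+ d) ≡ (a ℤ.+ c) ℤ.+ (b ℤ.+ d)
  exchange = ℤ-Solver.solve-∀
term-+ x@(closed a b cs) y@(closed a′ b′ cs′) (suc n) = trans
  (cong (λ z → term z n) (closed-cong (regroup a a′ b b′) (exchange b b′) (shift-+ cs cs′)))
  (term-+ (next-term x) (next-term y) n)
  where
  regroup : ∀ a c b d → ((a ℤ.+ c) ℤ.+ (a ℤ.+ c)) ℤ.+ ((b ℤ.+ d) ℤ.+ (b ℤ.+ d)) ≡
                        ((a ℤ.+ a) ℤ.+ (b ℤ.+ b)) ℤ.+ ((c ℤ.+ c) ℤ.+ (d ℤ.+ d))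
  regroup = ℤ-Solver.solve-∀
  exchange : ∀ b d → (b ℤ.+ d) ℤ.+ (b ℤ.+ d) ≡ (b ℤ.+ b) ℤ.+ (d ℤ.+ d)
  exchange = ℤ-Solver.solve-∀

term-* : ∀ k x n → term (k ⊡ x) n ≡ k ℤ.* term x n
term-* k (closed a b (c ∷ _)) zero = sym (ℤₚ.*-distribˡ-+ k a c)
term-* k x@(closed a b cs) (suc n) = trans
  (cong (λ z → term z n) (closed-cong (regroup k a b) (sym (ℤₚ.*-distribˡ-+ k b b)) (shift-* k cs)))
  (term-* k (next-term x) n)
  where
  regroup : ∀ k a b → (k ℤ.* a ℤ.+ k ℤ.* a) ℤ.+ (k ℤ.* b ℤ.+ k ℤ.* b) ≡ k ℤ.* ((a ℤ.+ a) ℤ.+ (b ℤ.+ b))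
  regroup = ℤ-Solver.solve-∀

record Value (s n : ℕ) (x : Closed) : Set where
  constructor value-is
  field equation : ↑ s ≡ term x n

open Value

infix 4 _∼_
infixl 6 _∔_

_∼_ : (ℕ → ℕ) → Closed → Set
s ∼ x = ∀ n → Value (s n) n x

_∔_ : ∀ {s t n x y} → Value s n x → Value t n y → Value (s + t) n (x ⊞ y)
_∔_ {s} {t} {n} {x} {y} (value-is h) (value-is h′) =
  value-is (trans (ℤₚ.pos-+ s t) (trans (cong₂ ℤ._+_ h h′) (sym (term-+ x y n))))

previous : ∀ {s n x} → Value s (suc n) x → Value s n (next-term x)
previous (value-is h) = value-is h

rewrite-by : ∀ {s t n x} → s ≡ t → Value t n x → Value s n x
rewrite-by refl h = h

-- The coefficients solve the recurrences above with their initial values; evaluation confirms them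
-- in the `∼` statements below. `closed-remainder` is `closed-Σε` plus 1 minus `closed-Σν`.
closed-pow closed-one closed-suc closed-μ closed-η closed-ε₁ closed-ε₂ closed-Σμε closed-ΣW closed-Σt closed-Σmt
  closed-Σbt closed-Συ closed-ΣΣυ closed-Σκ closed-Σκω closed-Σε closed-Σν closed-remainder : Closed
closed-pow = closed (↑ 1) (↑ 0) (↑ 0 ∷ ↑ 0 ∷ ↑ 0 ∷ ↑ 0 ∷ ↑ 0 ∷ ↑ 0 ∷ ↑ 0 ∷ [])
closed-one = closed (↑ 0) (↑ 0) (↑ 1 ∷ ↑ 0 ∷ ↑ 0 ∷ ↑ 0 ∷ ↑ 0 ∷ ↑ 0 ∷ ↑ 0 ∷ [])
closed-suc = closed (↑ 0) (↑ 0) (↑ 1 ∷ ↑ 1 ∷ ↑ 0 ∷ ↑ 0 ∷ ↑ 0 ∷ ↑ 0 ∷ ↑ 0 ∷ [])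
closed-μ   = closed (↑ 1) (↑ 0) (- ↑ 1 ∷ ↑ 0 ∷ ↑ 0 ∷ ↑ 0 ∷ ↑ 0 ∷ ↑ 0 ∷ ↑ 0 ∷ [])
closed-η   = closed (↑ 1) (↑ 0) (- ↑ 1 ∷ - ↑ 1 ∷ ↑ 0 ∷ ↑ 0 ∷ ↑ 0 ∷ ↑ 0 ∷ ↑ 0 ∷ [])
closed-ε₁  = closed (↑ 2) (↑ 0) (- ↑ 2 ∷ - ↑ 2 ∷ - ↑ 1 ∷ ↑ 0 ∷ ↑ 0 ∷ ↑ 0 ∷ ↑ 0 ∷ [])
closed-ε₂  = closed (↑ 4) (↑ 0) (- ↑ 4 ∷ - ↑ 4 ∷ - ↑ 3 ∷ - ↑ 1 ∷ ↑ 0 ∷ ↑ 0 ∷ ↑ 0 ∷ [])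
closed-Σμε   = closed (- ↑ 12) (↑ 2) (↑ 12 ∷ ↑ 8 ∷ ↑ 4 ∷ ↑ 1 ∷ ↑ 0 ∷ ↑ 0 ∷ ↑ 0 ∷ [])
closed-ΣW   = closed (- ↑ 3) (↑ 1) (↑ 3 ∷ ↑ 1 ∷ ↑ 0 ∷ ↑ 0 ∷ ↑ 0 ∷ ↑ 0 ∷ ↑ 0 ∷ [])
closed-Σt   = closed (↑ 0) (↑ 0) (↑ 0 ∷ ↑ 1 ∷ ↑ 1 ∷ ↑ 0 ∷ ↑ 0 ∷ ↑ 0 ∷ ↑ 0 ∷ [])
closed-Σmt   = closed (↑ 0) (↑ 0) (↑ 0 ∷ ↑ 1 ∷ ↑ 2 ∷ ↑ 1 ∷ ↑ 0 ∷ ↑ 0 ∷ ↑ 0 ∷ [])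
closed-Σbt   = closed (↑ 0) (↑ 0) (↑ 0 ∷ ↑ 0 ∷ ↑ 1 ∷ ↑ 1 ∷ ↑ 0 ∷ ↑ 0 ∷ ↑ 0 ∷ [])
closed-Συ   = closed (↑ 2) (↑ 0) (- ↑ 2 ∷ - ↑ 2 ∷ - ↑ 1 ∷ ↑ 1 ∷ ↑ 0 ∷ ↑ 0 ∷ ↑ 0 ∷ [])
closed-ΣΣυ  = closed (↑ 4) (↑ 0) (- ↑ 4 ∷ - ↑ 4 ∷ - ↑ 3 ∷ ↑ 0 ∷ ↑ 1 ∷ ↑ 0 ∷ ↑ 0 ∷ [])
closed-Σκ   = closed (- ↑ 9) (↑ 3) (↑ 9 ∷ ↑ 4 ∷ ↑ 1 ∷ ↑ 0 ∷ ↑ 1 ∷ ↑ 1 ∷ ↑ 0 ∷ [])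
closed-Σκω  = closed (- ↑ 6) (↑ 2) (↑ 6 ∷ ↑ 2 ∷ - ↑ 1 ∷ - ↑ 1 ∷ ↑ 0 ∷ ↑ 1 ∷ ↑ 0 ∷ [])
closed-Σε   = closed (- ↑ 10) (↑ 2) (↑ 10 ∷ ↑ 6 ∷ ↑ 2 ∷ - ↑ 1 ∷ - ↑ 1 ∷ ↑ 0 ∷ ↑ 1 ∷ [])
closed-Σν   = closed (↑ 0) (↑ 0) (↑ 1 ∷ ↑ 2 ∷ ↑ 1 ∷ ↑ 1 ∷ ↑ 1 ∷ ↑ 0 ∷ ↑ 0 ∷ [])
closed-remainder   = closed (- ↑ 10) (↑ 2) (↑ 10 ∷ ↑ 4 ∷ ↑ 1 ∷ - ↑ 2 ∷ - ↑ 2 ∷ ↑ 0 ∷ ↑ 1 ∷ [])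

-- Here `y` is the form that the recurrence yields for the next term; comparing its coefficients
-- with the shift of `x` is the whole induction step.
∼-rec : ∀ {s x y} → ↑ s 0 ≡ term x 0 → next-term x ≡ y →
        (∀ n → Value (s n) n x → Value (s (suc n)) n y) → s ∼ x
∼-rec base eq rec zero    = value-is base
∼-rec base eq rec (suc n) = value-is
  (trans (equation (rec n (∼-rec base eq rec n))) (cong (λ z → term z n) (sym eq)))

one∼ : (λ _ → 1) ∼ closed-one
one∼ = ∼-rec refl refl λ n (value-is h) → value-is h

suc∼ : suc ∼ closed-suc
suc∼ = ∼-rec refl refl λ n h → one∼ n ∔ h

pow∼ : (2 ^_) ∼ closed-pow
pow∼ = ∼-rec refl refl λ n h → rewrite-by (cong (2 ^ n +_) (+-identityʳ (2 ^ n))) (h ∔ h)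

μ∼ : μ ∼ closed-μ
μ∼ = ∼-rec refl refl λ n h → h ∔ pow∼ n

η∼ : η ∼ closed-η
η∼ = ∼-rec refl refl λ n h → h ∔ μ∼ n

ε₁∼ : ε₁ ∼ closed-ε₁
ε₁∼ = ∼-rec refl refl λ n h → previous (η∼ (suc n)) ∔ h

ε₂∼ : ε₂ ∼ closed-ε₂
ε₂∼ = ∼-rec refl refl λ n h → previous (ε₁∼ (suc n)) ∔ h

Σμε∼ : Σμε ∼ closed-Σμε
Σμε∼ = ∼-rec refl refl λ n h → rewrite-by (Σμε-suc n) (ε₂∼ n ∔ h ∔ h)

ΣW∼ : ΣW ∼ closed-ΣW
ΣW∼ = ∼-rec refl refl λ n h → rewrite-by (ΣW-suc n) (previous (η∼ (suc n)) ∔ h ∔ h)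

Σt∼ : Σt ∼ closed-Σt
Σt∼ = ∼-rec refl refl λ n h → suc∼ n ∔ h

Σmt∼ : Σmt ∼ closed-Σmt
Σmt∼ = ∼-rec refl refl λ n h → rewrite-by (Σmt-suc n) (suc∼ n ∔ Σt∼ n ∔ h)

Σbt∼ : Σbt ∼ closed-Σbt
Σbt∼ = ∼-rec refl refl λ n h → rewrite-by (Σbt-suc n) (Σt∼ n ∔ h)

Συ∼ : Συ ∼ closed-Συ
Συ∼ = ∼-rec refl refl λ n h → rewrite-by (Συ-suc n) (ε₁∼ n ∔ ε₁∼ n ∔ Σmt∼ n)

ΣΣυ∼ : ΣΣυ ∼ closed-ΣΣυ
ΣΣυ∼ = ∼-rec refl refl λ n h → previous (Συ∼ (suc n)) ∔ h

Σκ∼ : Σκ ∼ closed-Σκ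
Σκ∼ = ∼-rec refl refl λ n h → rewrite-by (Σκ-suc n)
  (previous (previous (η∼ (2 + n))) ∔ previous (ε₁∼ (suc n)) ∔ (h ∔ (Σμε∼ n ∔ (ΣW∼ n ∔ ΣΣυ∼ n))))

Σκω∼ : Σκω ∼ closed-Σκω
Σκω∼ = ∼-rec refl refl λ n h → rewrite-by (Σκω-suc n) (Σκ∼ n ∔ (ε₂∼ n ∔ ΣW∼ n))

Σε∼ : Σε ∼ closed-Σε
Σε∼ = ∼-rec refl refl λ n h → rewrite-by (Σε-suc n) (h ∔ Σκω∼ n)

Σν∼ : Σν ∼ closed-Σν
Σν∼ = ∼-rec refl refl λ n h → rewrite-by (Σν-suc n) (previous (suc∼ (suc n)) ∔ (h ∔ Σbt∼ n))

-- The closed forms count by the letters besides the first one, hence the shift; the empty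
-- permutation stands apart.
remainder : ℕ → ℤ
remainder zero    = ↑ 1
remainder (suc n) = term closed-remainder n

-- The 1 taken away is the Catalan number C(0) contained in `Σβ n`, since the Catalan series enters
-- without its constant term.
catalan-part : ℕ → ℤ
catalan-part zero    = ↑ 0
catalan-part (suc n) = (↑ Σσ n ℤ.+ ↑ Σβ n) ℤ.- ↑ 1

total-closed : ∀ n → ↑ Total d₀ n ≡ remainder (suc n) ℤ.+ catalan-part (suc n)
total-closed n = begin
  ↑ Total d₀ n
    ≡⟨ add-subtract (↑ Total d₀ n) (↑ Σν n) ⟩
  (↑ Total d₀ n ℤ.+ ↑ Σν n) ℤ.- ↑ Σν n
    ≡⟨ cong₂ ℤ._-_ (trans (sym (ℤₚ.pos-+ (Total d₀ n) (Σν n))) (trans (cong ↑_ (total-split n))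
         (trans (ℤₚ.pos-+ (Σσ n + Σβ n) (Σε n))
           (cong₂ ℤ._+_ (ℤₚ.pos-+ (Σσ n) (Σβ n)) (equation (Σε∼ n)))))) (equation (Σν∼ n)) ⟩
  ((↑ Σσ n ℤ.+ ↑ Σβ n) ℤ.+ term closed-Σε n) ℤ.- term closed-Σν n
    ≡⟨ regroup (↑ Σσ n ℤ.+ ↑ Σβ n) (term closed-Σε n) (term closed-Σν n) (term closed-remainder n)
         (trans (cong (λ z → term closed-Σε n ℤ.+ z) (equation (one∼ n)))
           -- The two sums of closed forms have the same coefficients by evaluation.
           (trans (sym (term-+ closed-Σε closed-one n)) (term-+ closed-Σν closed-remainder n))) ⟩
  term closed-remainder n ℤ.+ ((↑ Σσ n ℤ.+ ↑ Σβ n) ℤ.- ↑ 1) ∎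
  where
  open ≡-Reasoning
  add-subtract : ∀ a b → a ≡ (a ℤ.+ b) ℤ.- b
  add-subtract = ℤ-Solver.solve-∀
  lemma₁ : ∀ t η n → (t ℤ.+ η) ℤ.- n ≡ ((η ℤ.+ ↑ 1) ℤ.- n) ℤ.+ (t ℤ.- ↑ 1)
  lemma₁ = ℤ-Solver.solve-∀
  lemma₂ : ∀ n r → (n ℤ.+ r) ℤ.- n ≡ r
  lemma₂ = ℤ-Solver.solve-∀
  regroup : ∀ t η n r → η ℤ.+ ↑ 1 ≡ n ℤ.+ r → (t ℤ.+ η) ℤ.- n ≡ r ℤ.+ (t ℤ.- ↑ 1)
  regroup t η n r eq = trans (lemma₁ t η n)
    (cong (λ z → z ℤ.+ (t ℤ.- ↑ 1)) (trans (cong (λ z → z ℤ.- n) eq) (lemma₂ n r)))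

-- Power series

-- The product `⊛` by recursion on the index, the form in which the algebra of series goes by
-- induction.
conv : Series → Series → Series
conv f g zero    = f 0 ℤ.* g 0
conv f g (suc n) = f 0 ℤ.* g (suc n) ℤ.+ conv (f ∘ suc) g n

⊛-conv : ∀ f g → f ⊛ g ≗ conv f g
⊛-conv f g n = trans (cong ΣZ (map-applyUpTo id (λ k → f k ℤ.* g (n ∸ k)) (suc n))) (go f n)
  where
  go : ∀ f n → ΣZ (applyUpTo (λ k → f k ℤ.* g (n ∸ k)) (suc n)) ≡ conv f g n
  go f zero    = ℤₚ.+-identityʳ _
  go f (suc n) = cong (λ z → f 0 ℤ.* g (suc n) ℤ.+ z) (go (f ∘ suc) n)

conv-cong : ∀ {f f′ g g′} → f ≗ f′ → g ≗ g′ → conv f g ≗ conv f′ g′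
conv-cong p q zero    = cong₂ ℤ._*_ (p 0) (q 0)
conv-cong p q (suc n) = cong₂ ℤ._+_ (cong₂ ℤ._*_ (p 0) (q (suc n))) (conv-cong (p ∘ suc) q n)

conv-last : ∀ f g n → conv f g (suc n) ≡ conv f (g ∘ suc) n ℤ.+ f (suc n) ℤ.* g 0
conv-last f g zero    = refl
conv-last f g (suc n) = trans (cong (λ z → f 0 ℤ.* g (2 + n) ℤ.+ z) (conv-last (f ∘ suc) g n))
  (sym (ℤₚ.+-assoc (f 0 ℤ.* g (2 + n)) _ _))

conv-comm : ∀ f g → conv f g ≗ conv g f
conv-comm f g zero    = ℤₚ.*-comm (f 0) (g 0)
conv-comm f g (suc n) = begin
  f 0 ℤ.* g (suc n) ℤ.+ conv (f ∘ suc) g n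
    ≡⟨ cong₂ ℤ._+_ (ℤₚ.*-comm (f 0) (g (suc n))) (conv-comm (f ∘ suc) g n) ⟩
  g (suc n) ℤ.* f 0 ℤ.+ conv g (f ∘ suc) n ≡⟨ ℤₚ.+-comm (g (suc n) ℤ.* f 0) _ ⟩
  conv g (f ∘ suc) n ℤ.+ g (suc n) ℤ.* f 0 ≡⟨ conv-last g f n ⟨
  conv g f (suc n) ∎
  where open ≡-Reasoning

-- Linearity in the shape in which the tail of a product arises in `conv-assoc`.
conv-distrib : ∀ a f g h n → conv (λ i → a ℤ.* f i ℤ.+ g i) h n ≡ a ℤ.* conv f h n ℤ.+ conv g h n
conv-distrib a f g h zero    = distribute a (f 0) (g 0) (h 0)
  where
  distribute : ∀ a f g h → (a ℤ.* f ℤ.+ g) ℤ.* h ≡ a ℤ.* (f ℤ.* h) ℤ.+ g ℤ.* h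
  distribute = ℤ-Solver.solve-∀
conv-distrib a f g h (suc n) = trans
  (cong (λ z → (a ℤ.* f 0 ℤ.+ g 0) ℤ.* h (suc n) ℤ.+ z) (conv-distrib a (f ∘ suc) (g ∘ suc) h n))
  (distribute a (f 0) (g 0) (h (suc n)) (conv (f ∘ suc) h n) (conv (g ∘ suc) h n))
  where
  distribute : ∀ a f g h x y → (a ℤ.* f ℤ.+ g) ℤ.* h ℤ.+ (a ℤ.* x ℤ.+ y) ≡
                               a ℤ.* (f ℤ.* h ℤ.+ x) ℤ.+ (g ℤ.* h ℤ.+ y)
  distribute = ℤ-Solver.solve-∀

conv-assoc : ∀ f g h → conv (conv f g) h ≗ conv f (conv g h)
conv-assoc f g h zero    = ℤₚ.*-assoc (f 0) (g 0) (h 0)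
conv-assoc f g h (suc n) = begin
  f 0 ℤ.* g 0 ℤ.* h (suc n) ℤ.+ conv (λ i → f 0 ℤ.* g (suc i) ℤ.+ conv (f ∘ suc) g i) h n
    ≡⟨ cong (λ z → f 0 ℤ.* g 0 ℤ.* h (suc n) ℤ.+ z)
         (trans (conv-distrib (f 0) (g ∘ suc) (conv (f ∘ suc) g) h n)
           (cong (λ z → f 0 ℤ.* conv (g ∘ suc) h n ℤ.+ z) (conv-assoc (f ∘ suc) g h n))) ⟩
  f 0 ℤ.* g 0 ℤ.* h (suc n) ℤ.+ (f 0 ℤ.* conv (g ∘ suc) h n ℤ.+ conv (f ∘ suc) (conv g h) n)
    ≡⟨ regroup (f 0) (g 0) (h (suc n)) (conv (g ∘ suc) h n) _ ⟩
  conv f (conv g h) (suc n) ∎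
  where
  open ≡-Reasoning
  regroup : ∀ f g h x y → f ℤ.* g ℤ.* h ℤ.+ (f ℤ.* x ℤ.+ y) ≡ f ℤ.* (g ℤ.* h ℤ.+ x) ℤ.+ y
  regroup = ℤ-Solver.solve-∀

conv-zero : ∀ g n → conv (poly []) g n ≡ ↑ 0
conv-zero g zero    = refl
conv-zero g (suc n) = trans (ℤₚ.+-identityˡ (conv (poly []) g n)) (conv-zero g n)

conv-constant : ∀ a g n → conv (poly (a ∷ [])) g n ≡ a ℤ.* g n
conv-constant a g zero    = refl
conv-constant a g (suc n) = trans (cong (λ z → a ℤ.* g (suc n) ℤ.+ z) (conv-zero g n)) (ℤₚ.+-identityʳ _)

conv-one : ∀ g → conv one g ≗ g
conv-one g n = trans (conv-constant (↑ 1) g n) (ℤₚ.*-identityˡ (g n))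

invUpTo-inv : ∀ f n → invUpTo f n ≡ applyUpTo (λ k → inv f (n ∸ k)) (suc n)
invUpTo-inv f zero    = refl
invUpTo-inv f (suc n) = cong (inv f (suc n) ∷_) (invUpTo-inv f n)

zipWith-applyUpTo : ∀ (f g : ℕ → ℤ) n →
  zipWith ℤ._*_ (applyUpTo f n) (applyUpTo g n) ≡ applyUpTo (λ k → f k ℤ.* g k) n
zipWith-applyUpTo f g zero    = refl
zipWith-applyUpTo f g (suc n) = cong (f 0 ℤ.* g 0 ∷_) (zipWith-applyUpTo (f ∘ suc) (g ∘ suc) n)

inv-suc : ∀ f n → inv f (suc n) ≡ - conv (f ∘ suc) (inv f) n
inv-suc f n = cong -_ (trans
  (cong ΣZ (trans
    (cong₂ (zipWith ℤ._*_) (map-applyUpTo id (f ∘ suc) (suc n)) (invUpTo-inv f n))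
    (trans (zipWith-applyUpTo (f ∘ suc) (λ k → inv f (n ∸ k)) (suc n))
      (sym (map-applyUpTo id (λ k → f (suc k) ℤ.* inv f (n ∸ k)) (suc n))))))
  (⊛-conv (f ∘ suc) (inv f) n))

conv-inv : ∀ f → f 0 ≡ ↑ 1 → conv f (inv f) ≗ one
conv-inv f f₀ zero    rewrite f₀ = refl
conv-inv f f₀ (suc n) rewrite f₀ | inv-suc f n = cancel (conv (f ∘ suc) (inv f) n)
  where
  cancel : ∀ c → ↑ 1 ℤ.* (- c) ℤ.+ c ≡ ↑ 0
  cancel = ℤ-Solver.solve-∀

-- Cancelling `g` against its inverse reduces the identification of a quotient to checking one
-- product.
⊘-unique : ∀ f g h → g 0 ≡ ↑ 1 → conv g h ≗ f → f ⊘ g ≗ h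
⊘-unique f g h g₀ gh≗f n = begin
  (f ⊘ g) n                     ≡⟨ ⊛-conv f (inv g) n ⟩
  conv f (inv g) n              ≡⟨ conv-cong (λ i → trans (sym (gh≗f i)) (conv-comm g h i)) (λ _ → refl) n ⟩
  conv (conv h g) (inv g) n     ≡⟨ conv-assoc h g (inv g) n ⟩
  conv h (conv g (inv g)) n     ≡⟨ conv-cong (λ _ → refl) (conv-inv g g₀) n ⟩
  conv h one n                  ≡⟨ conv-comm h one n ⟩
  conv one h n                  ≡⟨ conv-one h n ⟩
  h n                           ∎
  where open ≡-Reasoning

-- Multiplying closed forms by the factors of the denominator

prefixed : List ℤ → Closed → Series
prefixed []       x n       = term x n
prefixed (a ∷ as) x zero    = a
prefixed (a ∷ as) x (suc n) = prefixed as x n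

-- Multiplication by 1 + k x, with c in place of the coefficient before the first one.
factor : ℤ → ℤ → Series → Series
factor k c f zero    = f 0 ℤ.+ k ℤ.* c
factor k c f (suc n) = f (suc n) ℤ.+ k ℤ.* f n

-- The first term of the closed part interacts with the last listed coefficient, so each factor
-- lengthens the list by one.
factor-coefficients : ℤ → ℤ → List ℤ → Closed → List ℤ
factor-coefficients k c []       x = (term x 0 ℤ.+ k ℤ.* c) ∷ []
factor-coefficients k c (a ∷ as) x = (a ℤ.+ k ℤ.* c) ∷ factor-coefficients k a as x

factor-prefixed : ∀ k c as x →
  factor k c (prefixed as x) ≗ prefixed (factor-coefficients k c as x) (next-term x ⊞ (k ⊡ x))
factor-prefixed k c []       x zero          = refl
factor-prefixed k c []       x (suc n)       = sym (trans (term-+ (next-term x) (k ⊡ x) n)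
                                                 (cong (λ z → term x (suc n) ℤ.+ z) (term-* k x n)))
factor-prefixed k c (a ∷ as) x zero          = refl
factor-prefixed k c (a ∷ as) x (suc zero)    = factor-prefixed k a as x zero
factor-prefixed k c (a ∷ as) x (suc (suc n)) = factor-prefixed k a as x (suc n)

affine : ℤ → Series
affine k = poly (↑ 1 ∷ k ∷ [])

conv-affine : ∀ k f → conv (affine k) f ≗ factor k (↑ 0) f
conv-affine k f zero    = trans (ℤₚ.*-identityˡ (f 0))
  (sym (trans (cong (λ z → f 0 ℤ.+ z) (ℤₚ.*-zeroʳ k)) (ℤₚ.+-identityʳ (f 0))))
conv-affine k f (suc n) = cong₂ ℤ._+_ (ℤₚ.*-identityˡ (f (suc n))) (conv-constant k f n)

factors : ℕ → ℤ → List ℤ × Closed → List ℤ × Closed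
factors zero    k s        = s
factors (suc j) k s = let as , x = factors j k s in factor-coefficients k (↑ 0) as x , next-term x ⊞ (k ⊡ x)

power-prefixed : ∀ j k s → conv (affine k ^^ j) (λ n → prefixed (proj₁ s) (proj₂ s) n) ≗
                 prefixed (proj₁ (factors j k s)) (proj₂ (factors j k s))
power-prefixed zero    k s n = conv-one (prefixed (proj₁ s) (proj₂ s)) n
power-prefixed (suc j) k s n = begin
  conv (affine k ⊛ (affine k ^^ j)) f n
    ≡⟨ conv-cong (⊛-conv (affine k) (affine k ^^ j)) (λ _ → refl) n ⟩
  conv (conv (affine k) (affine k ^^ j)) f n
    ≡⟨ conv-assoc (affine k) (affine k ^^ j) f n ⟩
  conv (affine k) (conv (affine k ^^ j) f) n
    ≡⟨ conv-cong (λ _ → refl) (power-prefixed j k s) n ⟩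
  conv (affine k) (prefixed (proj₁ (factors j k s)) (proj₂ (factors j k s))) n
    ≡⟨ conv-affine k _ n ⟩
  factor k (↑ 0) (prefixed (proj₁ (factors j k s)) (proj₂ (factors j k s))) n
    ≡⟨ factor-prefixed k (↑ 0) (proj₁ (factors j k s)) (proj₂ (factors j k s)) n ⟩
  prefixed (proj₁ (factors (suc j) k s)) (proj₂ (factors (suc j) k s)) n ∎
  where
  open ≡-Reasoning
  f = prefixed (proj₁ s) (proj₂ s)

nil : Closed
nil = closed (↑ 0) (↑ 0) (↑ 0 ∷ ↑ 0 ∷ ↑ 0 ∷ ↑ 0 ∷ ↑ 0 ∷ ↑ 0 ∷ ↑ 0 ∷ [])

prefixed-nil : ∀ as → prefixed as nil ≗ poly as
prefixed-nil []       zero    = refl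
prefixed-nil []       (suc n) = prefixed-nil [] n
prefixed-nil (a ∷ as) zero    = refl
prefixed-nil (a ∷ as) (suc n) = prefixed-nil as n

-- Two factors 1 - 2x annihilate (a + b n) 2 ^ n, and seven factors 1 - x annihilate polynomials of
-- degree at most six; only initial coefficients are left.
remainder-series : numer ⊘ ((oneMinusX ^^ 7) ⊛ (oneMinus2X ^^ 2)) ≗ remainder
remainder-series = ⊘-unique numer ((oneMinusX ^^ 7) ⊛ (oneMinus2X ^^ 2)) remainder refl λ n → begin
  conv ((oneMinusX ^^ 7) ⊛ (oneMinus2X ^^ 2)) remainder n
    ≡⟨ conv-cong (⊛-conv (oneMinusX ^^ 7) (oneMinus2X ^^ 2)) start n ⟩
  conv (conv (oneMinusX ^^ 7) (oneMinus2X ^^ 2)) (prefixed (↑ 1 ∷ []) closed-remainder) n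
    ≡⟨ conv-assoc (oneMinusX ^^ 7) (oneMinus2X ^^ 2) (prefixed (↑ 1 ∷ []) closed-remainder) n ⟩
  conv (oneMinusX ^^ 7) (conv (oneMinus2X ^^ 2) (prefixed (↑ 1 ∷ []) closed-remainder)) n
    ≡⟨ conv-cong {oneMinusX ^^ 7} (λ _ → refl) (power-prefixed 2 (- ↑ 2) (↑ 1 ∷ [] , closed-remainder)) n ⟩
  conv (oneMinusX ^^ 7) (prefixed (proj₁ s) (proj₂ s)) n
    ≡⟨ power-prefixed 7 (- ↑ 1) s n ⟩
  prefixed (proj₁ (factors 7 (- ↑ 1) s)) (proj₂ (factors 7 (- ↑ 1) s)) n
    -- Evaluation leaves the zero closed form, and the ten listed coefficients are those of the
    -- numerator: one for the empty permutation and one for each of the nine factors.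
    ≡⟨⟩
  prefixed (↑ 1 ∷ - ↑ 11 ∷ ↑ 51 ∷ - ↑ 130 ∷ ↑ 199 ∷ - ↑ 183 ∷ ↑ 91 ∷ - ↑ 15 ∷ - ↑ 6 ∷ ↑ 4 ∷ []) nil n
    ≡⟨ prefixed-nil (↑ 1 ∷ - ↑ 11 ∷ ↑ 51 ∷ - ↑ 130 ∷ ↑ 199 ∷ - ↑ 183 ∷ ↑ 91 ∷ - ↑ 15 ∷ - ↑ 6 ∷ ↑ 4 ∷ []) n ⟩
  numer n ∎
  where
  open ≡-Reasoning
  s = factors 2 (- ↑ 2) (↑ 1 ∷ [] , closed-remainder)
  start : remainder ≗ prefixed (↑ 1 ∷ []) closed-remainder
  start zero    = refl
  start (suc n) = refl

-- Binomial coefficients, ballot numbers and Catalan numbers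

absorb : ∀ n k → suc k * (n choose (suc k)) + k * (n choose k) ≡ n * (n choose k)
absorb zero    zero    = refl
absorb zero    (suc k) = cong₂ _+_ (*-zeroʳ (2 + k)) (*-zeroʳ (suc k))
absorb (suc n) zero    = begin
  1 * (suc n choose 1) + 0         ≡⟨ +-identityʳ _ ⟩
  1 * (suc n choose 1)               ≡⟨ cong (1 *_) (sym (nCk+nC[k+1]≡[n+1]C[k+1] n 0)) ⟩
  1 * (n choose 0 + n choose 1)         ≡⟨ regroup (n choose 0) (n choose 1) ⟩
  n choose 0 + (1 * (n choose 1) + 0 * (n choose 0)) ≡⟨ cong (n choose 0 +_) (absorb n 0) ⟩
  suc n * (n choose 0)               ≡⟨⟩
  suc n * (suc n choose 0)           ∎
  where
  open ≡-Reasoning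
  regroup : ∀ a b → 1 * (a + b) ≡ a + (1 * b + 0 * a)
  regroup = ℕ-Solver.solve-∀
absorb (suc n) (suc k) = begin
  suc (suc k) * (suc n choose (suc (suc k))) + suc k * (suc n choose (suc k))
    ≡⟨ cong₂ (λ x y → suc (suc k) * x + suc k * y)
         (sym (nCk+nC[k+1]≡[n+1]C[k+1] n (suc k))) (sym (nCk+nC[k+1]≡[n+1]C[k+1] n k)) ⟩
  suc (suc k) * (b + c) + suc k * (a + b)
    ≡⟨ regroup a b c k ⟩
  (suc (suc k) * c + suc k * b) + (suc k * b + k * a) + (a + b)
    ≡⟨ cong₂ (λ x y → x + y + (a + b)) (absorb n (suc k)) (absorb n k) ⟩
  n * b + n * a + (a + b)
    ≡⟨ collect n a b ⟩
  suc n * (a + b)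
    ≡⟨ cong (suc n *_) (nCk+nC[k+1]≡[n+1]C[k+1] n k) ⟩
  suc n * (suc n choose (suc k)) ∎
  where
  open ≡-Reasoning
  a = n choose k
  b = n choose (suc k)
  c = n choose (suc (suc k))
  regroup : ∀ a b c k → suc (suc k) * (b + c) + suc k * (a + b) ≡
            (suc (suc k) * c + suc k * b) + (suc k * b + k * a) + (a + b)
  regroup = ℕ-Solver.solve-∀
  collect : ∀ n a b → n * b + n * a + (a + b) ≡ suc n * (a + b)
  collect = ℕ-Solver.solve-∀

choose-pred : ℕ → ℕ → ℕ
choose-pred n zero    = 0
choose-pred n (suc b) = n choose b

pascal : ∀ n b → choose-pred n b + n choose b ≡ suc n choose b
pascal n zero    = refl
pascal n (suc b) = nCk+nC[k+1]≡[n+1]C[k+1] n b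

middle : ∀ b → (b + suc b) choose b ≡ (b + suc b) choose (suc b)
middle b = trans (nCk≡nC[n∸k] (m≤m+n b (suc b))) (cong ((b + suc b) choose_) (m+n∸m≡n b (suc b)))

-- The reflection formula with the subtracted binomial moved to the left. Pascal's rule matches the
-- recursion of `β`; at j = 0, where the recursion has one term only, the equality of the two middle
-- binomials supplies the rest.
ballot-formula : ∀ b j → β b j + choose-pred (b + (b + j)) b ≡ (b + (b + j)) choose b
ballot-formula zero    j       = refl
ballot-formula (suc b) zero    = begin
  β b 1 + suc n choose b
    ≡⟨ cong (β b 1 +_) (pascal n b) ⟨
  β b 1 + (choose-pred n b + n choose b)
    ≡⟨ +-assoc (β b 1) _ _ ⟨
  (β b 1 + choose-pred n b) + n choose b
    ≡⟨ cong₂ _+_ (subst (λ i → β b 1 + choose-pred i b ≡ i choose b) n₁ (ballot-formula b 1))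
         (subst (λ i → i choose b ≡ i choose (suc b)) n₂ (middle b)) ⟩
  n choose b + n choose (suc b)
    ≡⟨ nCk+nC[k+1]≡[n+1]C[k+1] n b ⟩
  suc n choose (suc b) ∎
  where
  open ≡-Reasoning
  n = b + (suc b + 0)
  n₁ : b + (b + 1) ≡ n
  n₁ = cong (b +_) (+-suc b 0)
  n₂ : b + suc b ≡ n
  n₂ = cong (λ i → b + suc i) (sym (+-identityʳ b))
ballot-formula (suc b) (suc j) = begin
  (β b (2 + j) + β (suc b) j) + suc n choose b
    ≡⟨ cong (β b (2 + j) + β (suc b) j +_) (pascal n b) ⟨
  (β b (2 + j) + β (suc b) j) + (choose-pred n b + n choose b)
    ≡⟨ exchange (β b (2 + j)) (β (suc b) j) (choose-pred n b) (n choose b) ⟩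
  (β b (2 + j) + choose-pred n b) + (β (suc b) j + n choose b)
    ≡⟨ cong₂ _+_ (subst (λ i → β b (2 + j) + choose-pred i b ≡ i choose b) n₁ (ballot-formula b (2 + j)))
         (subst (λ i → β (suc b) j + i choose b ≡ i choose (suc b)) n₂ (ballot-formula (suc b) j)) ⟩
  n choose b + n choose (suc b)
    ≡⟨ nCk+nC[k+1]≡[n+1]C[k+1] n b ⟩
  suc n choose (suc b) ∎
  where
  open ≡-Reasoning
  n = b + (suc b + suc j)
  n₁ : b + (b + (2 + j)) ≡ n
  n₁ = cong (b +_) (+-suc b (suc j))
  n₂ : suc b + (suc b + j) ≡ n
  n₂ = trans (sym (+-suc b (suc b + j))) (cong (b +_) (sym (+-suc (suc b) j)))
  exchange : ∀ a b c d → (a + b) + (c + d) ≡ (a + c) + (b + d)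
  exchange = ℕ-Solver.solve-∀

-- In `ballot-formula` the binomial of 2n over n - 1 is n / (n + 1) times the central one, so 1 / (n
-- + 1) of the central one remains.
catalan-β : ∀ n → catalan n ≡ β n 0
catalan-β zero    = refl
catalan-β (suc k) = trans (/-congˡ {o = suc (suc k)} (sym product)) (m*n/n≡m (β (suc k) 0) (suc (suc k)))
  where
  open ≡-Reasoning
  m = 2 * suc k
  a = m choose (suc k)
  b = m choose k
  absorbed : suc k * a ≡ suc (suc k) * b
  absorbed = +-cancelʳ-≡ (k * b) _ _ (trans (absorb m k) (double k b))
    where
    double : ∀ k b → 2 * suc k * b ≡ suc (suc k) * b + k * b
    double = ℕ-Solver.solve-∀
  product : β (suc k) 0 * suc (suc k) ≡ a
  product = +-cancelʳ-≡ (suc (suc k) * b) _ _ (begin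
    β (suc k) 0 * suc (suc k) + suc (suc k) * b ≡⟨ factor-out (β (suc k) 0) k b ⟩
    (β (suc k) 0 + b) * suc (suc k)               ≡⟨ cong (_* suc (suc k)) (ballot-formula (suc k) 0) ⟩
    a * suc (suc k)                                 ≡⟨ peel a k ⟩
    a + suc k * a                                 ≡⟨ cong (a +_) absorbed ⟩
    a + suc (suc k) * b                           ∎)
    where
    factor-out : ∀ x k b → x * suc (suc k) + suc (suc k) * b ≡ (x + b) * suc (suc k)
    factor-out = ℕ-Solver.solve-∀
    peel : ∀ a k → a * suc (suc k) ≡ a + suc k * a
    peel = ℕ-Solver.solve-∀

shifted-catalan : ∀ n → (C ⊖ one) (suc n) ≡ ↑ β (suc n) 0
shifted-catalan n = trans (ℤₚ.+-identityʳ _) (cong ↑_ (catalan-β (suc n)))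

-- Multiplication by 1 - x takes differences of the two partial sums, and these are consecutive
-- Catalan numbers.
catalan-quotient : conv oneMinusX catalan-part ≗ conv onePlusX (C ⊖ one)
catalan-quotient zero          = refl
catalan-quotient (suc zero)    = refl
catalan-quotient (suc (suc n)) = begin
  conv oneMinusX catalan-part (2 + n)
    ≡⟨ conv-affine (- ↑ 1) catalan-part (2 + n) ⟩
  ((↑ Σσ (suc n) ℤ.+ ↑ Σβ (suc n)) ℤ.- ↑ 1) ℤ.+ - ↑ 1 ℤ.* ((↑ Σσ n ℤ.+ ↑ Σβ n) ℤ.- ↑ 1)
    ≡⟨ cong (λ z → ((z ℤ.+ ↑ Σβ (suc n)) ℤ.- ↑ 1) ℤ.+ - ↑ 1 ℤ.* ((↑ Σσ n ℤ.+ ↑ Σβ n) ℤ.- ↑ 1))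
         (trans (cong ↑_ (Σσ-suc n)) (ℤₚ.pos-+ (Σσ n) _)) ⟩
  (((↑ Σσ n ℤ.+ ↑ β (2 + n) 0) ℤ.+ ↑ (β (suc n) 0 + Σβ n)) ℤ.- ↑ 1) ℤ.+ - ↑ 1 ℤ.* ((↑ Σσ n ℤ.+ ↑ Σβ n) ℤ.- ↑ 1)
    ≡⟨ cong (λ z → (((↑ Σσ n ℤ.+ ↑ β (2 + n) 0) ℤ.+ z) ℤ.- ↑ 1) ℤ.+ - ↑ 1 ℤ.* ((↑ Σσ n ℤ.+ ↑ Σβ n) ℤ.- ↑ 1))
         (ℤₚ.pos-+ (β (suc n) 0) (Σβ n)) ⟩
  (((↑ Σσ n ℤ.+ ↑ β (2 + n) 0) ℤ.+ (↑ β (suc n) 0 ℤ.+ ↑ Σβ n)) ℤ.- ↑ 1) ℤ.+ - ↑ 1 ℤ.* ((↑ Σσ n ℤ.+ ↑ Σβ n) ℤ.- ↑ 1)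
    ≡⟨ telescope (↑ Σσ n) (↑ Σβ n) (↑ β (2 + n) 0) (↑ β (suc n) 0) ⟩
  ↑ β (2 + n) 0 ℤ.+ ↑ 1 ℤ.* ↑ β (suc n) 0
    ≡⟨ cong₂ (λ x y → x ℤ.+ ↑ 1 ℤ.* y) (shifted-catalan (suc n)) (shifted-catalan n) ⟨
  (C ⊖ one) (2 + n) ℤ.+ ↑ 1 ℤ.* (C ⊖ one) (suc n)
    ≡⟨ conv-affine (↑ 1) (C ⊖ one) (2 + n) ⟨
  conv onePlusX (C ⊖ one) (2 + n) ∎
  where
  open ≡-Reasoning
  telescope : ∀ t s x y →
              (((t ℤ.+ x) ℤ.+ (y ℤ.+ s)) ℤ.- ↑ 1) ℤ.+ - ↑ 1 ℤ.* ((t ℤ.+ s) ℤ.- ↑ 1) ≡ x ℤ.+ ↑ 1 ℤ.* y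
  telescope = ℤ-Solver.solve-∀

-- The factor `C ⊖ one` is moved into the numerator of the quotient, where `⊘-unique` applies.
catalan-series : (onePlusX ⊘ oneMinusX) ⊛ (C ⊖ one) ≗ catalan-part
catalan-series n = begin
  ((onePlusX ⊘ oneMinusX) ⊛ G) n
    ≡⟨ ⊛-conv (onePlusX ⊘ oneMinusX) G n ⟩
  conv (onePlusX ⊘ oneMinusX) G n
    ≡⟨ conv-cong (λ i → trans (⊛-conv onePlusX (inv oneMinusX) i) (conv-comm onePlusX (inv oneMinusX) i))
         (λ _ → refl) n ⟩
  conv (conv (inv oneMinusX) onePlusX) G n
    ≡⟨ conv-assoc (inv oneMinusX) onePlusX G n ⟩
  conv (inv oneMinusX) (conv onePlusX G) n
    ≡⟨ conv-comm (inv oneMinusX) (conv onePlusX G) n ⟩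
  conv (conv onePlusX G) (inv oneMinusX) n
    ≡⟨ ⊛-conv (conv onePlusX G) (inv oneMinusX) n ⟨
  (conv onePlusX G ⊘ oneMinusX) n
    ≡⟨ ⊘-unique (conv onePlusX G) oneMinusX catalan-part refl catalan-quotient n ⟩
  catalan-part n ∎
  where
  open ≡-Reasoning
  G = C ⊖ one

theorem3p29 : (n : ℕ) → F T3p29 n ≡ rhs3p29 n
theorem3p29 n = trans (avoiders n) (sym (cong₂ ℤ._+_ (remainder-series n) (catalan-series n)))
  where
  avoiders : ∀ n → F T3p29 n ≡ remainder n ℤ.+ catalan-part n
  -- The empty permutation has no first letter to sum over.
  avoiders zero    = refl
  avoiders (suc n) = trans (cong ↑_ (countAvoiders-val value refl value-step n)) (total-closed n)
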